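{- $n_6(4) \geq 26$ and $n_7(4) \geq 30$. That is, every graph with chromatic number $4$ and girth at least $6$ has at least $26$ vertices, and every graph with chromatic number $4$ and girth at least $7$ has at least $30$ vertices.
   Context: All graphs are finite and simple. The girth of a graph is the length of its shortest cycle. For integers $g$ and $k$, $n_g(k)$ denotes the smallest order of a graph with chromatic number exactly $k$ and girth at least $g$. -}

module Defs where

open import Data.Nat using (ℕ; zero; suc; _≤_; _<_)
open import Data.Fin using (Fin; zero; suc; inject₁; fromℕ)
open import Data.Product using (Σ; _×_)
open import Relation.Nullary using (¬_)
open import Relation.Binary.Core using (Rel)
open import Relation.Binary.Definitions using (Symmetric; Irreflexive; Decidable)
open import Relation.Binary.PropositionalEquality using (_≡_)
open import Function.Definitions using (Injective)
open import Level using (0ℓ)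

record Graph (n : ℕ) : Set₁ where
  field
    Adj     : Rel (Fin n) 0ℓ
    adj?    : Decidable Adj
    sym     : Symmetric Adj
    irrefl  : Irreflexive _≡_ Adj
open Graph public

ProperColouring : ∀ {n} → Graph n → (k : ℕ) → (Fin n → Fin k) → Set
ProperColouring G k c = ∀ u v → Adj G u v → ¬ (c u ≡ c v)

Colourable : ∀ {n} → Graph n → ℕ → Set
Colourable G k = Σ (Fin _ → Fin k) (ProperColouring G k)

HasChromaticNumber : ∀ {n} → Graph n → ℕ → Set
HasChromaticNumber G zero    = Colourable G zero
HasChromaticNumber G (suc k) = Colourable G (suc k) × ¬ Colourable G k

-- A cycle of length suc k in G: distinct vertices c 0, …, c k with
-- c i ~ c (i+1) for i < k and c k ~ c 0.  (A genuine cycle needs length ≥ 3.)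
IsCycle : ∀ {n} → Graph n → (k : ℕ) → (Fin (suc k) → Fin n) → Set
IsCycle G k c =
  Injective _≡_ _≡_ c
  × (∀ (i : Fin k) → Adj G (c (inject₁ i)) (c (suc i)))
  × Adj G (c (fromℕ k)) (c zero)

-- girth at least g: no cycle of length ℓ with 3 ≤ ℓ < g
-- (acyclic graphs have infinite girth, so satisfy this for every g)
GirthAtLeast : ∀ {n} → Graph n → ℕ → Set
GirthAtLeast G g = ∀ k (c : Fin (suc k) → Fin _) → 3 ≤ suc k → suc k < g → ¬ IsCycle G k c

{-# OPTIONS --safe #-}
-- For a vertex v of a graph of girth at least 6, the vertices at distance exactly 2 from v form an independent set I.
-- If the vertices at distance at least 3 induce a bipartite graph, colouring I and v with 0, the neighbours of v
-- with 1 or 2 and the rest with 1 and 2 is a proper 3-colouring. So in a graph that is not 3-colourable the far part of every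
-- vertex contains an odd cycle, of length at least 7; a few extra recolourings near such a cycle give more.
--
-- Deleting vertices of degree at most 2 we may assume minimum degree 3.
-- Girth 6, at most 25 vertices. Two adjacent vertices u, v of degree at least 4 have at least 20 vertices within
-- distance 2, so a set R of at most 5 vertices remains; the far parts of u and of v consist of R and of an
-- independent set each, and both contain an odd cycle, which produces a cycle of length at most 5. Hence the vertices of
-- degree at least 4 are independent, and the others contain an induced odd cycle C, otherwise G is 3-colourable. Let y, y′ be the
-- neighbours outside C of two consecutive vertices of C. A 3-colouring of G − C in which y and y′ differ extends to C, and
-- it exists because G − C has at most 18 vertices: root the colouring above at a neighbour of y.
-- Girth 7, at most 29 vertices. The same argument applies. Now G − C has at most 22 vertices, and y, y′ have distance at
-- least 4 there. If the distance is at least 5, add the edge between y and y′ and use the case of girth 6; otherwise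
-- root the colouring at the middle of a path of length 4 from y to y′, or at a neighbour of y or y′.
module Submission where

open import Defs
open import Data.Bool.Base using (Bool; true; false; not; _xor_)
open import Data.Bool.Properties using (not-¬; not-involutive)
open import Data.Empty using (⊥; ⊥-elim)
open import Data.Fin.Base using (Fin; zero; suc)
open import Data.Fin.Patterns using (0F; 1F; 2F; 3F; 4F)
open import Data.Fin.Properties using (_≟_; any?)
open import Data.List.Base using (List; []; _∷_; _++_; length; map; filter; concatMap; allFin; lookup)
open import Data.List.Membership.Propositional using (_∈_; _∉_; find; lose)
open import Data.List.Membership.Propositional.Properties using (∈-++⁺ˡ; ∈-++⁺ʳ; ∈-++⁻; ∈-∃++; ∈-filter⁺; ∈-filter⁻; ∈-allFin; ∈-concatMap⁺; ∈-concatMap⁻; ∈-map⁺; ∈-lookup)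
open import Data.List.Properties using (length-++; length-map; length-tabulate; filter-notAll; filter-accept; ∷ʳ-injectiveʳ)
open import Data.List.Relation.Unary.All as All using ([]; _∷_)
open import Data.List.Relation.Unary.All.Properties using (¬Any⇒All¬)
open import Data.List.Relation.Unary.AllPairs using ([]; _∷_)
open import Data.List.Relation.Unary.Any as Any using (here; there)
open import Data.List.Relation.Unary.Unique.Propositional using (Unique)
open import Data.List.Relation.Unary.Unique.Propositional.Properties using (++⁺; filter⁺; allFin⁺)
open import Data.Maybe.Base as Maybe using (Maybe; just; nothing)
open import Data.Nat.Base using (ℕ; zero; suc; _+_; _*_; _≤_; _<_; z≤n; s≤s; s≤s⁻¹)
open import Data.Nat.Induction using (<-rec)
open import Data.Nat.Properties as ℕₚ using (≤-trans; ≤-refl; ≤-reflexive; n≤1+n; m≤m+n; m≤n+m; +-mono-≤; +-monoˡ-≤; +-monoʳ-≤; +-comm; +-assoc; +-suc; +-identityʳ; ≰⇒>; _≤?_; _<?_)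
open import Data.Product.Base using (Σ; ∃; ∃₂; _×_; _,_; proj₁; proj₂)
open import Data.Sum.Base using (_⊎_; inj₁; inj₂; [_,_]′)
open import Data.Unit.Base using (⊤; tt)
open import Function.Base using (_∘_; id; case_of_)
open import Relation.Binary.PropositionalEquality as ≡ using (_≡_; _≢_; refl; cong; subst; trans)
open import Relation.Nullary using (¬_; Dec; does; yes; no; contradiction; ¬?; _×-dec_; _⊎-dec_; True; toWitness)
open import Relation.Unary using (Decidable)

-- The demand that `y` and `y′` differ in colour is encoded as an edge between them, so that it
-- takes part in the deletion of vertices of degree at most 2: the graph with this edge has to be
-- 3-coloured, while the girth condition concerns the graph without it. There `y` and `y′` may have
-- degree 2, and every count of a ball has to pay for these two defects. A root next to `y` leaves
-- the colour of `y` free only as long as the other neighbours of `y` keep colour 0. These form the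
-- list `K`, and they restrict the recolourings near an odd cycle. In return each of them enlarges
-- the ball around the root, so the far part and `K` together have at most 10 elements; this
-- exchange closes the case of 18 vertices. The constants 18 and 22 are 25 - 7 and 29 - 7, as the
-- removed odd cycle has length at least 7. Deleted vertices stay in the vertex type as isolated
-- ones, so only vertices with a neighbour are counted. Colourability is refuted or derived under
-- double negation throughout, which permits classical case distinctions on reachability.

module _ {A : Set} where

  unique⊆⇒length≤ : {xs ys : List A} → Unique xs → (∀ {x} → x ∈ xs → x ∈ ys) → length xs ≤ length ys
  unique⊆⇒length≤ {[]}     _        _   = z≤n
  unique⊆⇒length≤ {x ∷ xs} (x≢ ∷ u) sub with as , bs , refl ← ∈-∃++ (sub (here refl)) =
    ≤-trans (s≤s (unique⊆⇒length≤ u sub′)) (≤-reflexive (≡.sym len))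
    where
    len : length (as ++ x ∷ bs) ≡ suc (length (as ++ bs))
    len = trans (length-++ as) (trans (+-suc _ _) (cong suc (≡.sym (length-++ as))))
    sub′ : ∀ {z} → z ∈ xs → z ∈ as ++ bs
    sub′ z∈ with ∈-++⁻ as (sub (there z∈))
    ... | inj₁ z∈as = ∈-++⁺ˡ z∈as
    ... | inj₂ (here refl) = contradiction refl (All.lookup x≢ z∈)
    ... | inj₂ (there z∈bs) = ∈-++⁺ʳ as z∈bs

  unique-∷ : {x : A} {xs : List A} → x ∉ xs → Unique xs → Unique (x ∷ xs)
  unique-∷ x∉ u = ¬Any⇒All¬ _ x∉ ∷ u

  unique-++ : {xs ys : List A} → Unique xs → Unique ys → (∀ {z} → z ∈ xs → z ∈ ys → ⊥) → Unique (xs ++ ys)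
  unique-++ ux uy d = ++⁺ ux uy (λ (p , q) → d p q)

  module _ {B : Set} (f : B → List A) where

    ∈concatMap⁻ : ∀ {y} xs → y ∈ concatMap f xs → ∃ λ x → x ∈ xs × y ∈ f x
    ∈concatMap⁻ xs y∈ = find (∈-concatMap⁻ f {xs = xs} y∈)

    ∈concatMap⁺ : ∀ {y x xs} → x ∈ xs → y ∈ f x → y ∈ concatMap f xs
    ∈concatMap⁺ x∈ y∈ = ∈-concatMap⁺ f (lose x∈ y∈)

    unique-concatMap : ∀ {xs} → Unique xs → (∀ {x} → x ∈ xs → Unique (f x)) →
      (∀ {x y z} → x ∈ xs → y ∈ xs → x ≢ y → z ∈ f x → z ∈ f y → ⊥) → Unique (concatMap f xs)
    unique-concatMap {[]} _ _ _ = []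
    unique-concatMap {x ∷ xs} (x≢ ∷ u) uf d =
      unique-++ (uf (here refl)) (unique-concatMap u (uf ∘ there) (λ p q → d (there p) (there q)))
        λ z∈ z∈′ → let y , y∈ , z∈y = ∈concatMap⁻ xs z∈′ in
          d (here refl) (there y∈) (All.lookup x≢ y∈) z∈ z∈y

    length-concatMap-≤ : ∀ {m} xs → (∀ {x} → x ∈ xs → length (f x) ≤ m) → length (concatMap f xs) ≤ length xs * m
    length-concatMap-≤ [] _ = z≤n
    length-concatMap-≤ (x ∷ xs) h = ≤-trans (≤-reflexive (length-++ (f x)))
      (+-mono-≤ (h (here refl)) (length-concatMap-≤ xs (h ∘ there)))

    -- The list `es` names the defective branches, each at most `s` short of `m`. In the counts of
    -- balls these are the branches that may contain a vertex of degree 2.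
    length-concatMap-≥ : ∀ {m s} xs (es : List B) → Unique xs →
      (∀ {x} → x ∈ xs → x ∈ es ⊎ m ≤ length (f x)) → (∀ {x} → x ∈ xs → m ≤ length (f x) + s) →
      length xs * m ≤ length (concatMap f xs) + length es * s
    length-concatMap-≥ [] es _ _ _ = z≤n
    length-concatMap-≥ {m} {s} (x ∷ xs) es (x≢ ∷ u) h k with h (here refl)
    ... | inj₂ m≤ = ≤-trans (+-mono-≤ m≤ (length-concatMap-≥ xs es u (h ∘ there) (k ∘ there)))
      (≤-reflexive (trans (≡.sym (+-assoc (length (f x)) _ _)) (cong (_+ _) (≡.sym (length-++ (f x))))))
    -- Since `xs` has no repetition, an exceptional entry can be struck from `es` once it has been
    -- paid for.
    ... | inj₁ x∈es with as , bs , refl ← ∈-∃++ x∈es =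
      ≤-trans (+-mono-≤ (k (here refl)) (length-concatMap-≥ xs (as ++ bs) u h′ (k ∘ there))) (≤-reflexive eq)
      where
      h′ : ∀ {z} → z ∈ xs → z ∈ as ++ bs ⊎ m ≤ length (f z)
      h′ z∈ with h (there z∈)
      ... | inj₂ q = inj₂ q
      ... | inj₁ z∈es with ∈-++⁻ as z∈es
      ... | inj₁ q = inj₁ (∈-++⁺ˡ q)
      ... | inj₂ (here refl) = contradiction refl (All.lookup x≢ z∈)
      ... | inj₂ (there q) = inj₁ (∈-++⁺ʳ as q)
      len : length (as ++ x ∷ bs) ≡ suc (length (as ++ bs))
      len = trans (length-++ as) (trans (+-suc _ _) (cong suc (≡.sym (length-++ as))))
      eq : length (f x) + s + (length (concatMap f xs) + length (as ++ bs) * s)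
         ≡ length (f x ++ concatMap f xs) + length (as ++ x ∷ bs) * s
      eq rewrite len | length-++ (f x) {concatMap f xs} = interchange (length (f x)) s _ _
        where
        interchange : ∀ a b c d → a + b + (c + d) ≡ a + c + (b + d)
        interchange a b c d = trans (+-assoc a b _) (trans (cong (a +_)
          (trans (≡.sym (+-assoc b c d)) (trans (cong (_+ d) (+-comm b c)) (+-assoc c b d)))) (≡.sym (+-assoc a c _)))

-- The summand `m` on the right replaces a subtraction: the branch of `y` counts with its own
-- length. In `separation-core` that length is tied to `K`.
length-concatMap-∋ : ∀ {A B : Set} (f : B → List A) {m y xs} → y ∈ xs → Unique xs →
  (∀ {x} → x ∈ xs → x ≢ y → m ≤ length (f x)) → length (f y) + length xs * m ≤ length (concatMap f xs) + m
length-concatMap-∋ f {m} {y} {.y ∷ xs} (here refl) (x≢ ∷ u) h = begin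
    length (f y) + (m + length xs * m)               ≤⟨ +-monoʳ-≤ (length (f y)) (+-monoʳ-≤ m
      (≤-trans (length-concatMap-≥ f {s = 0} xs [] u (λ x∈ → inj₂ (h (there x∈) λ { refl → All.lookup x≢ x∈ refl }))
        (λ x∈ → ≤-trans (h (there x∈) λ { refl → All.lookup x≢ x∈ refl }) (m≤m+n _ 0))) (≤-reflexive (+-identityʳ _)))) ⟩
    length (f y) + (m + length (concatMap f xs))     ≡⟨ cong (length (f y) +_) (+-comm m _) ⟩
    length (f y) + (length (concatMap f xs) + m)     ≡⟨ ≡.sym (+-assoc (length (f y)) _ m) ⟩
    length (f y) + length (concatMap f xs) + m       ≡⟨ cong (_+ m) (≡.sym (length-++ (f y))) ⟩
    length (f y ++ concatMap f xs) + m ∎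
  where open ℕₚ.≤-Reasoning
length-concatMap-∋ f {m} {y} {x ∷ xs} (there y∈) (x≢ ∷ u) h = begin
    length (f y) + (m + length xs * m)               ≡⟨ ≡.sym (+-assoc (length (f y)) m _) ⟩
    length (f y) + m + length xs * m                 ≡⟨ cong (_+ length xs * m) (+-comm (length (f y)) m) ⟩
    m + length (f y) + length xs * m                 ≡⟨ +-assoc m _ _ ⟩
    m + (length (f y) + length xs * m)               ≤⟨ +-mono-≤ (h (here refl) (All.lookup x≢ y∈)) (length-concatMap-∋ f y∈ u (h ∘ there)) ⟩
    length (f x) + (length (concatMap f xs) + m)     ≡⟨ ≡.sym (+-assoc (length (f x)) _ m) ⟩
    length (f x) + length (concatMap f xs) + m       ≡⟨ cong (_+ m) (≡.sym (length-++ (f x))) ⟩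
    length (f x ++ concatMap f xs) + m ∎
  where open ℕₚ.≤-Reasoning

length-concatMap-≤-∋ : ∀ {A B : Set} (f : B → List A) {m s y} xs → y ∈ xs → (∀ {x} → x ∈ xs → length (f x) ≤ m) →
  s + length (f y) ≤ m → s + length (concatMap f xs) ≤ length xs * m
length-concatMap-≤-∋ f {m} {s} (y ∷ xs) (here refl) h le = ≤-trans
  (≤-reflexive (trans (cong (s +_) (length-++ (f y))) (≡.sym (+-assoc s _ _))))
  (+-mono-≤ le (length-concatMap-≤ f xs (h ∘ there)))
length-concatMap-≤-∋ f {m} {s} (x ∷ xs) (there y∈) h le = ≤-trans
  (≤-reflexive (trans (cong (s +_) (trans (length-++ (f x)) (+-comm (length (f x)) _))) (trans (≡.sym (+-assoc s _ _)) (+-comm _ (length (f x))))))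
  (+-mono-≤ (h (here refl)) (length-concatMap-≤-∋ f xs y∈ (h ∘ there) le))

infix 4 _∈?_

_∈?_ : ∀ {n} (x : Fin n) xs → Dec (x ∈ xs)
x ∈? xs = Any.any? (x ≟_) xs

-- For numerals the hidden `True` is found by evaluation, so an impossible count is refuted by
-- exhibiting it.
≤-absurd : ∀ {a b} {_ : True (suc b ≤? a)} → a ≤ b → ⊥
≤-absurd {_} {_} {b<a} a≤b = ℕₚ.<⇒≱ (toWitness b<a) a≤b

-- Non-backtracking walks, trees of bounded depth and distance layers

module Neighbourhoods {n : ℕ} (G : Graph n) where

  infix 4 _∼_ _∼?_

  _∼_ : Fin n → Fin n → Set
  _∼_ = Adj G

  _∼?_ : ∀ u v → Dec (u ∼ v)
  _∼?_ = adj? G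

  ∼-sym : ∀ {u v} → u ∼ v → v ∼ u
  ∼-sym = Graph.sym G

  ∼⇒≢ : ∀ {u v} → u ∼ v → u ≢ v
  ∼⇒≢ p e = Graph.irrefl G e p

  -- Deleting a vertex removes its edges but keeps it in `Fin n`; the order of a subgraph is
  -- therefore measured by its non-isolated vertices.
  Active : Fin n → Set
  Active v = ∃ (v ∼_)

  Bound : ℕ → Set
  Bound k = ∀ xs → Unique xs → (∀ {x} → x ∈ xs → Active x) → length xs ≤ k

  nbrs : Fin n → List (Fin n)
  nbrs v = filter (v ∼?_) (allFin n)

  deg : Fin n → ℕ
  deg v = length (nbrs v)

  kid? : ∀ p a x → Dec (a ∼ x × x ≢ p)
  kid? p a x = (a ∼? x) ×-dec ¬? (x ≟ p)

  -- kids a a is the list of all neighbours of a.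
  kids : Fin n → Fin n → List (Fin n)
  kids p a = filter (kid? p a) (allFin n)

  nbrs-unique : ∀ v → Unique (nbrs v)
  nbrs-unique v = filter⁺ (v ∼?_) (allFin⁺ n)

  kids-unique : ∀ p a → Unique (kids p a)
  kids-unique p a = filter⁺ (kid? p a) (allFin⁺ n)

  ∈nbrs⁺ : ∀ {v x} → v ∼ x → x ∈ nbrs v
  ∈nbrs⁺ = ∈-filter⁺ _ (∈-allFin _)

  ∈nbrs⁻ : ∀ {v x} → x ∈ nbrs v → v ∼ x
  ∈nbrs⁻ {v} x∈ = proj₂ (∈-filter⁻ (v ∼?_) {xs = allFin n} x∈)

  ∈kids⁺ : ∀ {p a x} → a ∼ x → x ≢ p → x ∈ kids p a
  ∈kids⁺ e ne = ∈-filter⁺ _ (∈-allFin _) (e , ne)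

  ∈kids⁻ : ∀ {p a x} → x ∈ kids p a → a ∼ x × x ≢ p
  ∈kids⁻ {p} {a} x∈ = proj₂ (∈-filter⁻ (kid? p a) {xs = allFin n} x∈)

  deg≤1+kids : ∀ p a → deg a ≤ suc (length (kids p a))
  deg≤1+kids p a = unique⊆⇒length≤ (nbrs-unique a) λ {x} x∈ → case x ≟ p of λ where
    (yes refl) → here refl
    (no x≢p)   → there (∈kids⁺ (∈nbrs⁻ x∈) x≢p)

  deg≤kids : ∀ a → deg a ≤ length (kids a a)
  deg≤kids a = unique⊆⇒length≤ (nbrs-unique a) λ x∈ → ∈kids⁺ (∈nbrs⁻ x∈) (∼⇒≢ (∼-sym (∈nbrs⁻ x∈)))

  kids≤deg : ∀ a → length (kids a a) ≤ deg a
  kids≤deg a = unique⊆⇒length≤ (kids-unique a a) λ x∈ → ∈nbrs⁺ (proj₁ (∈kids⁻ x∈))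

  1+kids≤deg : ∀ {p a} → a ∼ p → suc (length (kids p a)) ≤ deg a
  1+kids≤deg a∼p = unique⊆⇒length≤ (unique-∷ (λ p∈ → proj₂ (∈kids⁻ p∈) refl) (kids-unique _ _))
    λ { (here refl) → ∈nbrs⁺ a∼p ; (there x∈) → ∈nbrs⁺ (proj₁ (∈kids⁻ x∈)) }

  -- NB p a x k: a non-backtracking walk of k steps from a to x whose first step is not to p.
  data NB : Fin n → Fin n → Fin n → ℕ → Set where
    stop : ∀ {p a} → NB p a a 0
    step : ∀ {p a b x k} → a ∼ b → b ≢ p → NB a b x k → NB p a x (suc k)

  -- Girth at least g, in terms of closed walks that backtrack at most at their base.
  NoClosed : ℕ → Set
  NoClosed g = ∀ {a k} → suc k < g → ¬ NB a a a (suc k)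

  noClosed-mono : ∀ {g h} → g ≤ h → NoClosed h → NoClosed g
  noClosed-mono g≤h nc k<g = nc (≤-trans k<g g≤h)

  module _ {g : ℕ} (nc : NoClosed g) where

    noReturn : ∀ {p a k} → suc k < g → ¬ NB p a a (suc k)
    noReturn k<g (step e _ w) = nc k<g (step e (∼⇒≢ (∼-sym e)) w)

    -- Reversing the first walk step by step onto the second moves the edge `p ∼ a` along it. What
    -- remains is a closed walk of length `j + k + 1` that backtracks at most at its base.
    meet : ∀ {p a x j k} → p ∼ a → NB p a x j → NB a p x k → suc (j + k) < g → ⊥
    meet p∼a stop w lt = nc lt (step (∼-sym p∼a) (∼⇒≢ p∼a) w)
    meet {k = k} p∼a (step {k = j} a∼b b≢p w) w′ lt =
      meet a∼b w (step (∼-sym p∼a) (b≢p ∘ ≡.sym) w′) (subst (λ m → suc m < g) (≡.sym (+-suc j k)) lt)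

  -- The tree of depth `d` hanging at `a` on the side away from `p`. Taking `p = a` excludes
  -- nothing, so `sub d a a` is the whole ball of radius `d`.
  sub : ℕ → Fin n → Fin n → List (Fin n)
  sub zero    p a = a ∷ []
  sub (suc d) p a = a ∷ concatMap (sub d a) (kids p a)

  ∈sub⁻ : ∀ d {p a x} → x ∈ sub d p a → ∃ λ k → k ≤ d × NB p a x k
  ∈sub⁻ zero (here refl) = 0 , z≤n , stop
  ∈sub⁻ (suc d) (here refl) = 0 , z≤n , stop
  ∈sub⁻ (suc d) {p} {a} (there x∈) =
    let b , b∈ , x∈b = ∈concatMap⁻ (sub d a) (kids p a) x∈
        k , k≤ , w   = ∈sub⁻ d x∈b
        e , ne       = ∈kids⁻ b∈
    in suc k , s≤s k≤ , step e ne w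

  ∈sub⁺ : ∀ {d k p a x} → k ≤ d → NB p a x k → x ∈ sub d p a
  ∈sub⁺ {zero}  z≤n stop = here refl
  ∈sub⁺ {suc d} z≤n stop = here refl
  ∈sub⁺ (s≤s k≤) (step e ne w) = there (∈concatMap⁺ (sub _ _) (∈kids⁺ e ne) (∈sub⁺ k≤ w))

  -- A repetition gives two walks that part below a common vertex and meet again, or one that
  -- returns to its start: in both cases a closed walk of length at most `2d`.
  sub-unique : ∀ {g} → NoClosed g → ∀ d {p a} → d + d < g → Unique (sub d p a)
  sub-unique nc zero _ = [] ∷ []
  sub-unique {g} nc (suc d) {p} {a} lt = unique-∷ a∉
    (unique-concatMap (sub d a) (kids-unique p a) (λ _ → sub-unique nc d (≤-trans (s≤s (≤-trans (m≤n+m _ 2) (≤-reflexive eq))) lt)) disj)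
    where
    eq : suc (suc (d + d)) ≡ suc d + suc d
    eq = cong suc (≡.sym (+-suc d d))
    a∉ : a ∉ concatMap (sub d a) (kids p a)
    a∉ x∈ with b , b∈ , x∈b ← ∈concatMap⁻ (sub d a) (kids p a) x∈
      with k , k≤ , w ← ∈sub⁻ d x∈b with e , ne ← ∈kids⁻ b∈ =
      noReturn nc (≤-trans (s≤s (s≤s (≤-trans k≤ (m≤m+n d (suc d))))) lt) (step e ne w)
    disj : ∀ {x y z} → x ∈ kids p a → y ∈ kids p a → x ≢ y → z ∈ sub d a x → z ∈ sub d a y → ⊥
    disj x∈ y∈ x≢y z∈x z∈y with j , j≤ , w ← ∈sub⁻ d z∈x | k , k≤ , w′ ← ∈sub⁻ d z∈y
      with ex , _ ← ∈kids⁻ x∈ | ey , _ ← ∈kids⁻ y∈ =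
      meet nc ex w (step ey (x≢y ∘ ≡.sym) w′) (≤-trans (s≤s (s≤s (+-mono-≤ j≤ (s≤s k≤)))) lt)

  -- A vertex common to the trees at the two ends closes a walk through the edge, of length at most
  -- `d + e + 1`.
  edge-subs-unique : ∀ {g} → NoClosed g → ∀ d e {u v} → u ∼ v → d + d < g → e + e < g → suc (d + e) < g →
    Unique (sub d v u ++ sub e u v)
  edge-subs-unique nc d e u∼v dd ee de = unique-++ (sub-unique nc d dd) (sub-unique nc e ee) λ x∈ x∈′ →
    let _ , j≤ , w = ∈sub⁻ d x∈ ; _ , k≤ , w′ = ∈sub⁻ e x∈′
    in meet nc (∼-sym u∼v) w w′ (≤-trans (s≤s (s≤s (+-mono-≤ j≤ k≤))) de)

  sub-active : ∀ d {p a x} → Active a → x ∈ sub d p a → Active x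
  sub-active d act x∈ = nb-active act (proj₂ (proj₂ (∈sub⁻ d x∈)))
    where
    nb-active : ∀ {p a x k} → Active a → NB p a x k → Active x
    nb-active act stop = act
    nb-active _ (step e _ w) = nb-active (_ , ∼-sym e) w

  module ShortCycles (nc : NoClosed 6) where

    no3 : ∀ {a b c} → a ∼ b → b ∼ c → c ∼ a → ⊥
    no3 ab bc ca = nc {k = 2} (s≤s (s≤s (s≤s (s≤s z≤n))))
      (step ab (∼⇒≢ (∼-sym ab)) (step bc (∼⇒≢ ca) (step ca (∼⇒≢ ab) stop)))

    no4 : ∀ {a b c d} → a ∼ b → b ∼ c → c ∼ d → d ∼ a → a ≢ c → b ≢ d → ⊥
    no4 ab bc cd da a≢c b≢d = nc {k = 3} (s≤s (s≤s (s≤s (s≤s (s≤s z≤n)))))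
      (step ab (∼⇒≢ (∼-sym ab)) (step bc (a≢c ∘ ≡.sym) (step cd (b≢d ∘ ≡.sym) (step da a≢c stop))))

    -- If two vertices at distance 2 along the closed walk coincide, the other three steps form a
    -- triangle.
    no5 : ∀ {a b c d e} → a ∼ b → b ∼ c → c ∼ d → d ∼ e → e ∼ a → ⊥
    no5 {a} {b} {c} {d} {e} ab bc cd de ea = nc {k = 4} ≤-refl
      (step ab (∼⇒≢ (∼-sym ab)) (step bc (λ { refl → no3 cd de ea })
      (step cd (λ { refl → no3 ab de ea }) (step de (λ { refl → no3 ab bc ea }) (step ea (λ { refl → no3 ab bc cd }) stop)))))

  module _ (v : Fin n) where

    data Layer (u : Fin n) : Set where
      root   : u ≡ v → Layer u
      first  : v ∼ u → Layer u
      second : ∀ {a} → u ≢ v → ¬ v ∼ u → v ∼ a → a ∼ u → Layer u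
      beyond : u ≢ v → ¬ v ∼ u → (∀ {a} → v ∼ a → ¬ a ∼ u) → Layer u

    -- Orders the ends of an edge, which halves the cases when a colouring by layers is checked.
    rank : ∀ {u} → Layer u → ℕ
    rank (root _)         = 0
    rank (first _)        = 1
    rank (second _ _ _ _) = 2
    rank (beyond _ _ _)   = 3

    layer : ∀ u → Layer u
    layer u with u ≟ v
    ... | yes e = root e
    ... | no u≢v with v ∼? u
    ...   | yes e = first e
    ...   | no v≁u with any? (λ a → (v ∼? a) ×-dec (a ∼? u))
    ...     | yes (a , e , e′) = second u≢v v≁u e e′
    ...     | no none = beyond u≢v v≁u (λ {a} e e′ → none (a , e , e′))

    Far : Fin n → Set
    Far u = u ≢ v × ¬ v ∼ u × (∀ {a} → v ∼ a → ¬ a ∼ u)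

    Second : Fin n → Set
    Second u = u ≢ v × ∃ λ a → v ∼ a × a ∼ u

    second∉far : ∀ {q} → Second q → ¬ Far q
    second∉far (_ , _ , e , e′) (_ , _ , none) = none e e′

    far∉sub : ∀ {p x} → Far x → x ∉ sub 2 p v
    far∉sub (x≢v , v≁x , none) x∈ with ∈sub⁻ 2 x∈
    ... | 0 , _ , stop = x≢v refl
    ... | 1 , _ , step e _ stop = v≁x e
    ... | 2 , _ , step e _ (step e′ _ stop) = none e e′
    ... | suc (suc (suc _)) , s≤s (s≤s ()) , _

  -- Colourings determined by the distance from a root

  Col : Set
  Col = Colourable G 3

  col : Bool → Fin 3
  col false = 1F
  col true  = 2F

  col-inj : ∀ {a b} → col a ≡ col b → a ≡ b
  col-inj {false} {false} _ = refl
  col-inj {true} {true} _ = refl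

  col≢0 : ∀ {a} → col a ≢ 0F
  col≢0 {false} ()
  col≢0 {true} ()

  -- The colouring that gives 0 to v, to the second neighbourhood of v minus Q and to J,
  -- and the colours 1 and 2 to the other vertices.
  module RootColouring (nc : NoClosed 6) (v : Fin n) {J Q : Fin n → Set} (J? : Decidable J) (Q? : Decidable Q)
    (g b : Fin n → Bool) where

    open ShortCycles nc

    QKid : Fin n → Set
    QKid a = ∃ λ q → a ∼ q × q ≢ v × Q q

    qkid? : ∀ a → Dec (QKid a)
    qkid? a = any? (λ q → (a ∼? q) ×-dec (¬? (q ≟ v) ×-dec Q? q))

    -- A vertex `q` in `Q` gives up colour 0 for the colour opposite to `b q`, where `b q` is the
    -- common colour of its far neighbours outside `J`. Its neighbour next to `v` must then take
    -- `b q`; a neighbour of `v` with no such `q` below it is free to take either value of `d`.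
    firstColour : Bool → ∀ {a} → Dec (QKid a) → Fin 3
    firstColour d (yes (q , _)) = col (b q)
    firstColour d (no _)        = col d

    secondColour : ∀ u → Dec (Q u) → Fin 3
    secondColour u (yes _) = col (not (b u))
    secondColour u (no _)  = 0F

    farColour : ∀ u → Dec (J u) → Fin 3
    farColour u (yes _) = 0F
    farColour u (no _)  = col (g u)

    colour : Bool → ∀ {u} → Layer v u → Fin 3
    colour d {u} (root _)         = 0F
    colour d {u} (first _)        = firstColour d (qkid? u)
    colour d {u} (second _ _ _ _) = secondColour u (Q? u)
    colour d {u} (beyond _ _ _)   = farColour u (J? u)

    rootColouring : Bool → Fin n → Fin 3
    rootColouring d u = colour d (layer v u)

    module _
      (J-indep : ∀ {x y} → J x → J y → x ∼ y → ⊥)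
      (g-proper : ∀ {x y} → Far v x → Far v y → ¬ J x → ¬ J y → x ∼ y → g x ≢ g y)
      (J-nbrs : ∀ {q x} → Second v q → Far v x → J x → q ∼ x → Q q)
      (b-nbrs : ∀ {q x} → Second v q → Q q → Far v x → ¬ J x → q ∼ x → g x ≡ b q)
      -- Two recoloured vertices below the same neighbour of `v` could demand different colours of
      -- it.
      (Q-sparse : ∀ {a q q′} → v ∼ a → a ∼ q → a ∼ q′ → q ≢ v → q′ ≢ v → Q q → Q q′ → q ≡ q′)
      where

      ordered : ∀ d {u w} → u ∼ w → (s : Layer v u) (t : Layer v w) → rank v s ≤ rank v t → colour d s ≡ colour d t → ⊥
      ordered d e (root refl) (root refl) _ _ = ∼⇒≢ e refl
      ordered d {w = w} e (root refl) (first _) _ eq with qkid? w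
      ... | yes _ = col≢0 (≡.sym eq)
      ... | no _ = col≢0 (≡.sym eq)
      ordered d e (root refl) (second _ v≁ _ _) _ _ = v≁ e
      ordered d e (root refl) (beyond _ v≁ _) _ _ = v≁ e
      ordered d e (first a) (first b) _ _ = no3 a e (∼-sym b)
      ordered d {u} {w} e (first a) (second w≢v _ _ _) _ eq with qkid? u | Q? w
      ... | yes (q , uq , q≢ , Qq) | yes Qw rewrite Q-sparse a uq e q≢ w≢v Qq Qw = not-¬ refl (col-inj eq)
      ... | yes _ | no _ = col≢0 eq
      ... | no none | yes Qw = none (w , e , w≢v , Qw)
      ... | no _ | no _ = col≢0 eq
      ordered d e (first a) (beyond _ _ none) _ _ = none a e
      ordered d e (second _ _ va au) (second _ _ vb bw) _ _ = no5 va au e (∼-sym bw) (∼-sym vb)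
      ordered d {u} {w} e (second u≢ _ va au) (beyond p q r) _ eq with Q? u | J? w
      ... | yes _ | yes _ = col≢0 eq
      ... | yes Qu | no ¬Jw = not-¬ (b-nbrs (u≢ , _ , va , au) Qu (p , q , r) ¬Jw e) (≡.sym (col-inj eq))
      ... | no ¬Qu | yes Jw = ¬Qu (J-nbrs (u≢ , _ , va , au) (p , q , r) Jw e)
      ... | no _ | no _ = col≢0 (≡.sym eq)
      ordered d {u} {w} e (beyond p q r) (beyond p′ q′ r′) _ eq with J? u | J? w
      ... | yes Ju | yes Jw = J-indep Ju Jw e
      ... | yes _ | no _ = col≢0 (≡.sym eq)
      ... | no _ | yes _ = col≢0 eq
      ... | no ¬Ju | no ¬Jw = g-proper (p , q , r) (p′ , q′ , r′) ¬Ju ¬Jw e (col-inj eq)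
      ordered d _ (first _) (root _) ()
      ordered d _ (second _ _ _ _) (root _) ()
      ordered d _ (second _ _ _ _) (first _) (s≤s ())
      ordered d _ (beyond _ _ _) (root _) ()
      ordered d _ (beyond _ _ _) (first _) (s≤s ())
      ordered d _ (beyond _ _ _) (second _ _ _ _) (s≤s (s≤s ()))

      rootColouring-proper : ∀ d → ProperColouring G 3 (rootColouring d)
      rootColouring-proper d u w e eq with ℕₚ.≤-total (rank v (layer v u)) (rank v (layer v w))
      ... | inj₁ le = ordered d e (layer v u) (layer v w) le eq
      ... | inj₂ le = ordered d (∼-sym e) (layer v w) (layer v u) le (≡.sym eq)

    rootColouring-second : ∀ d {u} → Second v u → ¬ Q u → rootColouring d u ≡ 0F
    rootColouring-second d {u} (u≢v , a , va , au) ¬Q with layer v u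
    ... | root e = contradiction e u≢v
    ... | first vu = ⊥-elim (no3 va au (∼-sym vu))
    ... | beyond _ _ none = ⊥-elim (none va au)
    ... | second _ _ _ _ with Q? u
    ...   | yes q = contradiction q ¬Q
    ...   | no _ = refl

    rootColouring-Q : ∀ d {u} → Second v u → Q u → rootColouring d u ≢ 0F
    rootColouring-Q d {u} (u≢v , a , va , au) Qu with layer v u
    ... | root e = contradiction e u≢v
    ... | first vu = ⊥-elim (no3 va au (∼-sym vu))
    ... | beyond _ _ none = ⊥-elim (none va au)
    ... | second _ _ _ _ with Q? u
    ...   | yes q = col≢0
    ...   | no ¬q = contradiction Qu ¬q

    -- Away from the neighbours of v the parameter d plays no role,
    -- and a neighbour of v without a child in Q takes either colour.
    rootColouring-separates : ∀ {y y′} → v ∼ y → ¬ QKid y → ¬ v ∼ y′ →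
      (∀ d → rootColouring d y ≡ rootColouring d y′) → ⊥
    rootColouring-separates {y} {y′} vy ¬k v≁y′ eq = contra (trans (eq false) (trans const (≡.sym (eq true))))
      where
      const : rootColouring false y′ ≡ rootColouring true y′
      const with layer v y′
      ... | root _ = refl
      ... | first e = contradiction e v≁y′
      ... | second _ _ _ _ = refl
      ... | beyond _ _ _ = refl
      contra : rootColouring false y ≢ rootColouring true y
      contra with layer v y
      ... | root refl = contradiction refl (∼⇒≢ vy)
      ... | second _ v≁ _ _ = contradiction vy v≁
      ... | beyond _ v≁ _ = contradiction vy v≁
      ... | first _ with qkid? y
      ...   | yes k = contradiction k ¬k
      ...   | no _ = λ ()

-- Classical choice over finite types, and parity

¬¬-Fin : ∀ {m} {P : Fin m → Set} → (∀ i → ¬ ¬ P i) → ¬ ¬ (∀ i → P i)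
¬¬-Fin {zero}  _ k = k (λ ())
¬¬-Fin {suc m} h k = h zero λ p₀ → ¬¬-Fin (h ∘ suc) λ ps → k λ { zero → p₀ ; (suc i) → ps i }

¬¬-dec : ∀ {A : Set} → ¬ ¬ Dec A
¬¬-dec k = k (no (k ∘ yes))

firstSuch : ∀ {m} {P : Fin m → Set} → Decidable P → Maybe (Fin m)
firstSuch {zero}  P? = nothing
firstSuch {suc m} P? with P? zero
... | yes _ = just zero
... | no _  = Maybe.map suc (firstSuch (P? ∘ suc))

-- Adjacent vertices are reachable from the same vertices; hence they select the same root, and the
-- 2-colouring by parity is consistent within a component.
firstSuch-cong : ∀ {m} {P Q : Fin m → Set} (P? : Decidable P) (Q? : Decidable Q) →
  (∀ i → P i → Q i) → (∀ i → Q i → P i) → firstSuch P? ≡ firstSuch Q?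
firstSuch-cong {zero} P? Q? to from = refl
firstSuch-cong {suc m} P? Q? to from with P? zero | Q? zero
... | yes _ | yes _ = refl
... | no _  | no _  = cong (Maybe.map suc) (firstSuch-cong (P? ∘ suc) (Q? ∘ suc) (to ∘ suc) (from ∘ suc))
... | yes p | no ¬q = contradiction (to _ p) ¬q
... | no ¬p | yes q = contradiction (from _ q) ¬p

firstSuch-sound : ∀ {m} {P : Fin m → Set} (P? : Decidable P) {r} → firstSuch P? ≡ just r → P r
firstSuch-sound {suc m} P? eq with P? zero
firstSuch-sound {suc m} P? refl | yes p = p
... | no _ with firstSuch (P? ∘ suc) in eq′
firstSuch-sound {suc m} P? refl | no _ | just _ = firstSuch-sound (P? ∘ suc) eq′

firstSuch-complete : ∀ {m} {P : Fin m → Set} (P? : Decidable P) → firstSuch P? ≡ nothing → ∀ i → ¬ P i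
firstSuch-complete {suc m} P? eq i p with P? zero
... | no ¬p with firstSuch (P? ∘ suc) in eq′
firstSuch-complete {suc m} P? eq zero p | no ¬p | nothing = ¬p p
firstSuch-complete {suc m} P? eq (suc i) p | no ¬p | nothing = firstSuch-complete (P? ∘ suc) eq′ i p

odd : ℕ → Bool
odd zero    = false
odd (suc k) = not (odd k)

odd-+ : ∀ j k → odd (j + k) ≡ odd j xor odd k
odd-+ zero    k = refl
odd-+ (suc j) k rewrite odd-+ j k with odd j | odd k
... | false | _     = refl
... | true  | false = refl
... | true  | true  = refl

odd-+⇒ : ∀ j k → odd (j + k) ≡ true → odd j ≡ true ⊎ odd k ≡ true
odd-+⇒ j k eq rewrite odd-+ j k with odd j | odd k
... | true  | _    = inj₁ refl
... | false | true = inj₂ refl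

-- The numbers `p` and `q` differ in parity, so `e` differs in parity from one of them.
odd-detour : ∀ p q e → odd (p + q) ≡ true → odd (e + q) ≡ true ⊎ odd (p + e) ≡ true
odd-detour p q e eq rewrite odd-+ p q | odd-+ e q | odd-+ p e with odd p | odd q | odd e
... | true  | false | true  = inj₁ refl
... | true  | false | false = inj₂ refl
... | false | true  | false = inj₁ refl
... | false | true  | true  = inj₂ refl

odd-through : ∀ j k → odd j ≡ odd k → odd (j + suc k) ≡ true
odd-through j k eq rewrite +-suc j k | odd-+ j k | eq with odd k
... | false = refl
... | true  = refl

-- Shortest odd closed walks

module OddCycles {n : ℕ} (G : Graph n) where

  open Neighbourhoods G

  data Walk (S : Fin n → Set) : Fin n → Fin n → ℕ → Set where
    nil  : ∀ {u} → S u → Walk S u u 0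
    cons : ∀ {u v w k} → S u → u ∼ v → Walk S v w k → Walk S u w (suc k)

  module _ {S : Fin n → Set} where

    end∈ : ∀ {u v k} → Walk S u v k → S v
    end∈ (nil s) = s
    end∈ (cons _ _ w) = end∈ w

    start∈ : ∀ {u v k} → Walk S u v k → S u
    start∈ (nil s) = s
    start∈ (cons s _ _) = s

    append : ∀ {u v w j k} → Walk S u v j → Walk S v w k → Walk S u w (j + k)
    append (nil _) w′ = w′
    append (cons s e w) w′ = cons s e (append w w′)

    snoc : ∀ {u v w k} → Walk S u v k → v ∼ w → S w → Walk S u w (suc k)
    snoc (nil s) e s′ = cons s e (nil s′)
    snoc (cons s e w) e′ s′ = cons s e (snoc w e′ s′)

    reverse : ∀ {u v k} → Walk S u v k → Walk S v u k
    reverse (nil s) = nil s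
    reverse (cons s e w) = snoc (reverse w) (∼-sym e) s

    -- The last vertex is omitted, so that a closed walk lists its base once.
    verts : ∀ {u v k} → Walk S u v k → List (Fin n)
    verts (nil _) = []
    verts (cons {u} _ _ w) = u ∷ verts w

    length-verts : ∀ {u v k} (w : Walk S u v k) → length (verts w) ≡ k
    length-verts (nil _) = refl
    length-verts (cons _ _ w) = cong suc (length-verts w)

    base∈ : ∀ {u v k} (w : Walk S u v (suc k)) → u ∈ verts w
    base∈ (cons _ _ _) = here refl

    verts∈ : ∀ {u v k x} (w : Walk S u v k) → x ∈ verts w → S x
    verts∈ (cons s _ _) (here refl) = s
    verts∈ (cons _ _ w) (there x∈) = verts∈ w x∈

    verts-active : ∀ {u v k x} (w : Walk S u v k) → x ∈ verts w → Active x
    verts-active (cons _ e _) (here refl) = _ , e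
    verts-active (cons _ _ w) (there x∈) = verts-active w x∈

    verts-append : ∀ {u v w j k} (p : Walk S u v j) (q : Walk S v w k) → verts (append p q) ≡ verts p ++ verts q
    verts-append (nil _) q = refl
    verts-append (cons _ _ p) q = cong (_ ∷_) (verts-append p q)

    record Split {u v k} (w : Walk S u v k) (x : Fin n) : Set where
      constructor splitting
      field
        {i j}   : ℕ
        before  : Walk S u x i
        after   : Walk S x v (suc j)
        lengths : i + suc j ≡ k
        verts≡  : verts w ≡ verts before ++ verts after

    split : ∀ {u v k x} (w : Walk S u v k) → x ∈ verts w → Split w x
    split w@(cons s _ _) (here refl) = splitting (nil s) w refl refl
    split (cons s e w) (there x∈) with splitting p q eq vs ← split w x∈ =
      splitting (cons s e p) q (cong suc eq) (cong (_ ∷_) vs)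

    unsnoc : ∀ {u v k} (w : Walk S u v (suc k)) →
      ∃ λ t → Σ (Walk S u t k) λ w′ → t ∼ v × verts w ≡ verts w′ ++ t ∷ []
    unsnoc (cons s e (nil _)) = _ , nil s , e , refl
    unsnoc (cons s e w@(cons _ _ _)) with t , w′ , e′ , eq ← unsnoc w = t , cons s e w′ , e′ , cong (_ ∷_) eq

  mapWalk : ∀ {S T : Fin n → Set} {u v k} → (∀ {x} → S x → T x) → Walk S u v k → Walk T u v k
  mapWalk f (nil s) = nil (f s)
  mapWalk f (cons s e w) = cons (f s) e (mapWalk f w)

  NoOdd< : (Fin n → Set) → ℕ → Set
  NoOdd< S ℓ = ∀ {m u} → m < ℓ → odd m ≡ true → ¬ Walk S u u m

  -- A shortest odd closed walk in S; it is an induced cycle.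
  record OddCycle (S : Fin n → Set) : Set where
    constructor oddCycle
    field
      {base} : Fin n
      {len}  : ℕ
      isOdd  : odd len ≡ true
      walk   : Walk S base base len
      min    : NoOdd< S len

    cyc : List (Fin n)
    cyc = verts walk

  open OddCycle public

  module _ {S : Fin n → Set} where

    -- A repeated vertex splits the closed walk into two shorter closed walks, one of which is odd.
    cyc-unique : (C : OddCycle S) → Unique (cyc C)
    cyc-unique C = go (nil (start∈ (walk C))) (walk C) refl
      where
      go : ∀ {x i k} → Walk S (base C) x i → (w : Walk S x (base C) k) → i + k ≡ len C → Unique (verts w)
      go pre (nil _) _ = []
      go {x} {i} pre (cons s e w) eq = unique-∷ x∉ (go (snoc pre e (start∈ w)) w (trans (≡.sym (+-suc i _)) eq))
        where
        x∉ : x ∉ verts w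
        x∉ x∈ with splitting {a} {j} p q eq′ _ ← split w x∈ with odd-+⇒ (suc a) (suc j + i) (trans (cong odd total) (isOdd C))
          where
          total : suc a + (suc j + i) ≡ len C
          total = trans (≡.sym (+-assoc (suc a) (suc j) i)) (trans (cong (λ m → suc (m + i)) eq′) (trans (+-comm _ i) eq))
        ... | inj₁ o = min C (subst (suc a <_) eq (≤-trans (s≤s (≤-trans (≤-reflexive (+-comm 1 a)) (≤-trans (+-monoʳ-≤ a (s≤s z≤n)) (≤-reflexive eq′)))) (m≤n+m _ i))) o (cons s e p)
        ... | inj₂ o = min C (subst (suc j + i <_) eq (≤-trans (s≤s (≤-reflexive (+-comm (suc j) i))) (≤-trans (≤-reflexive (≡.sym (+-suc i (suc j)))) (+-monoʳ-≤ i (s≤s (≤-trans (m≤n+m (suc j) a) (≤-reflexive eq′))))))) o (append q pre)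

    -- The detour `E` makes an odd closed walk with one of the two arcs; by minimality the arc that
    -- it replaces is no longer than `E`.
    geodesic : (C : OddCycle S) → ∀ {a b p q e} → Walk S a b p → Walk S b a q → p + q ≡ len C → Walk S a b e → p ≤ e ⊎ q ≤ e
    geodesic C {p = p} {q} {e} P Q eq E with odd-detour p q e (trans (cong odd eq) (isOdd C))
    ... | inj₁ o = inj₁ (ℕₚ.≮⇒≥ λ e<p → min C (subst (e + q <_) eq (+-monoˡ-≤ q e<p)) o (append E Q))
    ... | inj₂ o = inj₂ (ℕₚ.≮⇒≥ λ e<q → min C (subst (p + e <_) eq (ℕₚ.+-monoʳ-< p e<q)) o (append P (reverse E)))

    record Rebased (C : OddCycle S) (x : Fin n) : Set where
      constructor rebased
      field
        rwalk : Walk S x x (len C)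
        to    : ∀ {y} → y ∈ cyc C → y ∈ verts rwalk
        from  : ∀ {y} → y ∈ verts rwalk → y ∈ cyc C

      cycle : OddCycle S
      cycle = oddCycle (isOdd C) rwalk (min C)

    rebase : (C : OddCycle S) → ∀ {x} → x ∈ cyc C → Rebased C x
    rebase C {x} x∈ with splitting {i} {j} p q eq vs ← split (walk C) x∈
      with refl ← trans (+-comm (suc j) i) eq = rebased (append q p)
        (λ y∈ → subst (_ ∈_) (≡.sym (verts-append q p)) (swap (verts p) (subst (_ ∈_) vs y∈)))
        (λ y∈ → subst (_ ∈_) (≡.sym vs) (swap (verts q) (subst (_ ∈_) (verts-append q p) y∈)))
      where
      swap : ∀ {y} (as : List (Fin n)) {bs} → y ∈ as ++ bs → y ∈ bs ++ as
      swap as {bs} y∈ with ∈-++⁻ as y∈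
      ... | inj₁ q = ∈-++⁺ʳ bs q
      ... | inj₂ q = ∈-++⁺ˡ q

    record CycleNbrs (C : OddCycle S) (x : Fin n) : Set where
      constructor cycleNbrs
      field
        {s t} : Fin n
        s∈    : s ∈ cyc C
        t∈    : t ∈ cyc C
        s≢t   : s ≢ t
        x∼s   : x ∼ s
        x∼t   : x ∼ t
        only  : ∀ {y} → y ∈ cyc C → x ∼ y → y ≡ s ⊎ y ≡ t

    nil-≡ : ∀ {u v} → Walk S u v 0 → u ≡ v
    nil-≡ (nil _) = refl

    -- A chord is a detour of length 1 in `geodesic`, so it already is an edge of the cycle.
    -- Equality of the two neighbours would be a detour of length 0.
    nbrsAtBase : (C : OddCycle S) → CycleNbrs C (base C)
    nbrsAtBase (oddCycle {x} {suc (suc (suc k))} o (cons {v = s} Sx x∼s w) min) with t , w′ , t∼x , vs ← unsnoc w =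
      cycleNbrs (there s∈) (there t∈) s≢t x∼s (∼-sym t∼x) only
      where
      C : OddCycle S
      C = oddCycle o (cons Sx x∼s w) min
      s∈ : s ∈ verts w
      s∈ = base∈ w
      t∈ : t ∈ verts w
      t∈ = subst (t ∈_) (≡.sym vs) (∈-++⁺ʳ (verts w′) (here refl))
      s≢t : s ≢ t
      s≢t refl with geodesic C w′ (cons (end∈ w′) t∼x (cons Sx x∼s (nil (start∈ w)))) (+-comm (suc k) 2) (nil (start∈ w))
      ... | inj₁ ()
      ... | inj₂ ()
      only : ∀ {y} → y ∈ x ∷ verts w → x ∼ y → y ≡ s ⊎ y ≡ t
      only (here refl) e = contradiction refl (∼⇒≢ e)
      only {y} (there y∈) e with splitting {i} {j} p q eq vs′ ← split w y∈
        with geodesic C (cons Sx x∼s p) q (cong suc eq) (cons Sx e (nil (end∈ p)))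
      ... | inj₁ (s≤s z≤n) = inj₁ (≡.sym (nil-≡ p))
      ... | inj₂ (s≤s z≤n) with cons _ _ (nil _) ← q =
        inj₂ (∷ʳ-injectiveʳ (verts p) (verts w′) (trans (≡.sym vs′) vs))
    nbrsAtBase (oddCycle {len = 1} o (cons _ e (nil _)) min) = contradiction refl (∼⇒≢ e)

    nbrsOnCycle : (C : OddCycle S) → ∀ {x} → x ∈ cyc C → CycleNbrs C x
    nbrsOnCycle C x∈ with R ← rebase C x∈ with cycleNbrs s∈ t∈ s≢t e e′ only ← nbrsAtBase (Rebased.cycle R) =
      cycleNbrs (Rebased.from R s∈) (Rebased.from R t∈) s≢t e e′ (only ∘ Rebased.to R)

  -- Without a shortest odd closed walk there is none at all, by induction on the length. Then the
  -- parity of the walks from a root chosen in each component is a proper 2-colouring.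
  bipartite⊎oddCycle : ∀ {S : Fin n → Set} →
    ((g : Fin n → Bool) → ¬ (∀ {x y} → S x → S y → x ∼ y → g x ≢ g y)) → ¬ OddCycle S → ⊥
  -- Walks have unbounded length, so reachability with a given parity is not decided by search; the
  -- goal being absurd, all these decisions may be assumed.
  bipartite⊎oddCycle {S} noBip noCyc = ¬¬-Fin (λ r → ¬¬-Fin λ u → ¬¬-dec) λ odd? →
    ¬¬-Fin (λ r → ¬¬-Fin λ u → ¬¬-dec) λ even? → Parities.contra odd? even?
    where
    noOdd : ∀ ℓ {u} → odd ℓ ≡ true → ¬ Walk S u u ℓ
    noOdd = <-rec (λ ℓ → ∀ {u} → odd ℓ ≡ true → ¬ Walk S u u ℓ) λ ℓ ih o w →
      noCyc (oddCycle o w λ m<ℓ → ih m<ℓ)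
    Reach : Bool → Fin n → Fin n → Set
    Reach p r u = ∃ λ k → odd k ≡ p × Walk S r u k
    module Parities (odd? : ∀ r u → Dec (Reach true r u)) (even? : ∀ r u → Dec (Reach false r u)) where
      Root : Fin n → Fin n → Set
      Root u r = Reach true r u ⊎ Reach false r u
      root? : ∀ u r → Dec (Root u r)
      root? u r = odd? r u ⊎-dec even? r u
      side : Fin n → Maybe (Fin n) → Bool
      side u nothing  = false
      side u (just r) = does (odd? r u)
      move : ∀ {u v} → S v → u ∼ v → ∀ r → Root u r → Root v r
      move sv e r (inj₁ (k , o , w)) = inj₂ (suc k , cong not o , snoc w e sv)
      move sv e r (inj₂ (k , o , w)) = inj₁ (suc k , cong not o , snoc w e sv)
      clash : ∀ {p r x y} → S y → x ∼ y → Reach p r x → Reach p r y → ⊥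
      clash Sy e (j , o , w) (k , o′ , w′) =
        noOdd (j + suc k) (odd-through j k (trans o (≡.sym o′))) (append w (cons (end∈ w) e (reverse w′)))
      proper : ∀ {x y} → S x → S y → x ∼ y → side x (firstSuch (root? x)) ≢ side y (firstSuch (root? y))
      proper {x} {y} Sx Sy e eq rewrite firstSuch-cong (root? y) (root? x) (move Sx (∼-sym e)) (move Sy e)
        with firstSuch (root? x) in eqr
      ... | nothing = firstSuch-complete (root? x) eqr x (inj₂ (0 , refl , nil Sx))
      ... | just r with firstSuch-sound (root? x) eqr
      ...   | rt with odd? r x | odd? r y
      ...     | yes p | yes q = clash Sy e p q
      ...     | no ¬p | no ¬q with rt | move Sy e r rt
      ...       | inj₁ p | _ = ¬p p
      ...       | inj₂ _ | inj₁ q = ¬q q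
      ...       | inj₂ p | inj₂ q = clash Sy e p q
      contra : ⊥
      contra = noBip (λ u → side u (firstSuch (root? u))) proper

  module _ (nc : NoClosed 6) {S : Fin n → Set} where

    open ShortCycles nc

    7≤len : (C : OddCycle S) → 7 ≤ len C
    7≤len (oddCycle {len = 1} o (cons _ e (nil _)) _) = contradiction refl (∼⇒≢ e)
    7≤len (oddCycle {len = 3} o (cons _ a (cons _ b (cons _ c (nil _)))) _) = ⊥-elim (no3 a b c)
    7≤len (oddCycle {len = 5} o (cons _ a (cons _ b (cons _ c (cons _ d (cons _ e (nil _)))))) _) = ⊥-elim (no5 a b c d e)
    7≤len (oddCycle {len = suc (suc (suc (suc (suc (suc (suc _))))))} _ _ _) = m≤m+n 7 _

    -- Two vertices of a 7-cycle are at distance at most 3 on it, so a common neighbour outside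
    -- would close a cycle of length at most 5.
    outside7 : (C : OddCycle S) → len C ≡ 7 → ∀ {x a b} → x ∉ cyc C → a ∈ cyc C → b ∈ cyc C → x ∼ a → x ∼ b → a ≡ b
    outside7 C refl {x} x∉ a∈ b∈ xa xb with R ← rebase C a∈ = go (Rebased.cycle R) (x∉ ∘ Rebased.from R) (Rebased.to R b∈) refl xa xb
      where
      go : (D : OddCycle S) → x ∉ cyc D → ∀ {b} → b ∈ cyc D → len D ≡ 7 → x ∼ base D → x ∼ b → base D ≡ b
      go (oddCycle _ (cons {c₀} _ e₀ (cons _ e₁ (cons _ e₂ (cons _ e₃ (cons _ e₄ (cons _ e₅ (cons _ e₆ (nil _)))))))) _)
        x∉ b∈ refl xa xb with c₀ ≟ _
      ... | yes eq = eq
      ... | no ne = ⊥-elim (none b∈ ne xb)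
        where
        none : ∀ {b} → b ∈ _ → c₀ ≢ b → x ∼ b → ⊥
        none (here refl) ne _ = ne refl
        none (there (here refl)) ne xb = no3 xa e₀ (∼-sym xb)
        none (there (there (here refl))) ne xb = no4 xa e₀ e₁ (∼-sym xb) (λ { refl → x∉ (there (here refl)) }) ne
        none (there (there (there (here refl)))) ne xb = no5 xa e₀ e₁ e₂ (∼-sym xb)
        none (there (there (there (there (here refl))))) ne xb = no5 xb e₄ e₅ e₆ (∼-sym xa)
        none (there (there (there (there (there (here refl)))))) ne xb = no4 xb e₅ e₆ (∼-sym xa)
          (λ { refl → x∉ (there (there (there (there (there (there (here refl))))))) }) (ne ∘ ≡.sym)
        none (there (there (there (there (there (there (here refl))))))) ne xb = no3 xb e₆ (∼-sym xa)

    -- Neighbours on a 9-cycle of an outside vertex must be at distance 4 on it. The two vertices at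
    -- distance 4 from `a` are adjacent, so a triangle excludes having both.
    outside9 : (C : OddCycle S) → len C ≡ 9 → ∀ {x a b c} → x ∉ cyc C → a ∈ cyc C → b ∈ cyc C → c ∈ cyc C →
      x ∼ a → x ∼ b → x ∼ c → a ≢ b → a ≢ c → b ≡ c
    outside9 C refl {x} x∉ a∈ b∈ c∈ xa xb xc a≢b a≢c with R ← rebase C a∈ =
      go (Rebased.cycle R) (x∉ ∘ Rebased.from R) refl xa (Rebased.to R b∈) (Rebased.to R c∈) xb xc a≢b a≢c
      where
      go : (D : OddCycle S) → x ∉ cyc D → len D ≡ 9 → x ∼ base D → ∀ {b c} → b ∈ cyc D → c ∈ cyc D → x ∼ b → x ∼ c →
        base D ≢ b → base D ≢ c → b ≡ c
      go (oddCycle _ (cons {c₀} _ e₀ (cons {c₁} _ e₁ (cons _ e₂ (cons {c₃} _ e₃ (cons {c₄} _ e₄ (cons {c₅} _ e₅ (cons {c₆} _ e₆ (cons {c₇} _ e₇ (cons {c₈} _ e₈ (nil _)))))))))) _)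
        x∉ refl xa b∈ c∈ xb xc a≢b a≢c = both xb xc (which b∈ xb a≢b) (which c∈ xc a≢c)
        where
        which : ∀ {b} → b ∈ _ → x ∼ b → c₀ ≢ b → b ≡ c₄ ⊎ b ≡ c₅
        which (here refl) xb ne = contradiction refl ne
        which (there (here refl)) xb ne = ⊥-elim (no3 xa e₀ (∼-sym xb))
        which (there (there (here refl))) xb ne = ⊥-elim (no4 xa e₀ e₁ (∼-sym xb) (λ { refl → x∉ (there (here refl)) }) ne)
        which (there (there (there (here refl)))) xb ne = ⊥-elim (no5 xa e₀ e₁ e₂ (∼-sym xb))
        which (there (there (there (there (here refl))))) xb ne = inj₁ refl
        which (there (there (there (there (there (here refl)))))) xb ne = inj₂ refl
        which (there (there (there (there (there (there (here refl))))))) xb ne = ⊥-elim (no5 xb e₆ e₇ e₈ (∼-sym xa))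
        which (there (there (there (there (there (there (there (here refl)))))))) xb ne =
          ⊥-elim (no4 xb e₇ e₈ (∼-sym xa) (λ { refl → x∉ (there (there (there (there (there (there (there (there (here refl)))))))))}) (ne ∘ ≡.sym))
        which (there (there (there (there (there (there (there (there (here refl))))))))) xb ne = ⊥-elim (no3 xb e₈ (∼-sym xa))
        both : ∀ {b c} → x ∼ b → x ∼ c → b ≡ c₄ ⊎ b ≡ c₅ → c ≡ c₄ ⊎ c ≡ c₅ → b ≡ c
        both _ _ (inj₁ p) (inj₁ q) = trans p (≡.sym q)
        both _ _ (inj₂ p) (inj₂ q) = trans p (≡.sym q)
        both xb xc (inj₁ refl) (inj₂ refl) = ⊥-elim (no3 xb e₄ (∼-sym xc))
        both xb xc (inj₂ refl) (inj₁ refl) = ⊥-elim (no3 xc e₄ (∼-sym xb))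

-- Roots with few vertices at distance at least 3

module RootLemma {n : ℕ} (G : Graph n) (nc : Neighbourhoods.NoClosed G 6) (v : Fin n) (K : List (Fin n)) where

  open Neighbourhoods G
  open OddCycles G
  open ShortCycles nc

  far? : ∀ u → Dec (Far v u)
  far? u with layer v u
  ... | root e = no λ (p , _) → p e
  ... | first e = no λ (_ , p , _) → p e
  ... | second _ _ e e′ = no λ (_ , _ , p) → p e e′
  ... | beyond p q r = yes (p , q , r)

  FarSplit : Fin n → Set
  FarSplit w = (g : Fin n → Bool) → ¬ (∀ {x y} → (Far v x × x ≢ w) → (Far v y × y ≢ w) → x ∼ y → g x ≢ g y)

  -- When `w` takes colour 0, a second neighbour `q` of `v` adjacent to `w` has to leave it. With
  -- one further far neighbour at most, the colour opposite to that neighbour is open to `q`.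
  SingleOther : Fin n → Set
  SingleOther w = ∀ {q z z′} → Second v q → q ∼ w → Far v z → Far v z′ → q ∼ z → q ∼ z′ → z ≢ w → z′ ≢ w → z ≡ z′

  module _
    (second-K : ∀ {k} → k ∈ K → Second v k)
    -- The 9 limits the odd cycle to length 7 or 9; the 10 expresses that elements of `K` are paid
    -- for by far vertices.
    (bound : ∀ xs → Unique xs → (∀ {x} → x ∈ xs → Far v x × Active x) → length xs ≤ 9 × length xs + length K ≤ 10)
    (far-nonbipartite : (g : Fin n → Bool) → ¬ (∀ {x y} → Far v x → Far v y → x ∼ y → g x ≢ g y))
    -- A 2-colouring of the far part without such a `w` would complete to a 3-colouring with `w`
    -- coloured 0.
    (hole : ∀ w → Far v w → (∀ {k} → k ∈ K → ¬ k ∼ w) → SingleOther w → FarSplit w)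
    where

    -- Giving colour 0 to w forces the second neighbours of v adjacent to w to be recoloured. This fails if one of them must
    -- keep its colour (KBad), if one of them may see both colours (PBad), or if an odd cycle avoiding w is left.
    record KBad (w : Fin n) : Set where
      constructor kbad
      field
        {k} : Fin n
        k∈  : k ∈ K
        k∼w : k ∼ w

    record PBad (w : Fin n) : Set where
      constructor pbad
      field
        {q z z′} : Fin n
        sec   : Second v q
        q∼w   : q ∼ w
        far   : Far v z
        far′  : Far v z′
        q∼z   : q ∼ z
        q∼z′  : q ∼ z′
        z≢w   : z ≢ w
        z′≢w  : z′ ≢ w
        z≢z′  : z ≢ z′

    data Bad (w : Fin n) : Set where
      isK : KBad w → Bad w
      isP : PBad w → Bad w
      isB : OddCycle (λ x → Far v x × x ≢ w) → Bad w

    bad : ∀ {w} → Far v w → ¬ ¬ Bad w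
    bad {w} fw k = bipartite⊎oddCycle
      (hole w fw (λ k∈ k∼w → k (isK (kbad k∈ k∼w))) single) (k ∘ isB)
      where
      single : SingleOther w
      single {q} {z} {z′} sec qw fz fz′ qz qz′ z≢ z′≢ with z ≟ z′
      ... | yes eq = eq
      ... | no ne = ⊥-elim (k (isP (pbad sec qw fz fz′ qz qz′ z≢ z′≢ ne)))

    module _ (C : OddCycle (Far v)) where

      on⇒far : ∀ {x} → x ∈ cyc C → Far v x
      on⇒far = verts∈ (walk C)

      second∉ : ∀ {q} → Second v q → q ∉ cyc C
      second∉ s q∈ = second∉far v s (on⇒far q∈)

      extra : ∀ zs → Unique zs → (∀ {z} → z ∈ zs → z ∉ cyc C × Far v z × Active z) →
        length zs + len C ≤ 9 × length zs + len C + length K ≤ 10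
      extra zs u h = subst (λ m → m ≤ 9 × m + length K ≤ 10) eq
        (bound (zs ++ cyc C) (unique-++ u (cyc-unique C) (λ p → proj₁ (h p))) λ x∈ → [ (λ p → proj₂ (h p)) , (λ p → on⇒far p , verts-active (walk C) p) ]′ (∈-++⁻ zs x∈))
        where
        eq : length (zs ++ cyc C) ≡ length zs + len C
        eq = trans (length-++ zs) (cong (length zs +_) (length-verts (walk C)))

      Off : Fin n → Set
      Off z = z ∉ cyc C × Far v z × Active z

      off2 : ∀ {y z} → Off y → Off z → y ≢ z → 2 + len C ≤ 9 × 2 + len C + length K ≤ 10
      off2 oy oz y≢z = extra (_ ∷ _ ∷ []) ((y≢z ∷ []) ∷ [] ∷ []) λ { (here refl) → oy ; (there (here refl)) → oz }

      module Seven (seven : len C ≡ 7) where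

        sameNbr : ∀ {x a b} → x ∉ cyc C → a ∈ cyc C → b ∈ cyc C → x ∼ a → x ∼ b → a ≡ b
        sameNbr = outside7 nc C seven

        no3off : ∀ {x y z} → Off x → Off y → Off z → x ≢ y → x ≢ z → y ≢ z → ⊥
        no3off ox oy oz xy xz yz = ≤-absurd (subst (λ m → 3 + m ≤ 9) seven (proj₁ (extra (_ ∷ _ ∷ _ ∷ []) ((xy ∷ xz ∷ []) ∷ (yz ∷ []) ∷ [] ∷ [])
          λ { (here refl) → ox ; (there (here refl)) → oy ; (there (there (here refl))) → oz })))

        K≤1 : ∀ {y z} → Off y → Off z → y ≢ z → length K ≤ 1
        K≤1 oy oz ne = ℕₚ.+-cancelˡ-≤ 9 _ _ (subst (λ m → 2 + m + length K ≤ 10) seven (proj₂ (off2 oy oz ne)))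

        oneOf : ∀ {x y z} → Off x → Off y → Off z → y ≢ z → x ≡ y ⊎ x ≡ z
        oneOf {x} {y} {z} ox oy oz yz with x ≟ y | x ≟ z
        ... | yes p | _ = inj₁ p
        ... | _ | yes p = inj₂ p
        ... | no p | no q = ⊥-elim (no3off ox oy oz p q yz)

        -- By `outside7` the vertex `q` of the obstruction sees no cycle vertex other than `w`,
        -- which pushes `z` and `z′` off the cycle.
        pOff : ∀ {w} → w ∈ cyc C → (p : PBad w) → Off (PBad.z p) × Off (PBad.z′ p)
        pOff w∈ (pbad sec qw fz fz′ qz qz′ z≢ z′≢ _) =
          ((λ z∈ → z≢ (sameNbr (second∉ sec) z∈ w∈ qz qw)) , fz , _ , ∼-sym qz) ,
          ((λ z∈ → z′≢ (sameNbr (second∉ sec) z∈ w∈ qz′ qw)) , fz′ , _ , ∼-sym qz′)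

        commonNbr : ∀ {q r y z} → q ∼ y → q ∼ z → r ∼ y → r ∼ z → y ≢ z → q ≡ r
        commonNbr {q} {r} qy qz ry rz y≢z with q ≟ r
        ... | yes eq = eq
        ... | no ne = ⊥-elim (no4 qy (∼-sym ry) rz (∼-sym qz) ne y≢z)

        -- At most two far vertices lie off the cycle, so both obstructions use the same pair. Two
        -- different vertices adjacent to that pair form a 4-cycle with it; a single one would see
        -- both `a` and `b`, against `outside7`.
        twoP : ∀ {a b} → a ∈ cyc C → b ∈ cyc C → a ≢ b → PBad a → PBad b → ⊥
        twoP a∈ b∈ a≢b p@(pbad {q} sec qa _ _ qz qz′ _ _ z≢z′) p′@(pbad {r} _ rb _ _ ry ry′ _ _ y≢y′)
          with oz , oz′ ← pOff a∈ p | oy , oy′ ← pOff b∈ p′ = a≢b (sameNbr (second∉ sec) a∈ b∈ qa (subst (_∼ _) (≡.sym q≡r) rb))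
          where
          q≡r : q ≡ r
          q≡r with oneOf oy oz oz′ z≢z′ | oneOf oy′ oz oz′ z≢z′
          ... | inj₁ refl | inj₁ refl = contradiction refl y≢y′
          ... | inj₂ refl | inj₂ refl = contradiction refl y≢y′
          ... | inj₁ refl | inj₂ refl = commonNbr qz qz′ ry ry′ z≢z′
          ... | inj₂ refl | inj₁ refl = commonNbr qz qz′ ry′ ry z≢z′

        oneK : ∀ {a b} → length K ≤ 1 → a ∈ cyc C → b ∈ cyc C → a ≢ b → KBad a → KBad b → ⊥
        oneK le a∈ b∈ a≢b (kbad {k} k∈ ka) (kbad {l} l∈ lb) with k ≟ l
        ... | yes refl = a≢b (sameNbr (second∉ (second-K k∈)) a∈ b∈ ka lb)
        ... | no ne = ≤-absurd (≤-trans (unique⊆⇒length≤ {xs = k ∷ l ∷ []} ((ne ∷ []) ∷ [] ∷ [])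
          λ { (here refl) → k∈ ; (there (here refl)) → l∈ }) le)

        record Ear (w : Fin n) : Set where
          constructor ear
          field
            {y z a b} : Fin n
            oy  : Off y
            oz  : Off z
            y∼z : y ∼ z
            a∈  : a ∈ cyc C
            b∈  : b ∈ cyc C
            y∼a : y ∼ a
            z∼b : z ∼ b
            a≢w : a ≢ w
            b≢w : b ≢ w

        -- The cycle `D` has at least 7 vertices and avoids `w`, so it does not fit on `C`. Only two
        -- far vertices lie off `C`, and neither has two neighbours on `C`; hence `D` leaves `C`
        -- along an edge between these two.
        findEar : ∀ {w} → w ∈ cyc C → OddCycle (λ x → Far v x × x ≢ w) → Ear w
        findEar {w} w∈ D with Any.any? (λ y → ¬? (y ∈? cyc C)) (cyc D)
        ... | no none = ⊥-elim (≤-absurd (≤-trans (s≤s (subst (7 ≤_) (≡.sym (length-verts (walk D))) (7≤len nc D)))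
              (subst (suc (length (cyc D)) ≤_) (trans (length-verts (walk C)) seven)
              (unique⊆⇒length≤ (unique-∷ (λ w∈D → proj₂ (verts∈ (walk D) w∈D) refl) (cyc-unique D)) inside))))
          where
          inside : ∀ {x} → x ∈ w ∷ cyc D → x ∈ cyc C
          inside (here refl) = w∈
          inside {x} (there x∈) with x ∈? cyc C
          ... | yes p = p
          ... | no p = contradiction (lose x∈ p) none
        ... | yes some with y , y∈ , y∉ ← find some = fromNbrs (nbrsOnCycle D y∈)
          where
          offD : ∀ {x} → x ∈ cyc D → x ∉ cyc C → Off x
          offD x∈ x∉ = x∉ , proj₁ (verts∈ (walk D) x∈) , verts-active (walk D) x∈
          oy : Off y
          oy = offD y∈ y∉
          attach : ∀ {z a} → z ∈ cyc D → z ∉ cyc C → y ∼ z → a ∈ cyc D → a ∈ cyc C → y ∼ a → Ear w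
          attach {z} {a} z∈ z∉ yz a∈D a∈ ya with nbrsOnCycle D z∈
          ... | cycleNbrs {s} {t} s∈ t∈ s≢t zs zt _ = case s ≟ y of λ where
              (no s≢y)   → finish s∈ zs s≢y
              (yes refl) → finish t∈ zt (s≢t ∘ ≡.sym)
            where
            finish : ∀ {r} → r ∈ cyc D → z ∼ r → r ≢ y → Ear w
            finish {r} r∈ zr r≢y with r ∈? cyc C
            ... | yes r∈C = ear oy (offD z∈ z∉) yz a∈ r∈C ya zr (proj₂ (verts∈ (walk D) a∈D)) (proj₂ (verts∈ (walk D) r∈))
            ... | no r∉C = ⊥-elim (no3off oy (offD z∈ z∉) (offD r∈ r∉C) (∼⇒≢ yz) (r≢y ∘ ≡.sym) (∼⇒≢ zr))
          fromNbrs : CycleNbrs D y → Ear w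
          fromNbrs (cycleNbrs {s} {t} s∈ t∈ s≢t ys yt _) with s ∈? cyc C | t ∈? cyc C
          ... | yes s∈C | yes t∈C = contradiction (sameNbr y∉ s∈C t∈C ys yt) s≢t
          ... | yes s∈C | no t∉C = attach t∈ t∉C yt s∈ s∈C ys
          ... | no s∉C | yes t∈C = attach s∈ s∉C ys t∈ t∈C yt
          ... | no s∉C | no t∉C = ⊥-elim (no3off oy (offD s∈ s∉C) (offD t∈ t∉C) (∼⇒≢ ys) (∼⇒≢ yt) s≢t)

        flipEar : ∀ {w} → Ear w → Ear w
        flipEar (ear oy oz yz a∈ b∈ ya zb aw bw) = ear oz oy (∼-sym yz) b∈ a∈ zb ya bw aw

        -- The ear uses up the two far vertices off the cycle. The vertex `q` of a `PBad`
        -- obstruction would be adjacent to both and close a triangle. An odd cycle avoiding `a`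
        -- would need an ear through the same two vertices, but `y` sees only `a` on the cycle.
        earTip-K : ∀ {w} (E : Ear w) → ¬ ¬ KBad (Ear.a E)
        earTip-K (ear {y} {z} {a} oy oz yz a∈ b∈ ya zb _ _) k = bad (on⇒far a∈) λ where
          (isK p) → k p
          (isP p@(pbad {q} sec _ _ _ qz qz′ _ _ ne)) → let op , op′ = pOff a∈ p in
            case oneOf oy op op′ ne of λ where
              (inj₁ refl) → case oneOf oz op op′ ne of λ where
                (inj₁ refl) → ∼⇒≢ yz refl
                (inj₂ refl) → no3 qz yz (∼-sym qz′)
              (inj₂ refl) → case oneOf oz op op′ ne of λ where
                (inj₁ refl) → no3 qz (∼-sym yz) (∼-sym qz′)
                (inj₂ refl) → ∼⇒≢ yz refl
          (isB D) → case findEar a∈ D of λ where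
            (ear oy′ oz′ yz′ a∈′ b∈′ ya′ zb′ a≢ b≢) → case oneOf oy oy′ oz′ (∼⇒≢ yz′) of λ where
              (inj₁ refl) → a≢ (sameNbr (proj₁ oy) a∈′ a∈ ya′ ya)
              (inj₂ refl) → b≢ (sameNbr (proj₁ oy) b∈′ a∈ zb′ ya)

        noEar : ∀ {w} → Ear w → ⊥
        noEar E@(ear oy oz yz a∈ b∈ ya zb _ _) = earTip-K E λ ka → earTip-K (flipEar E) λ kb →
          oneK (K≤1 oy oz (∼⇒≢ yz)) a∈ b∈ (λ { refl → no3 ya (∼-sym zb) (∼-sym yz) }) ka kb

        bad′ : ∀ {w} → w ∈ cyc C → ¬ ¬ (KBad w ⊎ PBad w)
        bad′ w∈ k = bad (on⇒far w∈) λ where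
          (isK p) → k (inj₁ p)
          (isP p) → k (inj₂ p)
          (isB D) → noEar (findEar w∈ D)

        K≤3 : length K ≤ 3
        K≤3 = ℕₚ.+-cancelˡ-≤ 7 _ _ (subst (λ m → m + length K ≤ 10) seven (proj₂ (extra [] [] λ ())))

        diffK : ∀ {a b} → a ∈ cyc C → b ∈ cyc C → a ≢ b → (p : KBad a) (q : KBad b) → KBad.k p ≢ KBad.k q
        diffK a∈ b∈ a≢b (kbad k∈ ka) (kbad l∈ lb) refl = a≢b (sameNbr (second∉ (second-K k∈)) a∈ b∈ ka lb)

        -- Different cycle vertices are spoilt by different elements of `K`, of which there are at
        -- most 3. One `PBad` vertex puts two far vertices off the cycle, which lowers this to 1,
        -- and it excludes a second `PBad` vertex.
        fourBad : ∀ {a b c d} → a ∈ cyc C → b ∈ cyc C → c ∈ cyc C → d ∈ cyc C → Unique (a ∷ b ∷ c ∷ d ∷ []) → ⊥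
        fourBad {a} {b} {c} {d} a∈ b∈ c∈ d∈ ((ab ∷ ac ∷ ad ∷ []) ∷ (bc ∷ bd ∷ []) ∷ (cd ∷ []) ∷ [] ∷ []) =
          bad′ a∈ λ A → bad′ b∈ λ B → bad′ c∈ λ C → bad′ d∈ λ D → go A B C D
          where
          few : ∀ {w} → w ∈ cyc C → PBad w → length K ≤ 1
          few w∈ p = let o , o′ = pOff w∈ p in K≤1 o o′ (PBad.z≢z′ p)
          go : KBad a ⊎ PBad a → KBad b ⊎ PBad b → KBad c ⊎ PBad c → KBad d ⊎ PBad d → ⊥
          go (inj₁ p) (inj₁ q) (inj₁ r) (inj₁ s) = ≤-absurd (≤-trans (unique⊆⇒length≤ {xs = KBad.k p ∷ KBad.k q ∷ KBad.k r ∷ KBad.k s ∷ []}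
            ((diffK a∈ b∈ ab p q ∷ diffK a∈ c∈ ac p r ∷ diffK a∈ d∈ ad p s ∷ []) ∷ (diffK b∈ c∈ bc q r ∷ diffK b∈ d∈ bd q s ∷ []) ∷ (diffK c∈ d∈ cd r s ∷ []) ∷ [] ∷ [])
            λ { (here refl) → KBad.k∈ p ; (there (here refl)) → KBad.k∈ q ; (there (there (here refl))) → KBad.k∈ r ; (there (there (there (here refl)))) → KBad.k∈ s }) K≤3)
          go (inj₂ p) (inj₂ q) _ _ = twoP a∈ b∈ ab p q
          go (inj₂ p) _ (inj₂ r) _ = twoP a∈ c∈ ac p r
          go _ (inj₂ q) (inj₂ r) _ = twoP b∈ c∈ bc q r
          go (inj₂ p) (inj₁ q) (inj₁ r) _ = oneK (few a∈ p) b∈ c∈ bc q r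
          go (inj₁ p) (inj₂ q) (inj₁ r) _ = oneK (few b∈ q) a∈ c∈ ac p r
          go (inj₁ p) (inj₁ q) (inj₂ r) _ = oneK (few c∈ r) a∈ b∈ ab p q
          go (inj₁ p) (inj₁ q) (inj₁ _) (inj₂ s) = oneK (few d∈ s) a∈ b∈ ab p q

      contra : len C ≡ 7 → ⊥
      contra seven = go (walk C) seven refl (cyc-unique C)
        where
        go : ∀ {x k} (w : Walk (Far v) x (base C) k) → k ≡ 7 → verts w ≡ cyc C → Unique (cyc C) → ⊥
        go (cons _ _ (cons _ _ (cons _ _ (cons _ _ _)))) _ eq u rewrite ≡.sym eq with (ab ∷ ac ∷ ad ∷ _) ∷ (bc ∷ bd ∷ _) ∷ (cd ∷ _) ∷ _ ← u =
          Seven.fourBad seven (subst (_ ∈_) eq (here refl)) (subst (_ ∈_) eq (there (here refl))) (subst (_ ∈_) eq (there (there (here refl))))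
            (subst (_ ∈_) eq (there (there (there (here refl))))) ((ab ∷ ac ∷ ad ∷ []) ∷ (bc ∷ bd ∷ []) ∷ (cd ∷ []) ∷ [] ∷ [])

      -- The cycle exhausts the far part, so `outside9` rules out `PBad`, and an odd cycle avoiding
      -- `w` would be shorter than 9. Thus only `K` remains, of size at most 1, and its element
      -- would form a triangle with two consecutive cycle vertices.
      contra9 : len C ≡ 9 → ⊥
      contra9 nine with cycleNbrs {s} s∈ _ _ x∼s _ _ ← nbrsAtBase C = bad″ base∈C λ p → bad″ s∈ λ q → go p q
        where
        base∈C : base C ∈ cyc C
        base∈C = subst-base (walk C) nine
          where
          subst-base : ∀ {k} (w : Walk (Far v) (base C) (base C) k) → k ≡ 9 → base C ∈ verts w
          subst-base w refl = base∈ w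
        on : ∀ {z} → Far v z → Active z → z ∈ cyc C
        on {z} fz az with z ∈? cyc C
        ... | yes p = p
        ... | no p = ⊥-elim (≤-absurd (subst (λ m → 1 + m ≤ 9) nine (proj₁ (extra (z ∷ []) ([] ∷ []) λ { (here refl) → p , fz , az }))))
        K≤1 : length K ≤ 1
        K≤1 = ℕₚ.+-cancelˡ-≤ 9 _ _ (subst (λ m → m + length K ≤ 10) nine (proj₂ (extra [] [] λ ())))
        bad″ : ∀ {w} → w ∈ cyc C → ¬ ¬ KBad w
        bad″ {w} w∈ k = bad (on⇒far w∈) λ where
          (isK p) → k p
          (isP (pbad sec qw fz fz′ qz qz′ z≢w z′≢w z≢z′)) →
            z≢z′ (outside9 nc C nine (second∉ sec) w∈ (on fz (_ , ∼-sym qz)) (on fz′ (_ , ∼-sym qz′)) qw qz qz′ (z≢w ∘ ≡.sym) (z′≢w ∘ ≡.sym))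
          (isB D) → case len D <? len C of λ where
            (yes lt) → min C lt (isOdd D) (mapWalk proj₁ (walk D))
            (no ge) → ≤-absurd (≤-trans (s≤s (≤-trans (subst (_≤ len D) nine (ℕₚ.≮⇒≥ ge)) (≤-reflexive (≡.sym (length-verts (walk D))))))
              (proj₁ (bound (w ∷ cyc D) (unique-∷ (λ w∈D → proj₂ (verts∈ (walk D) w∈D) refl) (cyc-unique D))
                λ { (here refl) → on⇒far w∈ , verts-active (walk C) w∈ ; (there x∈) → proj₁ (verts∈ (walk D) x∈) , verts-active (walk D) x∈ })))
        go : KBad (base C) → KBad s → ⊥
        go (kbad {k} k∈ ka) (kbad {l} l∈ lb) with k ≟ l
        ... | yes refl = no3 ka x∼s (∼-sym lb)
        ... | no ne = ≤-absurd (≤-trans (unique⊆⇒length≤ {xs = k ∷ l ∷ []} ((ne ∷ []) ∷ [] ∷ [])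
          λ { (here refl) → k∈ ; (there (here refl)) → l∈ }) K≤1)

      noCycle : ⊥
      noCycle = go (len C) refl (7≤len nc C) (proj₁ (extra [] [] λ ())) (isOdd C)
        where
        go : ∀ k → len C ≡ k → 7 ≤ k → k ≤ 9 → odd k ≡ true → ⊥
        go 7 eq _ _ _ = contra eq
        go 8 _ _ _ ()
        go 9 eq _ _ _ = contra9 eq
        go (suc (suc (suc (suc (suc (suc (suc (suc (suc (suc _)))))))))) _ _ le _ = ≤-absurd {10} {9} (≤-trans (m≤m+n 10 _) le)
        go 0 _ () _ _
        go 1 _ (s≤s ()) _ _
        go 2 _ (s≤s (s≤s ())) _ _
        go 3 _ (s≤s (s≤s (s≤s ()))) _ _
        go 4 _ (s≤s (s≤s (s≤s (s≤s ())))) _ _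
        go 5 _ (s≤s (s≤s (s≤s (s≤s (s≤s ()))))) _ _
        go 6 _ (s≤s (s≤s (s≤s (s≤s (s≤s (s≤s ())))))) _ _

    impossible : ⊥
    impossible = bipartite⊎oddCycle far-nonbipartite noCycle

-- Colourings obtained from a small far part

module _ {n : ℕ} (G : Graph n) (nc : Neighbourhoods.NoClosed G 6) (v : Fin n) (K : List (Fin n)) where

  open Neighbourhoods G
  open RootLemma G nc v K
  open ShortCycles nc

  -- Two colourings, since a single one need not separate `y` from `y′`. If the other neighbours of
  -- `y` lie in `K`, they keep colour 0, so `y` switches with `d` while `y′`, not a neighbour of
  -- `v`, stays the same.
  record RootColourings : Set where
    constructor rootColourings
    field
      colouring : Bool → Fin n → Fin 3
      proper    : ∀ d → ProperColouring G 3 (colouring d)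
      separates : ∀ {y y′} → v ∼ y → (∀ {q} → y ∼ q → q ≢ v → q ∈ K) → ¬ v ∼ y′ →
        ∃ λ d → colouring d y ≢ colouring d y′

  private
    decide : ∀ (c : Bool → Fin n → Fin 3) y y′ → ((∀ d → c d y ≡ c d y′) → ⊥) → ∃ λ d → c d y ≢ c d y′
    decide c y y′ h with c true y ≟ c true y′ | c false y ≟ c false y′
    ... | no ne | _ = true , ne
    ... | _ | no ne = false , ne
    ... | yes e | yes e′ = ⊥-elim (h λ { true → e ; false → e′ })

  farBipartite⇒colourings : (g : Fin n → Bool) → (∀ {x y} → Far v x → Far v y → x ∼ y → g x ≢ g y) → RootColourings
  farBipartite⇒colourings g proper = rootColourings rootColouring
    (rootColouring-proper (λ ()) (λ fx fy _ _ → proper fx fy) (λ _ _ ()) (λ _ ()) (λ _ _ _ _ _ ()))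
    (λ {y} {y′} vy _ v≁y′ → decide rootColouring y y′ (rootColouring-separates vy (λ ()) v≁y′))
    where open RootColouring nc v {J = λ _ → ⊥} {Q = λ _ → ⊥} (λ _ → no λ ()) (λ _ → no λ ()) g (λ _ → true)

  -- The set `J` is `w` alone and `Q` its neighbourhood. Two members of `Q` below one neighbour of
  -- `v` would form a 4-cycle with `w`, and no member of `K` is recoloured.
  hole⇒colourings : (g : Fin n → Bool) → ∀ w → Far v w → (∀ {k} → k ∈ K → ¬ k ∼ w) → SingleOther w →
    (∀ {x y} → (Far v x × x ≢ w) → (Far v y × y ≢ w) → x ∼ y → g x ≢ g y) → RootColourings
  hole⇒colourings g w fw K≁w single proper = rootColourings rootColouring
    (rootColouring-proper (λ { refl refl e → ∼⇒≢ e refl })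
      (λ fx fy x≢ y≢ → proper (fx , x≢) (fy , y≢))
      (λ { _ _ refl e → e })
      (λ {q} sec qw fz z≢w qz → other-sound sec qw fz z≢w qz)
      (λ va aq aq′ q≢v q′≢v qw q′w → unique-kid va aq aq′ q≢v q′≢v qw q′w))
    (λ {y} {y′} vy kids⊆K v≁y′ → decide rootColouring y y′ (rootColouring-separates vy (λ (q , yq , q≢v , qw) → K≁w (kids⊆K yq q≢v) qw) v≁y′))
    where
    otherOf : ∀ {q} → Dec (∃ λ z → q ∼ z × z ≢ w × Far v z) → Bool
    otherOf (yes (z , _)) = g z
    -- With no other far neighbour either colour serves.
    otherOf (no _)        = true
    other? : ∀ q → Dec (∃ λ z → q ∼ z × z ≢ w × Far v z)
    other? q = any? (λ z → (q ∼? z) ×-dec (¬? (z ≟ w) ×-dec far? z))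
    open RootColouring nc v {J = _≡ w} {Q = _∼ w} (_≟ w) (_∼? w) g (λ q → otherOf (other? q))
    other-sound : ∀ {q z} → Second v q → q ∼ w → Far v z → z ≢ w → q ∼ z → g z ≡ otherOf (other? q)
    other-sound {q} {z} sec qw fz z≢w qz with other? q
    ... | yes (z′ , qz′ , z′≢w , fz′) = cong g (single sec qw fz fz′ qz qz′ z≢w z′≢w)
    ... | no none = contradiction (z , qz , z≢w , fz) none
    unique-kid : ∀ {a q q′} → v ∼ a → a ∼ q → a ∼ q′ → q ≢ v → q′ ≢ v → q ∼ w → q′ ∼ w → q ≡ q′
    unique-kid {a} {q} {q′} va aq aq′ _ _ qw q′w with q ≟ q′
    ... | yes eq = eq
    ... | no ne = ⊥-elim (no4 (∼-sym aq) aq′ q′w (∼-sym qw) ne λ { refl → proj₁ (proj₂ fw) va })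

  smallFar⇒colourings : (∀ {k} → k ∈ K → Second v k) →
    (∀ xs → Unique xs → (∀ {x} → x ∈ xs → Far v x × Active x) → length xs ≤ 9 × length xs + length K ≤ 10) →
    ¬ ¬ RootColourings
  smallFar⇒colourings sec bound k = impossible sec bound
    (λ g p → k (farBipartite⇒colourings g p))
    (λ w fw K≁ single g p → k (hole⇒colourings g w fw K≁ single p))

-- Subgraphs and reduction to minimum degree 3

infix 4 _⊑_

_⊑_ : ∀ {n} → Graph n → Graph n → Set
G ⊑ H = ∀ {u v} → Adj G u v → Adj H u v

module _ {n : ℕ} where

  open Neighbourhoods

  ⊑-noClosed : ∀ {G H : Graph n} {g} → G ⊑ H → NoClosed H g → NoClosed G g
  ⊑-noClosed {G} {H} G⊑H nc lt w = nc lt (mapNB w)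
    where
    mapNB : ∀ {p a x k} → NB G p a x k → NB H p a x k
    mapNB stop = stop
    mapNB (step e ne w) = step (G⊑H e) ne (mapNB w)

  ⊑-bound : ∀ {G H : Graph n} {k} → G ⊑ H → Bound H k → Bound G k
  ⊑-bound G⊑H b xs u act = b xs u (λ x∈ → let y , e = act x∈ in y , G⊑H e)

  ⊑-col : ∀ {G H : Graph n} → G ⊑ H → Col H → Col G
  ⊑-col G⊑H (c , p) = c , λ u v e → p u v (G⊑H e)

  infixl 6 _∖_

  _∖_ : Graph n → List (Fin n) → Graph n
  G ∖ xs = record
    { Adj    = λ u v → Adj G u v × u ∉ xs × v ∉ xs
    ; adj?   = λ u v → adj? G u v ×-dec (¬? (u ∈? xs) ×-dec ¬? (v ∈? xs))
    ; sym    = λ (e , p , q) → Graph.sym G e , q , p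
    ; irrefl = λ eq (e , _) → Graph.irrefl G eq e
    }

  ∖-⊑ : ∀ {G : Graph n} {xs} → (G ∖ xs) ⊑ G
  ∖-⊑ = proj₁

  _[_≔_] : (Fin n → Fin 3) → Fin n → Fin 3 → Fin n → Fin 3
  (c [ v ≔ κ ]) u with u ≟ v
  ... | yes _ = κ
  ... | no _ = c u

  ≔-same : ∀ (c : Fin n → Fin 3) v κ → (c [ v ≔ κ ]) v ≡ κ
  ≔-same c v κ with v ≟ v
  ... | yes _ = refl
  ... | no ne = contradiction refl ne

  ≔-other : ∀ (c : Fin n → Fin 3) {v u} κ → u ≢ v → (c [ v ≔ κ ]) u ≡ c u
  ≔-other c {v} {u} κ ne with u ≟ v
  ... | yes eq = contradiction eq ne
  ... | no _ = refl

  extendColouring : ∀ (G : Graph n) {c v κ us} → ProperColouring (G ∖ (v ∷ us)) 3 c →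
    (∀ {u} → Adj G v u → u ∉ us → c u ≢ κ) → ProperColouring (G ∖ us) 3 (c [ v ≔ κ ])
  extendColouring G {c} {v} {κ} {us} p free u w (e , u∉ , w∉) with u ≟ v | w ≟ v
  ... | yes refl | yes refl = λ _ → Graph.irrefl G refl e
  ... | yes refl | no _ = λ eq → free e w∉ (≡.sym eq)
  ... | no _ | yes refl = free (Graph.sym G e) u∉
  ... | no u≢v | no w≢v = p u w (e , (λ { (here eq) → u≢v eq ; (there q) → u∉ q }) , λ { (here eq) → w≢v eq ; (there q) → w∉ q })

  missingColour : ∀ (ks : List (Fin 3)) → length ks ≤ 2 → ∃ λ κ → κ ∉ ks
  missingColour ks le with any? (λ κ → ¬? (κ ∈? ks))
  ... | yes p = p
  ... | no none = ⊥-elim (≤-absurd (≤-trans (unique⊆⇒length≤ (allFin⁺ 3) (λ {κ} _ → inside κ)) le))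
    where
    inside : ∀ κ → κ ∈ ks
    inside κ with κ ∈? ks
    ... | yes p = p
    ... | no p = contradiction (κ , p) none

  freeColour : ∀ (c : Fin n → Fin 3) (us : List (Fin n)) → length us ≤ 2 → ∃ λ κ → ∀ {u} → u ∈ us → c u ≢ κ
  freeColour c us le with κ , κ∉ ← missingColour (map c us) (≤-trans (≤-reflexive (length-map c us)) le) =
    κ , λ { u∈ refl → κ∉ (∈-map⁺ c u∈) }

  MinDeg3 : Graph n → Set
  MinDeg3 G = ∀ {v} → Active G v → 3 ≤ deg G v

  -- A vertex of degree at most 2 can be coloured last. The induction runs on the bound for
  -- non-isolated vertices, which drops because the deleted vertex becomes isolated.
  reduceToCore : (Good : Graph n → Set) → (∀ {G v} → Good G → Good (G ∖ (v ∷ []))) →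
    (∀ G → Good G → MinDeg3 G → ¬ ¬ Col G) → ∀ k G → Bound G k → Good G → ¬ ¬ Col G
  reduceToCore Good closed core k G b good nocol with any? (λ v → any? (adj? G v) ×-dec (deg G v <? 3))
  ... | no none = core G good (λ {v} act → ℕₚ.≮⇒≥ λ lt → none (v , act , lt)) nocol
  reduceToCore Good closed core zero G b good nocol | yes (v , act , _) =
    ≤-absurd {1} {0} (b (v ∷ []) ([] ∷ []) λ { (here refl) → act })
  reduceToCore Good closed core (suc k) G b good nocol | yes (v , act , lt) =
    reduceToCore Good closed core k (G ∖ (v ∷ []))
      (λ xs u h → s≤s⁻¹ (b (v ∷ xs) (unique-∷ (λ v∈ → proj₁ (proj₂ (proj₂ (h v∈))) (here refl)) u)
        λ { (here refl) → act ; (there x∈) → let y , e , _ = h x∈ in y , e }))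
      (closed good)
      λ (c , p) → let κ , f = freeColour c (nbrs G v) (s≤s⁻¹ lt) in
        nocol (c [ v ≔ κ ] , λ u w e → extendColouring G {us = []} p (λ e _ → f (∈nbrs⁺ G e)) u w (e , (λ ()) , λ ()))

  -- The edge between `y` and `y′`, if present, stands for the demand that their colours differ.
  -- Girth is imposed on what is left without it; deleting an end removes the demand.
  unlink : Fin n → Fin n → Graph n → Graph n
  unlink y y′ F = record
    { Adj    = λ u v → Adj F u v × ¬ (u ≡ y × v ≡ y′) × ¬ (u ≡ y′ × v ≡ y)
    ; adj?   = λ u v → adj? F u v ×-dec (¬? ((u ≟ y) ×-dec (v ≟ y′)) ×-dec ¬? ((u ≟ y′) ×-dec (v ≟ y)))
    ; sym    = λ (e , p , q) → Graph.sym F e , (λ (a , b) → q (b , a)) , (λ (a , b) → p (b , a))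
    ; irrefl = λ eq (e , _) → Graph.irrefl F eq e
    }

  unlink-mono : ∀ {y y′} {F H : Graph n} → F ⊑ H → unlink y y′ F ⊑ unlink y y′ H
  unlink-mono F⊑H (e , p) = F⊑H e , p

  nonadjacent-⊑-unlink : ∀ {y y′} {F : Graph n} → ¬ Adj F y y′ → F ⊑ unlink y y′ F
  nonadjacent-⊑-unlink {F = F} y≁y′ e = e , (λ { (refl , refl) → y≁y′ e }) , λ { (refl , refl) → y≁y′ (Graph.sym F e) }

  deg-unlink : ∀ {y y′} {F : Graph n} {x} → x ≢ y → x ≢ y′ → deg F x ≤ deg (unlink y y′ F) x
  deg-unlink {y} {y′} {F} {x} p q = unique⊆⇒length≤ (nbrs-unique F x) λ z∈ →
    ∈nbrs⁺ (unlink y y′ F) (∈nbrs⁻ F z∈ , (λ (a , _) → p a) , λ (a , _) → q a)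

  deg-unlink-end : ∀ {y y′} {F : Graph n} {x} → deg F x ≤ suc (deg (unlink y y′ F) x)
  deg-unlink-end {y} {y′} {F} {x} = go (x ≟ y)
    where
    go : Dec (x ≡ y) → deg F x ≤ suc (deg (unlink y y′ F) x)
    go (yes refl) = unique⊆⇒length≤ {ys = y′ ∷ nbrs (unlink y y′ F) x} (nbrs-unique F x) λ {z} z∈ → case z ≟ y′ of λ where
      (yes refl) → here refl
      (no ne) → there (∈nbrs⁺ (unlink y y′ F) (∈nbrs⁻ F z∈ , (λ (_ , b) → ne b) , λ { (refl , refl) → ne refl }))
    go (no x≢y) = unique⊆⇒length≤ {ys = y ∷ nbrs (unlink y y′ F) x} (nbrs-unique F x) λ {z} z∈ → case z ≟ y of λ where
      (yes refl) → here refl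
      (no ne) → there (∈nbrs⁺ (unlink y y′ F) (∈nbrs⁻ F z∈ , (λ (a , _) → x≢y a) , λ (_ , b) → ne b))

-- Sizes of balls

module SubSizes {n : ℕ} (G : Graph n) where

  open Neighbourhoods G

  length-sub1 : ∀ p a → length (sub 1 p a) ≡ suc (length (kids p a))
  length-sub1 p a = cong suc (singles (kids p a))
    where
    singles : ∀ xs → length (concatMap (sub 0 a) xs) ≡ length xs
    singles [] = refl
    singles (_ ∷ xs) = cong suc (singles xs)

  deg≤sub1 : ∀ p a → deg a ≤ length (sub 1 p a)
  deg≤sub1 p a = ≤-trans (deg≤1+kids p a) (≤-reflexive (≡.sym (length-sub1 p a)))

  sub-suc≥ : ∀ d {m k} p a → k ≤ length (kids p a) → (∀ {x} → x ∈ kids p a → m ≤ length (sub d a x)) →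
    suc (k * m) ≤ length (sub (suc d) p a)
  sub-suc≥ d {m} {k} p a le h = s≤s (≤-trans (ℕₚ.*-monoˡ-≤ m le) (≤-trans
    (length-concatMap-≥ (sub d a) {s = 0} (kids p a) [] (kids-unique p a) (inj₂ ∘ h) (λ x∈ → ≤-trans (h x∈) (m≤m+n _ 0)))
    (≤-reflexive (+-identityʳ _))))

  3≤deg⇒2≤kids : ∀ p {a} → 3 ≤ deg a → 2 ≤ length (kids p a)
  3≤deg⇒2≤kids p le = s≤s⁻¹ (≤-trans le (deg≤1+kids p _))

  active-∼ : ∀ {u v} → u ∼ v → Active v
  active-∼ e = _ , ∼-sym e

  farBound : ∀ {N} → NoClosed 6 → Bound N → ∀ {v} → Active v → ∀ xs → Unique xs →
    (∀ {x} → x ∈ xs → Far v x × Active x) → length xs + length (sub 2 v v) ≤ N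
  farBound nc b {v} act xs u h = subst (_≤ _) (length-++ xs)
    (b (xs ++ sub 2 v v) (unique-++ u (sub-unique nc 2 (s≤s (s≤s (s≤s (s≤s (s≤s z≤n)))))) (λ p q → far∉sub v (proj₁ (h p)) q))
      λ x∈ → [ (λ p → proj₂ (h p)) , sub-active 2 act ]′ (∈-++⁻ xs x∈))

  twoNbrs : ∀ {v} → 2 ≤ deg v → ∃₂ λ a b → v ∼ a × v ∼ b × a ≢ b
  twoNbrs {v} le = go (nbrs v) (nbrs-unique v) le ∈nbrs⁻
    where
    go : ∀ xs → Unique xs → 2 ≤ length xs → (∀ {x} → x ∈ xs → v ∼ x) → ∃₂ λ a b → v ∼ a × v ∼ b × a ≢ b
    go (a ∷ b ∷ _) ((a≢b ∷ _) ∷ _) _ h = a , b , h (here refl) , h (there (here refl)) , a≢b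
    go (_ ∷ []) _ (s≤s ())

unlink-proper : ∀ {n y y′} {F : Graph n} {c : Fin n → Fin 3} →
  ProperColouring (unlink y y′ F) 3 c → c y ≢ c y′ → ProperColouring F 3 c
unlink-proper {y = y} {y′} p ne u w e eq with (u ≟ y) ×-dec (w ≟ y′) | (u ≟ y′) ×-dec (w ≟ y)
... | yes (refl , refl) | _ = ne eq
... | no _ | yes (refl , refl) = ne (≡.sym eq)
... | no q | no r = p u w (e , q , r) eq

-- Two prescribed vertices of different colours

module Separation {n : ℕ} (y y′ : Fin n) where

  open Neighbourhoods

  Good : Graph n → Set
  Good F = NoClosed (unlink y y′ F) 6 × Bound F 18

  -- Without the edge any non-isolated vertex can be the root: its ball has 10 vertices and leaves
  -- 8. With the edge the root is a neighbour `x` of `y` that is not adjacent to `y′`; two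
  -- neighbours of `y` cannot both be adjacent to `y′`, by girth.
  separation-core : ∀ F → Good F → MinDeg3 F → ¬ ¬ Col F
  separation-core F (nc , b) md nocol = go (adj? F y y′)
    where
    G : Graph n
    G = unlink y y′ F
    open SubSizes G
    open ShortCycles G nc
    bG : Bound G 18
    bG = ⊑-bound {G = G} {H = F} proj₁ b

    nonadjacent : ¬ Adj F y y′ → ⊥
    nonadjacent y≁y′ with any? (λ v → any? (adj? F v))
    ... | no none = nocol ((λ _ → 0F) , λ u v e → contradiction (u , v , e) none)
    ... | yes (v , u , e) = smallFar⇒colourings G nc v [] (λ ()) bound λ R →
            nocol (⊑-col {G = F} {H = G} F⊑G (RootColourings.colouring R true , RootColourings.proper R true))
      where
      F⊑G : F ⊑ G
      F⊑G = nonadjacent-⊑-unlink {F = F} y≁y′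
      md′ : MinDeg3 G
      md′ (w , e) = ≤-trans (md (w , proj₁ e)) (unique⊆⇒length≤ (nbrs-unique F _) λ z∈ → ∈nbrs⁺ G (F⊑G (∈nbrs⁻ F z∈)))
      ball : 10 ≤ length (sub G 2 v v)
      ball = sub-suc≥ 1 v v (≤-trans (md′ (u , F⊑G e)) (deg≤kids G v)) λ x∈ →
        ≤-trans (md′ (active-∼ (proj₁ (∈kids⁻ G x∈)))) (deg≤sub1 v _)
      bound : ∀ xs → Unique xs → (∀ {x} → x ∈ xs → Far G v x × Active G x) → length xs ≤ 9 × length xs + 0 ≤ 10
      bound xs uq h = ≤-trans (ℕₚ.+-cancelʳ-≤ 10 (length xs) 8 le) (n≤1+n 8) ,
          ≤-trans (≤-reflexive (+-identityʳ _)) (≤-trans (ℕₚ.+-cancelʳ-≤ 10 (length xs) 8 le) (m≤n+m 8 2))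
        where
        le : length xs + 10 ≤ 8 + 10
        le = ≤-trans (+-monoʳ-≤ (length xs) ball) (farBound nc bG (u , F⊑G e) xs uq h)

    adjacent : Adj F y y′ → ⊥
    adjacent yy′ = choose (twoNbrs (s≤s⁻¹ (≤-trans (md (y′ , yy′)) (deg-unlink-end {F = F}))))
      where
      y≢y′ : y ≢ y′
      y≢y′ eq = Graph.irrefl F eq yy′
      fromRoot : ∀ {x} → Adj G y x → ¬ Adj G x y′ → ⊥
      fromRoot {x} yx x≁y′ = smallFar⇒colourings G nc x K (λ k∈ → let e , ne = ∈kids⁻ G k∈ in ne , y , ∼-sym G yx , e) bound λ R →
          let open RootColourings R
              d , ne = separates (∼-sym G yx) (λ e ne → ∈kids⁺ G e ne) x≁y′
          in nocol (colouring d , unlink-proper {F = F} (proper d) ne)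
        where
        K : List (Fin n)
        -- These vertices must keep colour 0 for `y` to remain free.
        K = kids G x y
        x≢y : x ≢ y
        x≢y eq = ∼⇒≢ G yx (≡.sym eq)
        x≢y′ : x ≢ y′
        x≢y′ refl = proj₁ (proj₂ yx) (refl , refl)
        deg3 : ∀ {a} → Adj G x a → a ≢ y → 3 ≤ deg G a
        deg3 xa a≢y = ≤-trans (md (x , Graph.sym F (proj₁ xa))) (deg-unlink {F = F} a≢y λ { refl → x≁y′ xa })
        1≤K : 1 ≤ length K
        1≤K = s≤s⁻¹ (s≤s⁻¹ (≤-trans (md (y′ , yy′)) (≤-trans (deg-unlink-end {y = y} {y′} {F}) (s≤s (deg≤1+kids G x y)))))
        -- The root counts 1, the branch of `y` counts `1 + length K`, and at least two other
        -- branches count 3 each.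
        ball : 8 + length K ≤ length (sub G 2 x x)
        ball = s≤s (ℕₚ.+-cancelʳ-≤ 3 _ _ (begin
          7 + length K + 3                     ≡⟨ cong (7 +_) (+-comm (length K) 3) ⟩
          10 + length K                        ≡⟨ cong suc (+-comm 9 (length K)) ⟩
          suc (length K) + 3 * 3               ≤⟨ +-mono-≤ (≤-reflexive (≡.sym (length-sub1 x y))) (ℕₚ.*-monoˡ-≤ 3
            (≤-trans (≤-trans (md (y , Graph.sym F (proj₁ yx))) (deg-unlink {F = F} x≢y x≢y′)) (deg≤kids G x))) ⟩
          length (sub G 1 x y) + length (kids G x x) * 3 ≤⟨ length-concatMap-∋ (sub G 1 x) (∈kids⁺ G (∼-sym G yx) (x≢y ∘ ≡.sym)) (kids-unique G x x)
             (λ a∈ a≢y → ≤-trans (deg3 (proj₁ (∈kids⁻ G a∈)) a≢y) (deg≤sub1 x _)) ⟩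
          length (concatMap (sub G 1 x) (kids G x x)) + 3 ∎))
          where open ℕₚ.≤-Reasoning
        bound : ∀ xs → Unique xs → (∀ {z} → z ∈ xs → Far G x z × Active G z) → length xs ≤ 9 × length xs + length K ≤ 10
        bound xs uq h = ℕₚ.+-cancelʳ-≤ 1 (length xs) 9 (≤-trans (+-monoʳ-≤ (length xs) 1≤K) le) , le
          where
          le : length xs + length K ≤ 10
          le = ℕₚ.+-cancelʳ-≤ 8 _ 10 (≤-trans (≤-reflexive (trans (+-assoc (length xs) _ 8) (cong (length xs +_) (+-comm (length K) 8))))
            (≤-trans (+-monoʳ-≤ (length xs) ball) (farBound nc bG (y , ∼-sym G yx) xs uq h)))
      choose : (∃₂ λ a b → Adj G y a × Adj G y b × a ≢ b) → ⊥
      choose (a , b , ya , yb , a≢b) with adj? G a y′ | adj? G b y′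
      ... | no p | _ = fromRoot ya p
      ... | _ | no p = fromRoot yb p
      ... | yes p | yes q = no4 ya p (∼-sym G q) (∼-sym G yb) y≢y′ a≢b

    go : Dec (Adj F y y′) → ⊥
    go (yes e) = adjacent e
    go (no e) = nonadjacent e

  separation : ∀ F → NoClosed (unlink y y′ F) 6 → Bound F 18 → ¬ ¬ Col F
  separation F nc b = reduceToCore Good
    (λ {G} {v} (nc , b) → ⊑-noClosed {G = unlink y y′ (G ∖ (v ∷ []))} {H = unlink y y′ G}
       (unlink-mono {F = G ∖ (v ∷ [])} {H = G} proj₁) nc , ⊑-bound {G = G ∖ (v ∷ [])} {H = G} proj₁ b)
    separation-core 18 F b (nc , b)

-- Odd cycles of vertices of degree at most 3

link : ∀ {n} (y y′ : Fin n) → y ≢ y′ → Graph n → Graph n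
link y y′ y≢y′ G = record
  { Adj    = λ u v → Adj G u v ⊎ (u ≡ y × v ≡ y′) ⊎ (u ≡ y′ × v ≡ y)
  ; adj?   = λ u v → adj? G u v ⊎-dec (((u ≟ y) ×-dec (v ≟ y′)) ⊎-dec ((u ≟ y′) ×-dec (v ≟ y)))
  ; sym    = λ { (inj₁ e) → inj₁ (Graph.sym G e) ; (inj₂ (inj₁ (p , q))) → inj₂ (inj₂ (q , p)) ; (inj₂ (inj₂ (p , q))) → inj₂ (inj₁ (q , p)) }
  ; irrefl = λ { eq (inj₁ e) → Graph.irrefl G eq e ; refl (inj₂ (inj₁ (p , q))) → y≢y′ (trans (≡.sym p) q) ; refl (inj₂ (inj₂ (p , q))) → y≢y′ (trans (≡.sym q) p) }
  }

unlink-link : ∀ {n} {y y′ : Fin n} (ne : y ≢ y′) {G} → unlink y y′ (link y y′ ne G) ⊑ G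
unlink-link ne (inj₁ e , _) = e
unlink-link ne (inj₂ (inj₁ p) , q , _) = contradiction p q
unlink-link ne (inj₂ (inj₂ p) , _ , q) = contradiction p q

module LowCycles {n : ℕ} (G : Graph n) where

  open Neighbourhoods G
  open OddCycles G

  Low : Fin n → Set
  Low x = deg x ≤ 3

  lowOddCycle : (∀ {u v} → u ∼ v → ¬ Low u → ¬ Low v → ⊥) → ¬ Col → ¬ ¬ OddCycle Low
  lowOddCycle indep nocol = bipartite⊎oddCycle λ g proper →
      nocol (two g , λ u v e → distinct g proper e (deg u ≤? 3) (deg v ≤? 3))
    where
    pick : (Fin n → Bool) → ∀ u → Dec (Low u) → Fin 3
    pick g u (yes _) = col (g u)
    pick g u (no _)  = 0F
    two : (Fin n → Bool) → Fin n → Fin 3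
    two g u = pick g u (deg u ≤? 3)
    distinct : ∀ g → (∀ {x y} → Low x → Low y → x ∼ y → g x ≢ g y) → ∀ {u v} → u ∼ v →
      (p : Dec (Low u)) (q : Dec (Low v)) → pick g u p ≢ pick g v q
    distinct g pr e (yes p) (yes q) eq = pr p q e (col-inj eq)
    distinct g pr e (yes _) (no _) eq = col≢0 eq
    distinct g pr e (no _) (yes _) eq = col≢0 (≡.sym eq)
    distinct g pr e (no p) (no q) eq = indep e p q

  ∖-⊇ : ∀ {xs ys} → (∀ {x} → x ∈ xs → x ∈ ys) → (G ∖ ys) ⊑ (G ∖ xs)
  ∖-⊇ h (e , p , q) = e , p ∘ h , q ∘ h

  -- Each vertex is coloured while its successor on the walk is still uncoloured, so at most two of
  -- its at most three neighbours restrict it. For the last one the successor is `b`, which is why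
  -- `b` belongs to `rest`.
  greedy : ∀ {a b k} (w : Walk Low a b k) {rest f} → b ∈ rest → Unique (verts w) →
    ProperColouring (G ∖ (verts w ++ rest)) 3 f →
    ∃ λ f′ → ProperColouring (G ∖ rest) 3 f′ × (∀ {u} → u ∉ verts w → f′ u ≡ f u)
  greedy (nil _) b∈ _ p = _ , p , λ _ → refl
  greedy (cons {a} {a′} low e w) {rest} {f} b∈ (a≢ ∷ u) p =
    let κ , free = freeColour f others few
        f′ , p′ , same = greedy w b∈ u (extendColouring G {c = f} {κ = κ} {us = verts w ++ rest} p
          λ {u} e u∉ → free (∈-filter⁺ (λ u → ¬? (u ∈? (verts w ++ rest))) (∈nbrs⁺ e) u∉))
    in f′ , p′ , λ u∉ → trans (same (u∉ ∘ there)) (≔-other f κ (u∉ ∘ here))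
    where
    others : List (Fin n)
    others = filter (λ u → ¬? (u ∈? (verts w ++ rest))) (nbrs a)
    next∈ : ∀ {k} (w : Walk Low a′ _ k) → a′ ∈ verts w ++ rest
    next∈ (nil _) = b∈
    next∈ (cons _ _ _) = here refl
    few : length others ≤ 2
    few = s≤s⁻¹ (≤-trans (filter-notAll (λ u → ¬? (u ∈? (verts w ++ rest))) (nbrs a) (lose (∈nbrs⁺ e) λ ne → ne (next∈ w))) low)

  outerNbr : ∀ {S} (C : OddCycle S) {x} → x ∈ cyc C → 3 ≤ deg x → ∃ λ y → x ∼ y × y ∉ cyc C
  outerNbr C {x} x∈ 3≤ with Any.any? (λ y → ¬? (y ∈? cyc C)) (nbrs x)
  ... | yes some with y , y∈ , y∉ ← find some = y , ∈nbrs⁻ y∈ , y∉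
  ... | no none = ⊥-elim (≤-absurd (≤-trans 3≤ (unique⊆⇒length≤ {ys = s ∷ t ∷ []} (nbrs-unique x) inside)))
    where
    open CycleNbrs (nbrsOnCycle C x∈)
    inside : ∀ {y} → y ∈ nbrs x → y ∈ s ∷ t ∷ []
    inside {y} y∈ with y ∈? cyc C
    ... | no y∉ = contradiction (lose y∈ y∉) none
    ... | yes p with only p (∈nbrs⁻ y∈)
    ...   | inj₁ refl = here refl
    ...   | inj₂ refl = there (here refl)

  outerNbr-unique : ∀ {S} (C : OddCycle S) {x y z} → x ∈ cyc C → Low x → x ∼ y → x ∼ z → y ∉ cyc C → z ∉ cyc C → y ≡ z
  outerNbr-unique C {x} {y} {z} x∈ low xy xz y∉ z∉ with y ≟ z
  ... | yes eq = eq
  ... | no ne = ⊥-elim (≤-absurd (≤-trans (unique⊆⇒length≤ {xs = s ∷ t ∷ y ∷ z ∷ []}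
      ((s≢t ∷ (λ { refl → y∉ s∈ }) ∷ (λ { refl → z∉ s∈ }) ∷ []) ∷ ((λ { refl → y∉ t∈ }) ∷ (λ { refl → z∉ t∈ }) ∷ []) ∷ (ne ∷ []) ∷ [] ∷ [])
      λ { (here refl) → ∈nbrs⁺ x∼s ; (there (here refl)) → ∈nbrs⁺ x∼t ; (there (there (here refl))) → ∈nbrs⁺ xy ; (there (there (there (here refl)))) → ∈nbrs⁺ xz }) low))
    where open CycleNbrs (nbrsOnCycle C x∈)

  -- Consecutive cycle vertices c and c′ with outer neighbours y and y′:
  -- once y and y′ differ in colour, give c′ the colour of y and go round the cycle, ending at c.
  record Detached (C : OddCycle Low) : Set where
    field
      {c c′ y y′} : Fin n
      c∼c′ : c ∼ c′
      c∼y  : c ∼ y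
      c′∼y′ : c′ ∼ y′
      c∈   : c ∈ cyc C
      c′∈  : c′ ∈ cyc C
      y∉   : y ∉ cyc C
      y′∉  : y′ ∉ cyc C
      extend : ∀ f → ProperColouring (G ∖ cyc C) 3 f → f y ≢ f y′ → Col

  detach : MinDeg3 G → (C : OddCycle Low) → Detached C
  detach md C@(oddCycle {c} _ (cons _ e (nil _)) _) = contradiction refl (∼⇒≢ e)
  detach md C@(oddCycle {c} o (cons {v = c′} low e w₁@(cons {v = c₂} low′ e′ w)) mn)
    with outerNbr C (here refl) (md (_ , e)) | outerNbr C (there (here refl)) (md (_ , e′))
  ... | y , cy , y∉ | y′ , cy′ , y′∉ = record
    { c∼c′ = e ; c∼y = cy ; c′∼y′ = cy′ ; c∈ = here refl ; c′∈ = there (here refl) ; y∉ = y∉ ; y′∉ = y′∉ ; extend = extend }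
    where
    uq : Unique (c ∷ c′ ∷ verts w)
    uq = cyc-unique C
    c′∉w : c′ ∉ verts w
    c′∉w with _ ∷ (p ∷ _) ← uq = λ q → All.lookup p q refl
    uw : Unique (verts w)
    uw with _ ∷ (_ ∷ p) ← uq = p
    extend : ∀ f → ProperColouring (G ∖ cyc C) 3 f → f y ≢ f y′ → Col
    extend f p ne =
      -- With the rest of the cycle uncoloured, the only coloured neighbour of `c′` is `y′`, so `c′`
      -- may copy the colour of `y`.
      let p₁ = extendColouring G {c = f} {v = c′} {κ = f y} {us = verts w ++ c ∷ []}
                 (λ u v e → p u v (∖-⊇ reorder e))
                 (λ {u} c′u u∉ eq → case u ≟ c′ of λ where
                   (yes refl) → ∼⇒≢ c′u refl
                   (no u≢c′) → ne (trans (≡.sym eq) (cong f (outerNbr-unique C (there (here refl)) low′ c′u cy′ (u∉′ u∉ u≢c′) y′∉))))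
          f₂ , p₂ , same = greedy w {rest = c ∷ []} (here refl) uw p₁
          -- The neighbours `c′` and `y` share a colour, so it is enough to avoid the at most two
          -- neighbours of `c` other than `c′`.
          κ , free = freeColour f₂ (kids c′ c) (s≤s⁻¹ (≤-trans (1+kids≤deg e) low))
          fc′ : f₂ c′ ≡ f y
          fc′ = trans (same c′∉w) (≔-same f c′ (f y))
          fy : f₂ y ≡ f y
          fy = trans (same (y∉ ∘ there ∘ there)) (≔-other f (f y) λ { refl → y∉ (there (here refl)) })
          p₃ = extendColouring G {c = f₂} {v = c} {κ = κ} {us = []} p₂ λ {u} cu _ → case u ≟ c′ of λ where
                 (yes refl) eq → free (∈kids⁺ cy (λ { refl → y∉ (there (here refl)) })) (trans fy (trans (≡.sym fc′) eq))
                 (no u≢c′) → free (∈kids⁺ cu u≢c′)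
      in _ , λ u v e → p₃ u v (e , (λ ()) , λ ())
      where
      reorder : ∀ {x} → x ∈ cyc C → x ∈ c′ ∷ verts w ++ c ∷ []
      reorder (here refl) = there (∈-++⁺ʳ (verts w) (here refl))
      reorder (there (here refl)) = here refl
      reorder (there (there x∈)) = there (∈-++⁺ˡ x∈)
      u∉′ : ∀ {u} → u ∉ verts w ++ c ∷ [] → u ≢ c′ → u ∉ cyc C
      u∉′ u∉ ne (here refl) = u∉ (∈-++⁺ʳ (verts w) (here refl))
      u∉′ u∉ ne (there (here refl)) = ne refl
      u∉′ u∉ ne (there (there x∈)) = u∉ (∈-++⁺ˡ x∈)

  module _ (nc : NoClosed 6) {C : OddCycle Low} (D : Detached C) where

    open Detached D
    open ShortCycles nc

    y≢y′ : y ≢ y′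
    y≢y′ refl = no3 c∼c′ c′∼y′ (∼-sym c∼y)

    linked : Graph n
    linked = link y y′ y≢y′ (G ∖ cyc C)

    linked-col : Neighbourhoods.Col linked → Col
    linked-col (f , p) = extend f (λ u v e → p u v (inj₁ e)) (p y y′ (inj₂ (inj₁ (refl , refl))))

    linked-active : ∀ {x} → Neighbourhoods.Active linked x → Active x × x ∉ cyc C
    linked-active (_ , inj₁ (e , x∉ , _)) = (_ , e) , x∉
    linked-active (_ , inj₂ (inj₁ (refl , _))) = (_ , ∼-sym c∼y) , y∉
    linked-active (_ , inj₂ (inj₂ (refl , _))) = (_ , ∼-sym c′∼y′) , y′∉

    linked-bound : ∀ {k} → Bound (7 + k) → Neighbourhoods.Bound linked k
    linked-bound {k} b xs u act = ℕₚ.+-cancelˡ-≤ 7 _ _ (≤-trans (+-monoˡ-≤ (length xs) (subst (7 ≤_) (≡.sym (length-verts (walk C))) (7≤len nc C)))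
      (≤-trans (≤-reflexive (≡.sym (length-++ (cyc C))))
        (b (cyc C ++ xs) (unique-++ (cyc-unique C) u (λ p q → proj₂ (linked-active (act q)) p))
          λ x∈ → [ verts-active (walk C) , (λ q → proj₁ (linked-active (act q))) ]′ (∈-++⁻ (cyc C) x∈))))

    unlinked-⊑ : unlink y y′ linked ⊑ (G ∖ cyc C)
    unlinked-⊑ = unlink-link y≢y′ {G ∖ cyc C}

-- Adjacent vertices of degree at least 4

module Rings {n : ℕ} (G : Graph n) (nc : Neighbourhoods.NoClosed G 6) {R : Fin n → Set} (R? : Decidable R)
  (few : ∀ xs → Unique xs → (∀ {x} → x ∈ xs → R x × Neighbourhoods.Active G x) → length xs ≤ 5) where

  open Neighbourhoods G
  open OddCycles G
  open ShortCycles nc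

  double : ℕ → ℕ
  double zero    = zero
  double (suc k) = suc (suc (double k))

  odd-double : ∀ k → odd (double k) ≡ false
  odd-double zero    = refl
  odd-double (suc k) = cong (not ∘ not) (odd-double k)

  Mixed : (Fin n → Set) → Set
  Mixed S = ∀ {x y} → S x → S y → x ∼ y → ¬ R x → ¬ R y → ⊥

  module _ {S : Fin n → Set} (mixed : Mixed S) where

    count : ∀ {a b k} → Walk S a b k → ℕ
    count w = length (filter R? (verts w))

    count-mono : ∀ {a a′ b k} {s : S a} {e : a ∼ a′} (w : Walk S a′ b k) → count w ≤ count (cons s e w)
    count-mono {a} w with R? a
    ... | yes _ = n≤1+n _
    ... | no _ = ≤-refl

    half≤count : ∀ {a b} k → (w : Walk S a b (double k)) → k ≤ count w
    half≤count zero _ = z≤n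
    half≤count {a} (suc k) (cons {v = a′} s e (cons s′ e′ w)) with R? a
    ... | yes r = s≤s (≤-trans (half≤count k w) (count-mono {s = s′} {e = e′} w))
    ... | no ¬r with R? a′
    ...   | yes r′ = s≤s (half≤count k w)
    ...   | no ¬r′ = ⊥-elim (mixed s s′ e ¬r ¬r′)

    data Alternating : ∀ {a b k} → Walk S a b k → Set where
      last : ∀ {a b} {s : S a} {e : a ∼ b} {t : S b} → ¬ R a → Alternating (cons s e (nil t))
      pair : ∀ {a a′ a″ b k} {s : S a} {e : a ∼ a′} {s′ : S a′} {e′ : a′ ∼ a″} {w : Walk S a″ b k} →
        ¬ R a → R a′ → Alternating w → Alternating (cons s e (cons s′ e′ w))

    -- Two consecutive vertices outside `R` are excluded, so `2j + 1` vertices with only `j` of them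
    -- in `R` must alternate, starting and ending outside `R`.
    tight : ∀ {a b} j (w : Walk S a b (suc (double j))) → count w ≤ j → Alternating w
    tight {a} zero (cons s e (nil _)) le with R? a
    ... | no ¬r = last ¬r
    tight {a} (suc j) (cons {v = a′} s e w₁@(cons s′ e′ w)) le with R? a
    ... | yes r = ⊥-elim (ℕₚ.<-irrefl refl (≤-trans (s≤s (half≤count (suc j) w₁)) le))
    ... | no ¬r with R? a′
    ...   | yes r′ = pair ¬r r′ (tight j w (s≤s⁻¹ le))
    ...   | no ¬r′ = ⊥-elim (mixed s s′ e ¬r ¬r′)

    count≤5 : (C : OddCycle S) → length (filter R? (cyc C)) ≤ 5
    count≤5 C = few _ (filter⁺ R? (cyc-unique C)) λ x∈ → let x∈C , r = ∈-filter⁻ R? x∈ in r , verts-active (walk C) x∈C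

    -- An odd cycle, of length `2j + 3`, rotated so that it starts with two consecutive vertices of
    -- `R`.
    record Shape (j : ℕ) : Set where
      constructor shape
      field
        {c₀ c₁ c₂} : Fin n
        s₀    : S c₀
        e₀    : c₀ ∼ c₁
        s₁    : S c₁
        e₁    : c₁ ∼ c₂
        rest  : Walk S c₂ c₀ (suc (double j))
        min′  : NoOdd< S (suc (suc (suc (double j))))
        R₀    : R c₀
        R₁    : R c₁

      cycle : OddCycle S
      cycle = oddCycle (cong (not ∘ not ∘ not) (odd-double j)) (cons s₀ e₀ (cons s₁ e₁ rest)) min′

    count-shape : ∀ {j} (N : Shape j) → length (filter R? (cyc (Shape.cycle N))) ≡ suc (suc (count (Shape.rest N)))
    count-shape (shape {c₀} {c₁} {c₂} s₀ e₀ s₁ e₁ rest _ R₀ R₁) =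
      cong length (trans (filter-accept R? R₀) (cong (c₀ ∷_) (filter-accept R? R₁)))

    -- Length at least 7 gives `j ≥ 2`. The two initial vertices and half of the remaining ones lie
    -- in `R`, so at least `j + 2` do, and 5 are available.
    shape-cases : ∀ {j} → Shape j → Shape 2 ⊎ Shape 3
    shape-cases {0} N = ⊥-elim (≤-absurd (7≤len nc (Shape.cycle N)))
    shape-cases {1} N = ⊥-elim (≤-absurd (7≤len nc (Shape.cycle N)))
    shape-cases {2} N = inj₁ N
    shape-cases {3} N = inj₂ N
    shape-cases {suc (suc (suc (suc j)))} N@(shape s₀ e₀ s₁ e₁ rest@(cons {c₂} s₂ e₂ w) min′ R₀ R₁) = ⊥-elim (≤-absurd (≤-trans
      (s≤s (s≤s (≤-trans (m≤m+n 4 j) (≤-trans (half≤count _ w) (count-mono {s = s₂} {e₂} w)))))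
      (≤-trans (≤-reflexive (≡.sym (count-shape N))) (count≤5 (Shape.cycle N)))))

    label : Fin n → Bool
    label x = does (R? x)

    -- If no two consecutive vertices were in `R`, membership in `R` would alternate along the walk,
    -- which is impossible around an odd cycle.
    normalise : OddCycle S → Shape 2 ⊎ Shape 3
    normalise C with scan (walk C)
      where
      Found : ∀ {a b k} → Walk S a b k → Set
      Found {a} {b} {k} _ = ∃₂ λ x y → ∃₂ λ i j → Walk S a x i × S x × x ∼ y × Walk S y b j × i + suc j ≡ k × R x × R y
      scan : ∀ {a b k} (w : Walk S a b k) → Found w ⊎ label b ≡ odd k xor label a
      scan (nil _) = inj₂ refl
      scan {a} (cons {v = a′} {k = k} s e w) with R? a | R? a′ | scan w
      ... | _ | _ | inj₁ (x , y , i , j , p , sx , e′ , q , eq , r , r′) =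
        inj₁ (x , y , suc i , j , cons s e p , sx , e′ , q , cong suc eq , r , r′)
      ... | yes r | yes r′ | inj₂ _ = inj₁ (a , a′ , 0 , k , nil s , s , e , w , refl , r , r′)
      ... | no ¬r | no ¬r′ | inj₂ _ = ⊥-elim (mixed s (start∈ w) e ¬r ¬r′)
      ... | yes _ | no _ | inj₂ h = inj₂ (trans h (flip (odd k)))
        where
        flip : ∀ o → o xor false ≡ not o xor true
        flip false = refl
        flip true = refl
      ... | no _ | yes _ | inj₂ h = inj₂ (trans h (flip (odd k)))
        where
        flip : ∀ o → o xor true ≡ not o xor false
        flip false = refl
        flip true = refl
    ... | inj₁ (x , y , i , j , p , sx , e , q , eq , r , r′) = build (append q p)
        (trans (cong odd len≡) (isOdd C)) (subst (NoOdd< S) (≡.sym len≡) (min C))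
      where
      len≡ : suc (j + i) ≡ len C
      len≡ = trans (cong suc (+-comm j i)) (trans (≡.sym (+-suc i j)) eq)
      build : ∀ {k} → Walk S y x k → odd (suc k) ≡ true → NoOdd< S (suc k) → Shape 2 ⊎ Shape 3
      build {suc k} (cons s₁ e₁ w) o mn with half k o
        where
        half : ∀ k → not (not (odd k)) ≡ true → ∃ λ h → k ≡ suc (double h)
        half 1 _ = 0 , refl
        half (suc (suc k)) o with h , refl ← half k (trans (cong (not ∘ not) (≡.sym (not-involutive (odd k)))) o) = suc h , refl
      ... | h , refl = shape-cases (shape {h} sx e s₁ e₁ w mn r r′)
      build {zero} (nil _) _ _ = contradiction refl (∼⇒≢ e)
    ... | inj₂ h = ⊥-elim (not-¬ refl (trans h (cong (_xor label (base C)) (isOdd C))))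

  module NineCycle {c₀ c₁ c₂ c₃ c₄ c₅ c₆ c₇ c₈ : Fin n} (e₀ : c₀ ∼ c₁) (e₁ : c₁ ∼ c₂) (e₂ : c₂ ∼ c₃) (e₃ : c₃ ∼ c₄) (e₄ : c₄ ∼ c₅)
    (e₅ : c₅ ∼ c₆) (e₆ : c₆ ∼ c₇) (e₇ : c₇ ∼ c₈) (e₈ : c₈ ∼ c₀) (n02 : c₀ ≢ c₂) (n13 : c₁ ≢ c₃) (n07 : c₀ ≢ c₇) (n18 : c₁ ≢ c₈) where

    bs : List (Fin n)
    bs = c₀ ∷ c₁ ∷ c₃ ∷ c₅ ∷ c₇ ∷ []

    -- An edge from `c₃`, `c₅` or `c₇` to a member of `bs` would close a cycle of length at most 5
    -- with an arc of the 9-cycle.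
    edge : ∀ {p q} → p ∈ bs → q ∈ bs → p ∼ q → p ≡ c₀ ⊎ p ≡ c₁
    edge (here refl) _ e = inj₁ refl
    edge (there (here refl)) _ e = inj₂ refl
    edge (there (there (here refl))) (here refl) e = ⊥-elim (no4 e₀ e₁ e₂ e n02 n13)
    edge (there (there (here refl))) (there (here refl)) e = ⊥-elim (no3 e₁ e₂ e)
    edge (there (there (here refl))) (there (there (here refl))) e = contradiction refl (∼⇒≢ e)
    edge (there (there (here refl))) (there (there (there (here refl)))) e = ⊥-elim (no3 e₃ e₄ (∼-sym e))
    edge (there (there (here refl))) (there (there (there (there (here refl))))) e = ⊥-elim (no5 e₃ e₄ e₅ e₆ (∼-sym e))
    edge (there (there (there (here refl)))) (here refl) e = ⊥-elim (no5 e₅ e₆ e₇ e₈ (∼-sym e))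
    edge (there (there (there (here refl)))) (there (here refl)) e = ⊥-elim (no5 e₁ e₂ e₃ e₄ e)
    edge (there (there (there (here refl)))) (there (there (here refl))) e = ⊥-elim (no3 e₃ e₄ e)
    edge (there (there (there (here refl)))) (there (there (there (here refl)))) e = contradiction refl (∼⇒≢ e)
    edge (there (there (there (here refl)))) (there (there (there (there (here refl))))) e = ⊥-elim (no3 e₅ e₆ (∼-sym e))
    edge (there (there (there (there (here refl))))) (here refl) e = ⊥-elim (no3 e₇ e₈ (∼-sym e))
    edge (there (there (there (there (here refl))))) (there (here refl)) e = ⊥-elim (no4 e₇ e₈ e₀ (∼-sym e) (n07 ∘ ≡.sym) (n18 ∘ ≡.sym))
    edge (there (there (there (there (here refl))))) (there (there (here refl))) e = ⊥-elim (no5 e₃ e₄ e₅ e₆ e)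
    edge (there (there (there (there (here refl))))) (there (there (there (here refl)))) e = ⊥-elim (no3 e₅ e₆ e)
    edge (there (there (there (there (here refl))))) (there (there (there (there (here refl))))) e = contradiction refl (∼⇒≢ e)

    -- c₅ is the only vertex of bs at distance 4 on the cycle from c₀ or c₁.
    partner : ∀ {x p q} → x ≢ c₂ → x ≢ c₈ → p ≡ c₀ ⊎ p ≡ c₁ → q ∈ bs → x ∼ p → x ∼ q → p ≢ q → q ≡ c₅
    partner _ _ _ (there (there (there (here refl)))) _ _ _ = refl
    partner _ _ (inj₁ refl) (here refl) xp xq ne = contradiction refl ne
    partner _ _ (inj₁ refl) (there (here refl)) xp xq ne = ⊥-elim (no3 xp e₀ (∼-sym xq))
    partner _ _ (inj₁ refl) (there (there (here refl))) xp xq ne = ⊥-elim (no5 xp e₀ e₁ e₂ (∼-sym xq))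
    partner _ x≢c₈ (inj₁ refl) (there (there (there (there (here refl))))) xp xq ne = ⊥-elim (no4 xq e₇ e₈ (∼-sym xp) x≢c₈ (ne ∘ ≡.sym))
    partner _ _ (inj₂ refl) (here refl) xp xq ne = ⊥-elim (no3 xq e₀ (∼-sym xp))
    partner _ _ (inj₂ refl) (there (here refl)) xp xq ne = contradiction refl ne
    partner x≢c₂ _ (inj₂ refl) (there (there (here refl))) xp xq ne = ⊥-elim (no4 xp e₁ e₂ (∼-sym xq) x≢c₂ ne)
    partner _ _ (inj₂ refl) (there (there (there (there (here refl))))) xp xq ne = ⊥-elim (no5 xq e₇ e₈ e₀ (∼-sym xp))

  module _ {S S′ : Fin n → Set} (mixed : Mixed S) (mixed′ : Mixed S′)
    (apart : ∀ {x} → S x → S′ x → R x) where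

    among : ∀ {rs} → length rs ≡ 5 → Unique rs → (∀ {x} → x ∈ rs → R x × Active x) → ∀ {x} → R x → Active x → x ∈ rs
    among {rs} len≡ u h {x} r act with x ∈? rs
    ... | yes p = p
    ... | no p = ⊥-elim (ℕₚ.<-irrefl refl (≤-trans (s≤s (few (x ∷ rs) (unique-∷ p u)
      λ { (here refl) → r , act ; (there q) → h q })) (≤-reflexive (cong suc (≡.sym len≡)))))

    module _ (C : OddCycle S) (seven : len C ≡ 7) (D : OddCycle S′) where

      onlyR : ∀ {x} → S′ x → x ∈ cyc C → R x
      onlyR p q = apart (verts∈ (walk C) q) p

      -- A vertex of D outside R has both its neighbours on D in R, and not both of them on C.
      extraR : ∃ λ t → t ∈ cyc D × R t × t ∉ cyc C
      extraR with Any.any? (¬? ∘ R?) (cyc D)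
      ... | no none = ⊥-elim (≤-absurd (≤-trans (7≤len nc D) (≤-trans (≤-reflexive (≡.sym (length-verts (walk D))))
              (few (cyc D) (cyc-unique D) λ {x} x∈ → isR x∈ (R? x) , verts-active (walk D) x∈))))
        where
        isR : ∀ {x} → x ∈ cyc D → Dec (R x) → R x
        isR _ (yes r) = r
        isR x∈ (no r) = contradiction (lose x∈ r) none
      ... | yes some with x , x∈ , ¬Rx ← find some = pick (nbrsOnCycle D x∈)
        where
        isR : ∀ {s} → s ∈ cyc D → x ∼ s → R s
        isR {s} s∈ e with R? s
        ... | yes r = r
        ... | no r = ⊥-elim (mixed′ (verts∈ (walk D) x∈) (verts∈ (walk D) s∈) e ¬Rx r)
        pick : CycleNbrs D x → ∃ λ t → t ∈ cyc D × R t × t ∉ cyc C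
        pick (cycleNbrs {s} {t} s∈ t∈ s≢t xs xt _) with s ∈? cyc C | t ∈? cyc C
        ... | no p | _ = s , s∈ , isR s∈ xs , p
        ... | yes _ | no p = t , t∈ , isR t∈ xt , p
        ... | yes p | yes q = contradiction (outside7 nc C seven (λ x∈C → ¬Rx (onlyR (verts∈ (walk D) x∈) x∈C)) p q xs xt) s≢t

      extraR⇒count≤4 : ∀ {t} → t ∈ cyc D → R t → t ∉ cyc C → length (filter R? (cyc C)) ≤ 4
      extraR⇒count≤4 {t} t∈ Rt t∉ = s≤s⁻¹
          (few (t ∷ filter R? (cyc C)) (unique-∷ (λ p → t∉ (proj₁ (∈-filter⁻ R? p))) (filter⁺ R? (cyc-unique C)))
            λ { (here refl) → Rt , verts-active (walk D) t∈ ; (there p) → let q , r = ∈-filter⁻ R? p in r , verts-active (walk C) q })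

      -- Apart from `t`, the set `R` lies on the 7-cycle. A vertex of `D` outside `R` whose
      -- neighbours on `D` both differ from `t` would have both of them on that cycle, against
      -- `outside7`; so `D` has three consecutive vertices in `R` away from `t`.
      throughR : ∀ {t bs} → Rebased D t → (∀ {x} → x ∈ bs → x ∈ cyc C) → (∀ {x} → R x → Active x → x ≢ t → x ∈ bs) →
        ∃ λ p → ∃ λ q → ∃ λ r → p ∈ bs × q ∈ bs × r ∈ bs × p ∼ q × q ∼ r × p ≢ r
      throughR {t} {bs} D′ bs⊆C inR = go (Rebased.rwalk D′) (7≤len nc D) (cyc-unique (Rebased.cycle D′))
        where
        mid : ∀ {x y z} → S′ x → S′ y → S′ z → x ∼ y → y ∼ z → x ≢ z → x ≢ t → z ≢ t → R y
        mid {x} {y} {z} sx sy sz xy yz x≢z x≢t z≢t with R? y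
        ... | yes r = r
        ... | no ¬r = contradiction (outside7 nc C seven (¬r ∘ onlyR sy) (bs⊆C (on sx (∼-sym xy) x≢t)) (bs⊆C (on sz yz z≢t)) (∼-sym xy) yz) x≢z
          where
          on : ∀ {s} → S′ s → y ∼ s → s ≢ t → s ∈ bs
          on {s} ss ys s≢t with R? s
          ... | yes r = inR r (_ , ∼-sym ys) s≢t
          ... | no r = ⊥-elim (mixed′ sy ss ys ¬r r)
        go : ∀ {k} (w : Walk S′ t t k) → 7 ≤ k → Unique (verts w) →
          ∃ λ p → ∃ λ q → ∃ λ r → p ∈ bs × q ∈ bs × r ∈ bs × p ∼ q × q ∼ r × p ≢ r
        go (cons s₀ f₀ (cons {d₁} s₁ f₁ (cons {d₂} s₂ f₂ (cons {d₃} s₃ f₃ (cons {d₄} s₄ f₄ (cons {d₅} s₅ f₅ _)))))) _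
          ((t1 ∷ t2 ∷ t3 ∷ t4 ∷ t5 ∷ _) ∷ (_ ∷ n13 ∷ _) ∷ (_ ∷ n24 ∷ _) ∷ (_ ∷ n35 ∷ _) ∷ _) =
          d₂ , d₃ , d₄ , inR (mid s₁ s₂ s₃ f₁ f₂ n13 (t1 ∘ ≡.sym) (t3 ∘ ≡.sym)) (_ , f₂) (t2 ∘ ≡.sym) ,
            inR (mid s₂ s₃ s₄ f₂ f₃ n24 (t2 ∘ ≡.sym) (t4 ∘ ≡.sym)) (_ , f₃) (t3 ∘ ≡.sym) ,
            inR (mid s₃ s₄ s₅ f₃ f₄ n35 (t3 ∘ ≡.sym) (t5 ∘ ≡.sym)) (_ , f₄) (t4 ∘ ≡.sym) , f₂ , f₃ , n24
        go (nil _) () _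
        go (cons _ _ (nil _)) (s≤s ()) _
        go (cons _ _ (cons _ _ (nil _))) (s≤s (s≤s ())) _
        go (cons _ _ (cons _ _ (cons _ _ (nil _)))) (s≤s (s≤s (s≤s ()))) _
        go (cons _ _ (cons _ _ (cons _ _ (cons _ _ (nil _))))) (s≤s (s≤s (s≤s (s≤s ())))) _
        go (cons _ _ (cons _ _ (cons _ _ (cons _ _ (cons _ _ (nil _)))))) (s≤s (s≤s (s≤s (s≤s (s≤s ()))))) _

    -- The extra vertex of `R` leaves at most four for the 7-cycle, which is the minimum, so the
    -- cycle alternates after its first two vertices. Among those four the only edge is the one
    -- between `c₀` and `c₁`, while `throughR` yields a path with two edges.
    sevenRing : Shape mixed 2 → OddCycle S′ → ⊥
    sevenRing N D with t , t∈ , Rt , t∉ ← extraR (Shape.cycle N) refl D =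
      go N t∉ Rt (verts-active (walk D) t∈) (rebase D t∈)
        (s≤s⁻¹ (s≤s⁻¹ (subst (_≤ 4) (count-shape mixed N) (extraR⇒count≤4 (Shape.cycle N) refl D t∈ Rt t∉))))
      where
      go : ∀ {t} (M : Shape mixed 2) → t ∉ cyc (Shape.cycle M) → R t → Active t → Rebased D t → count mixed (Shape.rest M) ≤ 2 → ⊥
      go {t} M@(shape {c₀} {c₁} s₀ e₀ s₁ e₁ rest@(cons {c₂} _ e₂ (cons {c₃} _ e₃ (cons _ e₄ (cons {c₅} _ e₅ (cons _ e₆ (nil _)))))) min′ R₀ R₁) t∉ Rt at D′ le
        with tight mixed 2 rest le | cyc-unique (Shape.cycle M)
      ... | pair _ R₃ (pair _ R₅ (last _))
          | (n01 ∷ n02 ∷ n03 ∷ n04 ∷ n05 ∷ _) ∷ (n12 ∷ n13 ∷ n14 ∷ n15 ∷ _) ∷ (n23 ∷ _) ∷ (_ ∷ n35 ∷ _) ∷ _ =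
          finish (throughR (Shape.cycle M) refl D D′ inside onBs)
        where
        bs : List (Fin n)
        bs = c₀ ∷ c₁ ∷ c₃ ∷ c₅ ∷ []
        inside : ∀ {x} → x ∈ bs → x ∈ cyc (Shape.cycle M)
        inside (here p) = here p
        inside (there (here p)) = there (here p)
        inside (there (there (here p))) = there (there (there (here p)))
        inside (there (there (there (here p)))) = there (there (there (there (there (here p)))))
        isR : ∀ {x} → x ∈ t ∷ bs → R x × Active x
        isR (here refl) = Rt , at
        isR (there (here refl)) = R₀ , _ , e₀
        isR (there (there (here refl))) = R₁ , _ , e₁
        isR (there (there (there (here refl)))) = R₃ , _ , e₃
        isR (there (there (there (there (here refl))))) = R₅ , _ , e₅
        onBs : ∀ {x} → R x → Active x → x ≢ t → x ∈ bs
        onBs r a x≢t with among {t ∷ bs} refl (unique-∷ (t∉ ∘ inside) ((n01 ∷ n03 ∷ n05 ∷ []) ∷ (n13 ∷ n15 ∷ []) ∷ (n35 ∷ []) ∷ [] ∷ [])) isR r a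
        ... | here eq = contradiction eq x≢t
        ... | there p = p
        edge : ∀ {p q} → p ∈ bs → q ∈ bs → p ∼ q → (p ≡ c₀ × q ≡ c₁) ⊎ (p ≡ c₁ × q ≡ c₀)
        edge (here refl) (there (here refl)) e = inj₁ (refl , refl)
        edge (there (here refl)) (here refl) e = inj₂ (refl , refl)
        edge (here refl) (here refl) e = contradiction refl (∼⇒≢ e)
        edge (there (here refl)) (there (here refl)) e = contradiction refl (∼⇒≢ e)
        edge (there (there (here refl))) (there (there (here refl))) e = contradiction refl (∼⇒≢ e)
        edge (there (there (there (here refl)))) (there (there (there (here refl)))) e = contradiction refl (∼⇒≢ e)
        edge (here refl) (there (there (here refl))) e = ⊥-elim (no4 e₀ e₁ e₂ (∼-sym e) n02 n13)
        edge (there (there (here refl))) (here refl) e = ⊥-elim (no4 e₀ e₁ e₂ e n02 n13)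
        edge (here refl) (there (there (there (here refl)))) e = ⊥-elim (no3 e₅ e₆ e)
        edge (there (there (there (here refl)))) (here refl) e = ⊥-elim (no3 e₅ e₆ (∼-sym e))
        edge (there (here refl)) (there (there (here refl))) e = ⊥-elim (no3 e₁ e₂ (∼-sym e))
        edge (there (there (here refl))) (there (here refl)) e = ⊥-elim (no3 e₁ e₂ e)
        edge (there (here refl)) (there (there (there (here refl)))) e = ⊥-elim (no5 e₁ e₂ e₃ e₄ (∼-sym e))
        edge (there (there (there (here refl)))) (there (here refl)) e = ⊥-elim (no5 e₁ e₂ e₃ e₄ e)
        edge (there (there (here refl))) (there (there (there (here refl)))) e = ⊥-elim (no3 e₃ e₄ (∼-sym e))
        edge (there (there (there (here refl)))) (there (there (here refl))) e = ⊥-elim (no3 e₃ e₄ e)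
        finish : (∃ λ p → ∃ λ q → ∃ λ r → p ∈ bs × q ∈ bs × r ∈ bs × p ∼ q × q ∼ r × p ≢ r) → ⊥
        finish (p , q , r , p∈ , q∈ , r∈ , pq , qr , p≢r) with edge p∈ q∈ pq | edge q∈ r∈ qr
        ... | inj₁ (refl , refl) | inj₂ (_ , refl) = p≢r refl
        ... | inj₂ (refl , refl) | inj₁ (_ , refl) = p≢r refl
        ... | inj₁ (refl , refl) | inj₁ (eq , _) = n01 (≡.sym eq)
        ... | inj₂ (refl , refl) | inj₂ (eq , _) = n01 eq

    -- Both cycles contain all five vertices of `R`. The initial edge of the second one lies within
    -- `R`, so it joins `c₀` and `c₁`; by `partner` both `d₃` and `d₇` are then `c₅`.
    nineRings : Shape mixed 3 → Shape mixed′ 3 → ⊥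
    nineRings N@(shape {c₀} {c₁} s₀ e₀ s₁ e₁ rest@(cons {c₂} _ e₂ (cons {c₃} _ e₃ (cons {c₄} _ e₄ (cons {c₅} _ e₅ (cons {c₆} _ e₆ (cons {c₇} _ e₇ (cons {c₈} _ e₈ (nil _)))))))) min′ R₀ R₁)
      N′@(shape {d₀} {d₁} t₀ f₀ t₁ f₁ rest′@(cons {d₂} t₂ f₂ (cons {d₃} _ f₃ (cons {d₄} _ f₄ (cons {d₅} _ f₅ (cons {d₆} _ f₆ (cons {d₇} t₇ f₇ (cons {d₈} t₈ f₈ (nil _)))))))) _ R₀′ R₁′)
      with tight mixed 3 rest (s≤s⁻¹ (s≤s⁻¹ (subst (_≤ 5) (count-shape mixed N) (count≤5 mixed (Shape.cycle N)))))
         | tight mixed′ 3 rest′ (s≤s⁻¹ (s≤s⁻¹ (subst (_≤ 5) (count-shape mixed′ N′) (count≤5 mixed′ (Shape.cycle N′)))))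
         | cyc-unique (Shape.cycle N) | cyc-unique (Shape.cycle N′)
    ... | pair _ R₃ (pair _ R₅ (pair _ R₇ (last _))) | pair ¬R₂ R₃′ (pair _ R₅′ (pair _ R₇′ (last ¬R₈)))
        | (n01 ∷ n02 ∷ n03 ∷ _ ∷ n05 ∷ _ ∷ n07 ∷ _) ∷ (_ ∷ n13 ∷ _ ∷ n15 ∷ _ ∷ n17 ∷ n18 ∷ _) ∷ _ ∷ (_ ∷ n35 ∷ _ ∷ n37 ∷ _) ∷ _ ∷ (_ ∷ n57 ∷ _) ∷ _
        | (m01 ∷ _ ∷ _ ∷ _ ∷ _ ∷ _ ∷ m07 ∷ _) ∷ (_ ∷ m13 ∷ _) ∷ _ ∷ (_ ∷ _ ∷ _ ∷ m37 ∷ _) ∷ _ = finish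
      where
      open NineCycle e₀ e₁ e₂ e₃ e₄ e₅ e₆ e₇ e₈ n02 n13 n07 n18
      isR : ∀ {x} → x ∈ bs → R x × Active x
      isR x∈ = All.lookup {P = λ x → R x × Active x}
        ((R₀ , _ , e₀) ∷ (R₁ , _ , e₁) ∷ (R₃ , _ , e₃) ∷ (R₅ , _ , e₅) ∷ (R₇ , _ , e₇) ∷ []) x∈
      onBs : ∀ {x} → R x → Active x → x ∈ bs
      onBs = among refl ((n01 ∷ n03 ∷ n05 ∷ n07 ∷ []) ∷ (n13 ∷ n15 ∷ n17 ∷ []) ∷ (n35 ∷ n37 ∷ []) ∷ (n57 ∷ []) ∷ [] ∷ []) isR
      off : ∀ {x c} → S′ x → ¬ R x → c ∈ cyc (Shape.cycle N) → x ≢ c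
      off sx ¬r c∈ refl = ¬r (apart (verts∈ (walk (Shape.cycle N)) c∈) sx)
      c₂∈ : c₂ ∈ cyc (Shape.cycle N)
      c₂∈ = there (there (here refl))
      c₈∈ : c₈ ∈ cyc (Shape.cycle N)
      c₈∈ = there (there (there (there (there (there (there (there (here refl))))))))
      finish : ⊥
      finish = m37 (trans
        (partner (off t₂ ¬R₂ c₂∈) (off t₂ ¬R₂ c₈∈) (edge d₁∈ d₀∈ (∼-sym f₀)) (onBs R₃′ (_ , f₃)) (∼-sym f₁) f₂ m13)
        (≡.sym (partner (off t₈ ¬R₈ c₂∈) (off t₈ ¬R₈ c₈∈) (edge d₀∈ d₁∈ f₀) (onBs R₇′ (_ , f₇)) f₈ (∼-sym f₇) m07)))
        where
        d₀∈ : d₀ ∈ bs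
        d₀∈ = onBs R₀′ (_ , f₀)
        d₁∈ : d₁ ∈ bs
        d₁∈ = onBs R₁′ (_ , f₁)

-- The case of girth 6

module _ {n : ℕ} (G : Graph n) where

  open Neighbourhoods G
  open OddCycles G
  open SubSizes G
  open LowCycles G

  noHighEdge : NoClosed 6 → MinDeg3 G → Bound 25 → ¬ Col → ∀ {u v} → u ∼ v → ¬ Low u → ¬ Low v → ⊥
  noHighEdge nc md b nocol {u} {v} uv hu hv =
    bipartite⊎oddCycle (nonbip u) λ C → bipartite⊎oddCycle (nonbip v) λ D → finish (normalise mixedᵤ C) (normalise mixedᵥ D) C D
    where
    open ShortCycles nc
    -- A vertex at distance at least 3 from u lies outside T or is a grandchild of v, and vice versa.
    T : List (Fin n)
    T = sub 2 v u ++ sub 2 u v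
    T-unique : Unique T
    T-unique = edge-subs-unique nc 2 2 uv (s≤s (s≤s (s≤s (s≤s (s≤s z≤n))))) (s≤s (s≤s (s≤s (s≤s (s≤s z≤n))))) ≤-refl
    half : ∀ p {a} → Active a → ¬ Low a → 10 ≤ length (sub 2 p a)
    half p act high = sub-suc≥ 1 p _ (s≤s⁻¹ (≤-trans (≰⇒> high) (deg≤1+kids p _))) λ x∈ →
      ≤-trans (md (active-∼ (proj₁ (∈kids⁻ x∈)))) (deg≤sub1 _ _)
    R : Fin n → Set
    R x = x ∉ T
    R? : ∀ x → Dec (R x)
    R? x = ¬? (x ∈? T)
    few : ∀ xs → Unique xs → (∀ {x} → x ∈ xs → R x × Active x) → length xs ≤ 5
    few xs uq h = ℕₚ.+-cancelʳ-≤ 20 (length xs) 5 (≤-trans (+-monoʳ-≤ (length xs)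
        (≤-trans (+-mono-≤ (half v (_ , uv) hu) (half u (active-∼ uv) hv)) (≤-reflexive (≡.sym (length-++ (sub 2 v u))))))
      (≤-trans (≤-reflexive (≡.sym (length-++ xs))) (b (xs ++ T) (unique-++ uq T-unique (λ p → proj₁ (h p))) act)))
      where
      act : ∀ {x} → x ∈ xs ++ T → Active x
      act x∈ with ∈-++⁻ xs x∈
      ... | inj₁ p = proj₂ (h p)
      ... | inj₂ p with ∈-++⁻ (sub 2 v u) p
      ...   | inj₁ q = sub-active 2 (_ , uv) q
      ...   | inj₂ q = sub-active 2 (active-∼ uv) q
    open Rings G nc R? few
    nonbip : ∀ r (g : Fin n → Bool) → ¬ (∀ {x y} → Far r x → Far r y → x ∼ y → g x ≢ g y)
    nonbip r g p = let open RootColourings (farBipartite⇒colourings G nc r [] g p) in nocol (colouring true , proper true)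
    grandchild : ∀ {p a x} → p ∼ a → Far p x → x ∈ sub 2 p a → ∃ λ c → a ∼ c × c ∼ x
    grandchild pa (_ , p≁x , none) x∈ with ∈sub⁻ 2 x∈
    ... | 0 , _ , stop = contradiction pa p≁x
    ... | 1 , _ , step e _ stop = contradiction e (none pa)
    ... | 2 , _ , step e _ (step e′ _ stop) = _ , e , e′
    ... | suc (suc (suc _)) , s≤s (s≤s ()) , _
    -- Both vertices are grandchildren of `a`, so the edge between them would close a walk of length
    -- 5 through `a`.
    cousins : ∀ {p a x y} → p ∼ a → Far p x → Far p y → x ∼ y → x ∈ sub 2 p a → y ∈ sub 2 p a → ⊥
    cousins pa fx fy xy x∈ y∈ with _ , ac , cx ← grandchild pa fx x∈ | _ , ad , dy ← grandchild pa fy y∈ =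
      no5 ac cx xy (∼-sym dy) (∼-sym ad)
    inT : ∀ {x} → ¬ R x → x ∈ T
    inT {x} ¬r with x ∈? T
    ... | yes p = p
    ... | no p = contradiction p ¬r
    sideᵤ : ∀ {x} → Far u x → ¬ R x → x ∈ sub 2 u v
    sideᵤ fx ¬r with ∈-++⁻ (sub 2 v u) (inT ¬r)
    ... | inj₁ p = contradiction p (far∉sub _ fx)
    ... | inj₂ p = p
    sideᵥ : ∀ {x} → Far v x → ¬ R x → x ∈ sub 2 v u
    sideᵥ fx ¬r with ∈-++⁻ (sub 2 v u) (inT ¬r)
    ... | inj₁ p = p
    ... | inj₂ p = contradiction p (far∉sub _ fx)
    mixedᵤ : Mixed (Far u)
    mixedᵤ fx fy e p q = cousins uv fx fy e (sideᵤ fx p) (sideᵤ fy q)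
    mixedᵥ : Mixed (Far v)
    mixedᵥ fx fy e p q = cousins (∼-sym uv) fx fy e (sideᵥ fx p) (sideᵥ fy q)
    apart : ∀ {x} → Far u x → Far v x → R x
    apart fu fv x∈ with ∈-++⁻ (sub 2 v u) x∈
    ... | inj₁ p = far∉sub u fu p
    ... | inj₂ p = far∉sub v fv p
    finish : Shape mixedᵤ 2 ⊎ Shape mixedᵤ 3 → Shape mixedᵥ 2 ⊎ Shape mixedᵥ 3 → OddCycle (Far u) → OddCycle (Far v) → ⊥
    finish (inj₁ N) _ _ D = sevenRing mixedᵤ mixedᵥ apart N D
    finish _ (inj₁ N) C _ = sevenRing mixedᵥ mixedᵤ (λ p q → apart q p) N C
    finish (inj₂ N) (inj₂ M) _ _ = nineRings mixedᵤ mixedᵥ apart N M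

  girth6-core : NoClosed 6 → Bound 25 → MinDeg3 G → ¬ ¬ Col
  girth6-core nc b md nocol = lowOddCycle (noHighEdge nc md b nocol) nocol λ C →
    let D = detach md C
        F = linked nc D
    in Separation.separation (Detached.y D) (Detached.y′ D) F
      (⊑-noClosed {G = unlink _ _ F} {H = G} (λ e → ∖-⊑ {G = G} (unlinked-⊑ nc D e)) nc)
      (linked-bound nc D b) (λ c → nocol (linked-col nc D c))

girth6-colourable : ∀ {n} (G : Graph n) → Neighbourhoods.NoClosed G 6 → Neighbourhoods.Bound G 25 → ¬ ¬ Neighbourhoods.Col G
girth6-colourable G nc b = reduceToCore (λ G → Neighbourhoods.NoClosed G 6 × Neighbourhoods.Bound G 25)
  (λ {G} {v} (nc , b) → ⊑-noClosed {G = G ∖ (v ∷ [])} {H = G} proj₁ nc , ⊑-bound {G = G ∖ (v ∷ [])} {H = G} proj₁ b)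
  (λ G (nc , b) → girth6-core G nc b) 25 G b (nc , b)

-- Two prescribed vertices of different colours, in girth 7

module Separation7 {n : ℕ} (G : Graph n) (nc : Neighbourhoods.NoClosed G 7) where

  open Neighbourhoods G
  open OddCycles G
  open SubSizes G

  nc6 : NoClosed 6
  nc6 = noClosed-mono (n≤1+n 6) nc

  open ShortCycles nc6

  Path : Fin n → Fin n → ℕ → Set
  Path = Walk (λ _ → ⊤)

  Apart : Fin n → Fin n → Set
  Apart p p′ = ∀ {j} → j ≤ 3 → ¬ Path p p′ j

  path1 : ∀ {a b} → a ∼ b → Path a b 1
  path1 e = cons tt e (nil tt)

  path2 : ∀ {a b c} → a ∼ b → b ∼ c → Path a c 2
  path2 e e′ = cons tt e (path1 e′)

  path3 : ∀ {a b c d} → a ∼ b → b ∼ c → c ∼ d → Path a d 3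
  path3 e e′ e″ = cons tt e (path2 e′ e″)

  avoid2 : ∀ {v} → 3 ≤ deg v → ∀ a b → ∃ λ w → v ∼ w × w ≢ a × w ≢ b
  avoid2 {v} le a b with any? (λ w → (v ∼? w) ×-dec (¬? (w ≟ a) ×-dec ¬? (w ≟ b)))
  ... | yes found = found
  ... | no none = ⊥-elim (≤-absurd (≤-trans le (unique⊆⇒length≤ {ys = a ∷ b ∷ []} (nbrs-unique v) inside)))
    where
    inside : ∀ {w} → w ∈ nbrs v → w ∈ a ∷ b ∷ []
    inside {w} w∈ with w ≟ a | w ≟ b
    ... | yes p | _ = here p
    ... | no _ | yes q = there (here q)
    ... | no p | no q = contradiction (w , ∈nbrs⁻ w∈ , p , q) none

  avoid1 : ∀ {v} → 2 ≤ deg v → ∀ a → ∃ λ w → v ∼ w × w ≢ a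
  avoid1 le a with s , t , vs , vt , s≢t ← twoNbrs le with s ≟ a
  ... | no p = s , vs , p
  ... | yes refl = t , vt , s≢t ∘ ≡.sym

  onlyThree : ∀ {v a b c w} → deg v ≤ 3 → v ∼ a → v ∼ b → v ∼ c → a ≢ b → a ≢ c → b ≢ c → v ∼ w → w ∈ a ∷ b ∷ c ∷ []
  onlyThree {v} {a} {b} {c} {w} le va vb vc ab ac bc vw with w ∈? (a ∷ b ∷ c ∷ [])
  ... | yes p = p
  ... | no p = ⊥-elim (≤-absurd (≤-trans (unique⊆⇒length≤ {xs = w ∷ a ∷ b ∷ c ∷ []} (unique-∷ p ((ab ∷ ac ∷ []) ∷ (bc ∷ []) ∷ [] ∷ []))
      λ { (here refl) → ∈nbrs⁺ vw ; (there (here refl)) → ∈nbrs⁺ va ; (there (there (here refl))) → ∈nbrs⁺ vb ; (there (there (there (here refl)))) → ∈nbrs⁺ vc }) le))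

  -- Five steps without turning back visit six different vertices in girth 6. Six are too many
  -- beside an odd cycle and a ball of 10, since 7 + 10 + 6 exceeds 22. The start `p₀` is exempt
  -- from `next`, so it may be a vertex with few continuations.
  longWalk : ∀ {Z : Fin n → Set} {p₀} → Z p₀ → (∃ λ w → p₀ ∼ w × Z w) →
    (∀ {z} prev → Z z → z ≢ p₀ → z ∼ prev → ∃ λ w → z ∼ w × w ≢ prev × Z w) →
    ∃ λ zs → length zs ≡ 6 × Unique zs × (∀ {z} → z ∈ zs → Z z × Active z)
  longWalk {Z} {p₀} z₀ (p₁ , e₀ , z₁) next
    with p₂ , e₁ , n02 , z₂ ← next p₀ z₁ (∼⇒≢ (∼-sym e₀)) (∼-sym e₀)
    with p₃ , e₂ , n13 , z₃ ← next p₁ z₂ n02 (∼-sym e₁)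
    with p₄ , e₃ , n24 , z₄ ← next p₂ z₃ (λ { refl → no3 e₀ e₁ e₂ }) (∼-sym e₂)
    with p₅ , e₄ , n35 , z₅ ← next p₃ z₄ (λ { refl → no4 e₀ e₁ e₂ e₃ (n02 ∘ ≡.sym) (n13 ∘ ≡.sym) }) (∼-sym e₃) =
      p₀ ∷ p₁ ∷ p₂ ∷ p₃ ∷ p₄ ∷ p₅ ∷ [] , refl ,
      (∼⇒≢ e₀ ∷ n02 ∘ ≡.sym ∷ (λ { refl → no3 e₀ e₁ e₂ }) ∷ (λ { refl → no4 e₀ e₁ e₂ e₃ (n02 ∘ ≡.sym) (n13 ∘ ≡.sym) }) ∷ (λ { refl → no5 e₀ e₁ e₂ e₃ e₄ }) ∷ []) ∷
      (∼⇒≢ e₁ ∷ n13 ∘ ≡.sym ∷ (λ { refl → no3 e₁ e₂ e₃ }) ∷ (λ { refl → no4 e₁ e₂ e₃ e₄ (n13 ∘ ≡.sym) (n24 ∘ ≡.sym) }) ∷ []) ∷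
      (∼⇒≢ e₂ ∷ n24 ∘ ≡.sym ∷ (λ { refl → no3 e₂ e₃ e₄ }) ∷ []) ∷ (∼⇒≢ e₃ ∷ n35 ∘ ≡.sym ∷ []) ∷ (∼⇒≢ e₄ ∷ []) ∷ [] ∷ [] ,
      λ { (here refl) → z₀ , _ , e₀ ; (there (here refl)) → z₁ , _ , e₁ ; (there (there (here refl))) → z₂ , _ , e₂
        ; (there (there (there (here refl)))) → z₃ , _ , e₃ ; (there (there (there (there (here refl))))) → z₄ , _ , e₄
        ; (there (there (there (there (there (here refl)))))) → z₅ , _ , ∼-sym e₄ }

  module _ (r : Fin n) where

    second? : ∀ q → Dec (Second r q)
    second? q = ¬? (q ≟ r) ×-dec any? (λ a → (r ∼? a) ×-dec (a ∼? q))

    SecondNbr : Fin n → Set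
    SecondNbr z = ∃ λ q → z ∼ q × Second r q

    secondNbr? : ∀ z → Dec (SecondNbr z)
    secondNbr? z = any? (λ q → (z ∼? q) ×-dec second? q)

    farNbr : ∀ {z w} → Far r z → z ∼ w → Second r w ⊎ Far r w
    farNbr {z} {w} (_ , r≁z , none) zw with layer r w
    ... | root refl = contradiction (∼-sym zw) r≁z
    ... | first e = contradiction (∼-sym zw) (none e)
    ... | second w≢r _ e e′ = inj₁ (w≢r , _ , e , e′)
    ... | beyond a b c = inj₂ (a , b , c)

    -- Two such neighbours would give a closed walk of length 6 through `r` and `z`; here girth 7 is
    -- used.
    secondNbr-unique : ∀ {z q q′} → Far r z → z ∼ q → Second r q → z ∼ q′ → Second r q′ → q ≡ q′
    secondNbr-unique {z} {q} {q′} (z≢r , r≁z , none) zq (q≢r , a , ra , aq) zq′ (q′≢r , a′ , ra′ , aq′) with q ≟ q′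
    ... | yes eq = eq
    ... | no ne = ⊥-elim (meet nc zq (step (∼-sym aq) (λ { refl → r≁z ra }) (step (∼-sym ra) (q≢r ∘ ≡.sym) stop))
      (step zq′ (ne ∘ ≡.sym) (step (∼-sym aq′) (λ { refl → r≁z ra′ }) (step (∼-sym ra′) (q′≢r ∘ ≡.sym) stop))) ≤-refl)

    nextFar : ∀ {z} prev → Far r z → 3 ≤ deg z → ∃ λ w → z ∼ w × w ≢ prev × Far r w
    nextFar {z} prev fz le with secondNbr? z
    ... | yes (q , zq , sq) with w , zw , w≢prev , w≢q ← avoid2 le prev q | farNbr fz zw
    ...   | inj₁ sw = contradiction (secondNbr-unique fz zw sw zq sq) w≢q
    ...   | inj₂ fw = w , zw , w≢prev , fw
    nextFar {z} prev fz le | no none with w , zw , w≢prev , _ ← avoid2 le prev prev | farNbr fz zw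
    ...   | inj₁ sw = contradiction (w , zw , sw) none
    ...   | inj₂ fw = w , zw , w≢prev , fw

    far∈sub3 : ∀ {z} → Far r z → z ∈ sub 3 r r → SecondNbr z
    far∈sub3 (z≢r , r≁z , none) z∈ with ∈sub⁻ 3 z∈
    ... | 0 , _ , stop = contradiction refl z≢r
    ... | 1 , _ , step e _ stop = contradiction e r≁z
    ... | 2 , _ , step e _ (step e′ _ stop) = contradiction e′ (none e)
    ... | 3 , _ , step e _ (step e′ ne (step e″ _ stop)) = _ , ∼-sym e″ , ne , _ , e , e′
    ... | suc (suc (suc (suc _))) , s≤s (s≤s (s≤s ())) , _

    near∈sub2 : ∀ z → z ∈ sub 2 r r ⊎ Far r z
    near∈sub2 z with layer r z
    ... | root refl = inj₁ (here refl)
    ... | first e = inj₁ (∈sub⁺ {d = 2} {k = 1} (s≤s z≤n) (step e (∼⇒≢ (∼-sym e)) stop))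
    ... | second z≢r _ e e′ = inj₁ (∈sub⁺ {d = 2} {k = 2} ≤-refl (step e (∼⇒≢ (∼-sym e)) (step e′ z≢r stop)))
    ... | beyond a b c = inj₂ (a , b , c)

    -- A neighbour at distance 2 from `r` and the two neighbours on the cycle already account for
    -- degree 3.
    noExit : ∀ {S} (C : OddCycle S) → (∀ {x} → S x → Far r x) → ∀ {w z} → w ∈ cyc C → deg w ≤ 3 → SecondNbr w → w ∼ z → Far r z → z ∈ cyc C
    noExit C S⊆far {w} {z} w∈ le (q , wq , sq) wz fz with cycleNbrs {s} {t} s∈ t∈ s≢t ws wt _ ← nbrsOnCycle C w∈
      with onlyThree le wq ws wt (λ { refl → second∉far r sq (S⊆far (verts∈ (walk C) s∈)) }) (λ { refl → second∉far r sq (S⊆far (verts∈ (walk C) t∈)) }) s≢t wz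
    ... | here refl = contradiction fz (second∉far r sq)
    ... | there (here refl) = s∈
    ... | there (there (here refl)) = t∈

    tooManyFar : ∀ {S} (C : OddCycle S) → (∀ {x} → S x → Far r x) → Bound 22 → Active r → 10 ≤ length (sub 2 r r) →
      (∃ λ zs → length zs ≡ 6 × Unique zs × (∀ {z} → z ∈ zs → (Far r z × z ∉ cyc C) × Active z)) → ⊥
    tooManyFar C S⊆far b act ball (zs , len≡ , u , h) = ≤-absurd (begin
        7 + 6 + 10                                ≤⟨ +-mono-≤ (+-mono-≤ (7≤len nc6 C) (≤-reflexive (≡.sym len≡))) ball ⟩
        len C + length zs + length (sub 2 r r)    ≡⟨ cong (λ m → m + length zs + length (sub 2 r r)) (≡.sym (length-verts (walk C))) ⟩
        length (cyc C) + length zs + length (sub 2 r r) ≡⟨ cong (_+ length (sub 2 r r)) (≡.sym (length-++ (cyc C))) ⟩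
        length (cyc C ++ zs) + length (sub 2 r r) ≤⟨ farBound nc6 b act (cyc C ++ zs) (unique-++ (cyc-unique C) u (λ p q → proj₂ (proj₁ (h q)) p))
           (λ x∈ → [ (λ p → S⊆far (verts∈ (walk C) p) , verts-active (walk C) p) , (λ q → proj₁ (proj₁ (h q)) , proj₂ (h q)) ]′ (∈-++⁻ (cyc C) x∈)) ⟩
        22 ∎)
      where open ℕₚ.≤-Reasoning

    cycle≤12 : ∀ {S} (C : OddCycle S) → (∀ {x} → S x → Far r x) → Bound 22 → Active r → 10 ≤ length (sub 2 r r) → len C ≤ 12
    cycle≤12 C S⊆far b act ball = ℕₚ.+-cancelʳ-≤ 10 _ 12 (≤-trans (+-mono-≤ (≤-reflexive (≡.sym (length-verts (walk C)))) ball)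
      (farBound nc6 b act (cyc C) (cyc-unique C) (λ p → S⊆far (verts∈ (walk C) p) , verts-active (walk C) p)))

    -- If the part of the ball of radius 3 beyond distance 2 lies on the cycle, the size of the ball
    -- bounds the length of the cycle from below; together with an upper bound this fixes an even
    -- length.
    farOff : ∀ {S} (C : OddCycle S) → length (sub 2 r r) ≤ 10 → Active r → ∀ {k} → k ≤ length (sub 3 r r) →
      (∃ λ z → Far r z × Active z × z ∉ cyc C) ⊎ k ≤ len C + 10
    farOff C ball act {k} k≤ with Any.any? (λ z → ¬? (z ∈? (cyc C ++ sub 2 r r))) (sub 3 r r)
    ... | yes some with z , z∈ , z∉ ← find some | near∈sub2 z
    ...   | inj₁ p = contradiction (∈-++⁺ʳ (cyc C) p) z∉
    ...   | inj₂ fz = inj₁ (z , fz , sub-active 3 act z∈ , z∉ ∘ ∈-++⁺ˡ)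
    farOff C ball act {k} k≤ | no none = inj₂ (≤-trans k≤ (≤-trans (unique⊆⇒length≤ (sub-unique nc 3 ≤-refl) inside)
        (≤-trans (≤-reflexive (length-++ (cyc C))) (+-mono-≤ (≤-reflexive (length-verts (walk C))) ball))))
      where
      inside : ∀ {z} → z ∈ sub 3 r r → z ∈ cyc C ++ sub 2 r r
      inside {z} z∈ with z ∈? (cyc C ++ sub 2 r r)
      ... | yes p = p
      ... | no p = contradiction (lose z∈ p) none

  module Specials (p p′ : Fin n) (apart : Apart p p′) (b : Bound 22) (2≤p : 2 ≤ deg p) (2≤p′ : 2 ≤ deg p′)
    (deg≥3 : ∀ {x} → Active x → x ≢ p → x ≢ p′ → 3 ≤ deg x)
    (inseparable : ∀ c → ProperColouring G 3 c → c p ≢ c p′ → ⊥) where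

    p≢p′ : p ≢ p′
    p≢p′ refl = apart z≤n (nil tt)

    p≁p′ : ¬ p ∼ p′
    p≁p′ e = apart (s≤s z≤n) (path1 e)

    deg≥2 : ∀ {x} → Active x → 2 ≤ deg x
    deg≥2 {x} act with x ≟ p | x ≟ p′
    ... | yes refl | _ = 2≤p
    ... | no _ | yes refl = 2≤p′
    ... | no q | no q′ = ≤-trans (n≤1+n 2) (deg≥3 act q q′)

    Plain : Fin n → Set
    Plain x = x ≢ p × x ≢ p′

    plain? : ∀ x → Dec (Plain x)
    plain? x = ¬? (x ≟ p) ×-dec ¬? (x ≟ p′)

    sub1≥3 : ∀ {a q} → a ∼ q → Plain q → 3 ≤ length (sub 1 a q)
    sub1≥3 e (x , y) = ≤-trans (deg≥3 (active-∼ e) x y) (deg≤sub1 _ _)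

    sub1≥2 : ∀ {a q} → a ∼ q → 2 ≤ length (sub 1 a q)
    sub1≥2 e = ≤-trans (deg≥2 (active-∼ e)) (deg≤sub1 _ _)

    sub2≥7 : ∀ {z a} → z ∼ a → Plain a → (∀ {q} → q ∈ kids z a → Plain q) → 7 ≤ length (sub 2 z a)
    sub2≥7 za (x , y) h = sub-suc≥ 1 _ _ (3≤deg⇒2≤kids _ (deg≥3 (active-∼ za) x y)) λ q∈ → sub1≥3 (proj₁ (∈kids⁻ q∈)) (h q∈)

    -- With all degrees at least 3 and a fourth branch, the ball of radius 3 would have 1 + 4 * 7 =
    -- 29 vertices. Each of `p` and `p′` affects at most one branch, at a cost of at most 3, which
    -- still leaves 23.
    deg≤3 : ∀ z → deg z ≤ 3
    deg≤3 z with deg z ≤? 3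
    ... | yes le = le
    ... | no ¬le = ⊥-elim (≤-absurd (≤-trans ball (b (sub 3 z z) (sub-unique nc 3 ≤-refl) (sub-active 3 act))))
      where
      4≤ : 4 ≤ deg z
      4≤ = ≰⇒> ¬le
      act : Active z
      act with a , _ , e , _ ← twoNbrs (≤-trans (m≤n+m 2 2) 4≤) = a , e
      branch? : ∀ s a → Dec (s ∈ sub 1 z a)
      branch? s a = s ∈? sub 1 z a
      branch : Fin n → List (Fin n)
      branch s = filter (branch? s) (kids z z)
      branch≤1 : ∀ s → length (branch s) ≤ 1
      branch≤1 s = atMostOne (branch s) (filter⁺ (branch? s) (kids-unique z z)) same
        where
        atMostOne : ∀ xs → Unique xs → (∀ {x y} → x ∈ xs → y ∈ xs → x ≡ y) → length xs ≤ 1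
        atMostOne [] _ _ = z≤n
        atMostOne (_ ∷ []) _ _ = ≤-refl
        atMostOne (_ ∷ _ ∷ _) ((ne ∷ _) ∷ _) h = contradiction (h (here refl) (there (here refl))) ne
        same : ∀ {x y} → x ∈ branch s → y ∈ branch s → x ≡ y
        same {x} {y} x∈ y∈ with x ≟ y
        ... | yes eq = eq
        ... | no ne with x∈k , s∈x ← ∈-filter⁻ (branch? s) {xs = kids z z} x∈ | y∈k , s∈y ← ∈-filter⁻ (branch? s) {xs = kids z z} y∈
          with j , j≤ , w ← ∈sub⁻ 1 s∈x | k , k≤ , w′ ← ∈sub⁻ 1 s∈y =
          ⊥-elim (meet nc (proj₁ (∈kids⁻ x∈k)) w (step (proj₁ (∈kids⁻ y∈k)) (ne ∘ ≡.sym) w′)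
            (≤-trans (s≤s (s≤s (+-mono-≤ j≤ (s≤s k≤)))) (m≤n+m 5 2)))
      es : List (Fin n)
      es = branch p ++ branch p′
      es≤2 : length es ≤ 2
      es≤2 = ≤-trans (≤-reflexive (length-++ (branch p))) (+-mono-≤ (branch≤1 p) (branch≤1 p′))
      usual : ∀ {a} → a ∈ kids z z → a ∈ es ⊎ 7 ≤ length (sub 2 z a)
      usual {a} a∈ with branch? p a | branch? p′ a
      ... | yes q | _ = inj₁ (∈-++⁺ˡ (∈-filter⁺ (branch? p) a∈ q))
      ... | no _ | yes q = inj₁ (∈-++⁺ʳ (branch p) (∈-filter⁺ (branch? p′) a∈ q))
      ... | no q | no q′ = inj₂ (sub2≥7 (proj₁ (∈kids⁻ a∈)) ((λ { refl → q (here refl) }) , λ { refl → q′ (here refl) })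
        λ k∈ → (λ { refl → q (∈sub⁺ {d = 1} {k = 1} ≤-refl (nb k∈)) }) , λ { refl → q′ (∈sub⁺ {d = 1} {k = 1} ≤-refl (nb k∈)) })
        where
        nb : ∀ {x} → x ∈ kids z a → NB z a x 1
        nb x∈ = let e , ne = ∈kids⁻ x∈ in step e ne stop
      -- The worst branch has a special vertex of degree 2 at its root and counts 1 + 3.
      always : ∀ {a} → a ∈ kids z z → 7 ≤ length (sub 2 z a) + 3
      always {a} a∈ with plain? a
      ... | yes (x , y) = ≤-trans (n≤1+n 7) (+-monoˡ-≤ 3 (sub-suc≥ 1 {2} {2} z a (3≤deg⇒2≤kids z (deg≥3 (active-∼ (proj₁ (∈kids⁻ a∈))) x y))
              λ q∈ → sub1≥2 (proj₁ (∈kids⁻ q∈))))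
      ... | no special = +-monoˡ-≤ 3 (sub-suc≥ 1 {3} {1} z a (s≤s⁻¹ (≤-trans (deg≥2 (active-∼ (proj₁ (∈kids⁻ a∈)))) (deg≤1+kids z a)))
              λ q∈ → let e = proj₁ (∈kids⁻ q∈) in sub1≥3 e ((λ { refl → lonely e }) , λ { refl → lonely′ e }))
        where
        lonely : ¬ a ∼ p
        lonely e = special (∼⇒≢ e , λ { refl → p≁p′ (∼-sym e) })
        lonely′ : ¬ a ∼ p′
        lonely′ e = special ((λ { refl → p≁p′ e }) , ∼⇒≢ e)
      ball : 23 ≤ length (sub 3 z z)
      ball = s≤s (ℕₚ.+-cancelʳ-≤ 6 22 _ (≤-trans (ℕₚ.*-monoˡ-≤ 7 (≤-trans 4≤ (deg≤kids z)))
        (≤-trans (length-concatMap-≥ (sub 2 z) {s = 3} (kids z z) es (kids-unique z z) usual always)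
          (+-monoʳ-≤ _ (ℕₚ.*-monoˡ-≤ 3 es≤2)))))

    sub1≤3 : ∀ {a q} → a ∼ q → length (sub 1 a q) ≤ 3
    sub1≤3 {a} {q} e = ≤-trans (≤-reflexive (length-sub1 a q)) (≤-trans (1+kids≤deg (∼-sym e)) (deg≤3 q))

    ball≤10 : ∀ r → length (sub 2 r r) ≤ 10
    ball≤10 r = s≤s (≤-trans (length-concatMap-≤ (sub 1 r) (kids r r) (λ a∈ → sub1≤3 (proj₁ (∈kids⁻ a∈))))
      (ℕₚ.*-monoˡ-≤ 3 (≤-trans (kids≤deg r) (deg≤3 r))))

    ball≥10 : ∀ {r} → 3 ≤ deg r → (∀ {a} → r ∼ a → 3 ≤ deg a) → 10 ≤ length (sub 2 r r)
    ball≥10 {r} 3≤ h = sub-suc≥ 1 r r (≤-trans 3≤ (deg≤kids r)) λ a∈ → ≤-trans (h (proj₁ (∈kids⁻ a∈))) (deg≤sub1 _ _)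

    -- The root is a neighbour of p.
    deg-p≤2 : deg p ≤ 2
    deg-p≤2 with deg p ≤? 2
    ... | yes le = le
    ... | no ¬le with x , _ , px , _ ← twoNbrs 2≤p = ⊥-elim (fromRoot px)
      where
      3≤p : 3 ≤ deg p
      3≤p = ≰⇒> ¬le
      fromRoot : ∀ {x} → p ∼ x → ⊥
      fromRoot {x} px = bipartite⊎oddCycle {S = Far x}
          (λ g pr → let open RootColourings (farBipartite⇒colourings G nc6 x (kids x p) g pr)
                        d , ne = separates (∼-sym px) ∈kids⁺ (λ e → apart (s≤s (s≤s z≤n)) (path2 px e))
                    in inseparable (colouring d) (proper d) ne) contra
        where
        x-plain : Plain x
        x-plain = (∼⇒≢ (∼-sym px)) , λ { refl → p≁p′ px }
        xact : Active x
        xact = _ , ∼-sym px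
        deg-x : 3 ≤ deg x
        deg-x = deg≥3 xact (proj₁ x-plain) (proj₂ x-plain)
        3≤nbr : ∀ {a} → x ∼ a → 3 ≤ deg a
        3≤nbr {a} xa with a ≟ p
        ... | yes refl = 3≤p
        ... | no a≢p = deg≥3 (active-∼ xa) a≢p λ { refl → apart (s≤s (s≤s z≤n)) (path2 px xa) }
        ball : 10 ≤ length (sub 2 x x)
        ball = ball≥10 deg-x 3≤nbr
        ball3 : 22 ≤ length (sub 3 x x)
        ball3 = sub-suc≥ 2 {7} {3} x x (≤-trans deg-x (deg≤kids x)) λ {a} a∈ → let xa = proj₁ (∈kids⁻ a∈) in
          sub-suc≥ 1 {3} {2} x a (3≤deg⇒2≤kids x (3≤nbr xa)) λ q∈ → let aq , q≢x = ∈kids⁻ q∈ in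
            sub1≥3 aq ((λ { refl → no3 px xa aq }) , λ { refl → apart ≤-refl (path3 px xa aq) })
        -- The ball of radius 3 accounts for all 22 vertices, so every far vertex has a neighbour at
        -- distance 2 from `x`.
        inBall : ∀ {z} → Active z → z ∈ sub 3 x x
        inBall {z} act with z ∈? sub 3 x x
        ... | yes q = q
        ... | no q = ⊥-elim (≤-absurd (≤-trans (s≤s ball3) (b (z ∷ sub 3 x x) (unique-∷ q (sub-unique nc 3 ≤-refl))
          λ { (here refl) → act ; (there r) → sub-active 3 xact r })))
        far≢p : ∀ {z} → Far x z → z ≢ p
        far≢p (_ , x≁z , _) refl = x≁z (∼-sym px)
        contra : OddCycle (Far x) → ⊥
        contra C with farOff x C (ball≤10 x) xact ball3
        -- If no far vertex lies off the cycle, its length is 22 - 10 = 12.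
        ... | inj₂ le = even12 (len C) refl le (cycle≤12 x C id b xact ball) (isOdd C)
          where
          even12 : ∀ k → len C ≡ k → 22 ≤ k + 10 → k ≤ 12 → odd k ≡ true → ⊥
          even12 k _ le le′ o with refl ← ℕₚ.≤-antisym le′ (ℕₚ.+-cancelʳ-≤ 10 12 k le) = contradiction o λ ()
        ... | inj₁ (z₀ , fz₀ , act₀ , z₀∉) = tooManyFar x C id b xact ball walk6
          where
          Z : Fin n → Set
          Z z = Far x z × z ∉ cyc C
          off : ∀ {z w} → Z z → z ∼ w → w ∉ cyc C
          off (fz , z∉) zw w∈ = z∉ (noExit x C id w∈ (deg≤3 _) (far∈sub3 x (verts∈ (walk C) w∈) (inBall (verts-active (walk C) w∈))) (∼-sym zw) fz)
          go-on : ∀ {z} prev → Z z → Active z → z ≢ p′ → ∃ λ w → z ∼ w × w ≢ prev × Z w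
          go-on prev zz@(fz , _) act z≢p′ with w , zw , w≢ , fw ← nextFar x prev fz (deg≥3 act (far≢p fz) z≢p′) =
            w , zw , w≢ , fw , off zz zw
          walk6 : ∃ λ zs → length zs ≡ 6 × Unique zs × (∀ {z} → z ∈ zs → Z z × Active z)
          walk6 with near∈sub2 x p′ | p′ ∈? cyc C
          -- The vertex `p′` may have degree 2, so a walk among the far vertices can start there but
          -- might be unable to pass through it.
          ... | inj₂ fp′ | no p′∉ = longWalk (fp′ , p′∉) first′ λ prev zz z≢ e → go-on prev zz (_ , e) z≢
            where
            first′ : ∃ λ w → p′ ∼ w × Z w
            first′ with q , p′q , sq ← far∈sub3 x fp′ (inBall (let w , e , _ = avoid1 2≤p′ p′ in w , e))
              with w , e , w≢q ← avoid1 2≤p′ q with farNbr x fp′ e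
            ... | inj₁ sw = contradiction (secondNbr-unique x fp′ e sw p′q sq) w≢q
            ... | inj₂ fw = w , e , fw , off (fp′ , p′∉) e
          ... | inj₂ _ | yes p′∈ = longWalk (fz₀ , z₀∉) (let w , e , _ , zw = go-on z₀ (fz₀ , z₀∉) act₀ (λ { refl → z₀∉ p′∈ }) in w , e , zw)
                λ prev zz z≢ e → go-on prev zz (_ , e) λ { refl → proj₂ zz p′∈ }
          ... | inj₁ near | _ = longWalk (fz₀ , z₀∉) (let w , e , _ , zw = go-on z₀ (fz₀ , z₀∉) act₀ (λ { refl → far∉sub x fz₀ near }) in w , e , zw)
                λ prev zz z≢ e → go-on prev zz (_ , e) λ { refl → far∉sub x (proj₁ zz) near }

    -- The root is the middle m of a path from p to p′. The vertices o at distance at least 4 from m may be coloured 0,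
    -- and p, which has a single neighbour beyond x, may be recoloured.
    module Middle {x m x′ : Fin n} (p≤2 : deg p ≤ 2) (p′≤2 : deg p′ ≤ 2)
      (px : p ∼ x) (xm : x ∼ m) (mx′ : m ∼ x′) (x′p′ : x′ ∼ p′) where

      m≢p : m ≢ p
      m≢p refl = apart (s≤s (s≤s z≤n)) (path2 mx′ x′p′)

      m≢p′ : m ≢ p′
      m≢p′ refl = apart (s≤s (s≤s z≤n)) (path2 px xm)

      x≢x′ : x ≢ x′
      x≢x′ refl = apart (s≤s (s≤s z≤n)) (path2 px x′p′)

      mact : Active m
      mact = _ , mx′

      m-nbr : ∀ {a} → m ∼ a → Plain a
      m-nbr ma = (λ { refl → apart ≤-refl (path3 (∼-sym ma) mx′ x′p′) }) , λ { refl → apart ≤-refl (path3 px xm ma) }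

      3≤nbr : ∀ {a} → m ∼ a → 3 ≤ deg a
      3≤nbr ma = deg≥3 (active-∼ ma) (proj₁ (m-nbr ma)) (proj₂ (m-nbr ma))

      3≤m : 3 ≤ deg m
      3≤m = deg≥3 mact m≢p m≢p′

      ball : 10 ≤ length (sub 2 m m)
      ball = ball≥10 3≤m 3≤nbr

      -- The full count is 1 + 3 * 7; the branches of `x` and `x′` contain `p` and `p′` and may each
      -- be short by 1.
      ball3 : 20 ≤ length (sub 3 m m)
      ball3 = s≤s (ℕₚ.+-cancelʳ-≤ 2 19 _ (≤-trans (ℕₚ.*-monoˡ-≤ 7 (≤-trans 3≤m (deg≤kids m)))
        (length-concatMap-≥ (sub 2 m) {s = 1} (kids m m) (x ∷ x′ ∷ []) (kids-unique m m) usual always)))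
        where
        usual : ∀ {a} → a ∈ kids m m → a ∈ x ∷ x′ ∷ [] ⊎ 7 ≤ length (sub 2 m a)
        usual {a} a∈ with a ≟ x | a ≟ x′
        ... | yes q | _ = inj₁ (here q)
        ... | no _ | yes q = inj₁ (there (here q))
        ... | no q | no q′ = inj₂ (sub2≥7 ma (m-nbr ma) λ k∈ → let ak = proj₁ (∈kids⁻ k∈) in
              (λ { refl → no4 ma ak px xm m≢p q }) , λ { refl → no4 ma ak (∼-sym x′p′) (∼-sym mx′) m≢p′ q′ })
          where
          ma : m ∼ a
          ma = proj₁ (∈kids⁻ a∈)
        always : ∀ {a} → a ∈ kids m m → 7 ≤ length (sub 2 m a) + 1
        always {a} a∈ = s≤s (oneSpecial (a ∼? p))
          where
          ma : m ∼ a
          ma = proj₁ (∈kids⁻ a∈)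
          from : ∀ s → (∀ {q} → q ∈ kids m a → q ≢ s → Plain q) → 6 ≤ length (concatMap (sub 1 a) (kids m a)) + 1
          from s h = ≤-trans (ℕₚ.*-monoˡ-≤ 3 (3≤deg⇒2≤kids m (3≤nbr ma)))
            (length-concatMap-≥ (sub 1 a) {s = 1} (kids m a) (s ∷ []) (kids-unique m a)
              (λ {q} q∈ → case q ≟ s of λ { (yes e) → inj₁ (here e) ; (no ne) → inj₂ (sub1≥3 (proj₁ (∈kids⁻ q∈)) (h q∈ ne)) })
              (λ q∈ → +-monoˡ-≤ 1 (sub1≥2 (proj₁ (∈kids⁻ q∈)))))
          oneSpecial : Dec (a ∼ p) → 6 ≤ length (concatMap (sub 1 a) (kids m a)) + 1
          oneSpecial (yes ap) = from p λ q∈ ne → ne , λ { refl → apart (s≤s (s≤s z≤n)) (path2 (∼-sym ap) (proj₁ (∈kids⁻ q∈))) }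
          oneSpecial (no a≁p) = from p′ λ q∈ ne → (λ { refl → a≁p (proj₁ (∈kids⁻ q∈)) }) , ne

      second-p : Second m p
      second-p = m≢p ∘ ≡.sym , x , ∼-sym xm , ∼-sym px

      second-p′ : Second m p′
      second-p′ = m≢p′ ∘ ≡.sym , x′ , mx′ , x′p′

      far-deg : ∀ {z} → Far m z → Active z → 3 ≤ deg z
      far-deg fz act = deg≥3 act (λ { refl → second∉far m second-p fz }) λ { refl → second∉far m second-p′ fz }

      -- The recoloured set `Q` is `p` alone, whose only far neighbour is `k`; `p` leaves colour 0
      -- while `p′` keeps it, so a 2-colouring of the far part outside `J` would separate them.
      nonbip : ∀ {J : Fin n → Set} → Decidable J → (∀ {y z} → J y → J z → y ≡ z) → (∀ {z} → J z → ¬ SecondNbr m z) →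
        (g : Fin n → Bool) → ¬ (∀ {y z} → (Far m y × ¬ J y) → (Far m z × ¬ J z) → y ∼ z → g y ≢ g z)
      nonbip {J} J? J-single J-deep g pr with k , pk , k≢x ← avoid1 2≤p x =
        inseparable (rootColouring true) (rootColouring-proper
            (λ Jy Jz e → ∼⇒≢ e (J-single Jy Jz))
            (λ fy fz ¬y ¬z → pr (fy , ¬y) (fz , ¬z))
            (λ {q} sq _ Jz qz → contradiction (q , ∼-sym qz , sq) (J-deep Jz))
            (λ { _ refl fz _ e → cong g (onlyK fz e) })
            (λ { _ _ _ _ _ refl refl → refl }) true)
          λ eq → rootColouring-Q true second-p refl (trans eq (rootColouring-second true second-p′ (p≢p′ ∘ ≡.sym)))
        where
        open RootColouring nc6 m {J = J} {Q = _≡ p} J? (_≟ p) g (λ _ → g k)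
        onlyK : ∀ {z} → Far m z → p ∼ z → z ≡ k
        onlyK {z} (_ , m≁z , _) pz with z ≟ k
        ... | yes e = e
        ... | no ne = ⊥-elim (≤-absurd (≤-trans (unique⊆⇒length≤ {xs = x ∷ z ∷ k ∷ []}
            (((λ { refl → m≁z (∼-sym xm) }) ∷ k≢x ∘ ≡.sym ∷ []) ∷ (ne ∷ []) ∷ [] ∷ [])
            λ { (here refl) → ∈nbrs⁺ px ; (there (here refl)) → ∈nbrs⁺ pz ; (there (there (here refl))) → ∈nbrs⁺ pk }) p≤2))

      -- Now `p` and `p′` have degree at most 2, so at most 1 + 6 + 6 + 7 = 20 vertices lie within
      -- distance 3 of `m`. A cycle filling the far part has length 10, which is even; otherwise
      -- `noExit` keeps a long walk off the cycle.
      noDeep : (∀ {z} → Far m z → Active z → SecondNbr m z) → ⊥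
      noDeep shallow = bipartite⊎oddCycle (nonbip {J = λ _ → ⊥} (λ _ → no λ ()) (λ ()) (λ ())) contra
        where
        branch : ∀ {a s} → m ∼ a → a ∼ s → s ≢ m → deg s ≤ 2 → length (sub 2 m a) ≤ 6
        branch {a} {s} ma as s≢m le = ≤-trans
          (length-concatMap-≤-∋ (sub 1 a) {s = 1} (kids m a) (∈kids⁺ as s≢m) (λ q∈ → sub1≤3 (proj₁ (∈kids⁻ q∈)))
            (s≤s (≤-trans (≤-reflexive (length-sub1 a s)) (≤-trans (1+kids≤deg (∼-sym as)) le))))
          (ℕₚ.*-monoˡ-≤ 3 (s≤s⁻¹ (≤-trans (1+kids≤deg (∼-sym ma)) (deg≤3 a))))
        cycle≤10 : (C : OddCycle (λ z → Far m z × ¬ ⊥)) → len C + 10 ≤ 20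
        cycle≤10 C with a , ma , a≢x , a≢x′ ← avoid2 3≤m x x′ = begin
            len C + 10                                   ≤⟨ +-mono-≤ (≤-reflexive (≡.sym (length-verts (walk C)))) ball ⟩
            length (cyc C) + length (sub 2 m m)          ≡⟨ ≡.sym (length-++ (cyc C)) ⟩
            length (cyc C ++ sub 2 m m)                  ≤⟨ unique⊆⇒length≤ (unique-++ (cyc-unique C) (sub-unique nc6 2 (s≤s (s≤s (s≤s (s≤s (s≤s z≤n))))))
                                                              (λ q → far∉sub m (proj₁ (verts∈ (walk C) q)))) inside ⟩
            length (m ∷ sub 2 m x ++ sub 2 m x′ ++ sub 2 m a)  ≡⟨ cong suc (trans (length-++ (sub 2 m x)) (cong (length (sub 2 m x) +_) (length-++ (sub 2 m x′)))) ⟩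
            suc (length (sub 2 m x) + (length (sub 2 m x′) + length (sub 2 m a)))
              ≤⟨ s≤s (+-mono-≤ (branch (∼-sym xm) (∼-sym px) (m≢p ∘ ≡.sym) p≤2) (+-mono-≤ (branch mx′ x′p′ (m≢p′ ∘ ≡.sym) p′≤2)
                   (s≤s (≤-trans (length-concatMap-≤ (sub 1 a) (kids m a) (λ q∈ → sub1≤3 (proj₁ (∈kids⁻ q∈))))
                     (ℕₚ.*-monoˡ-≤ 3 (s≤s⁻¹ (≤-trans (1+kids≤deg (∼-sym ma)) (deg≤3 a)))))))) ⟩
            20 ∎
          where
          open ℕₚ.≤-Reasoning hiding (stop)
          spread : ∀ {z} k → k ≤ 3 → NB m m z k → z ∈ m ∷ sub 2 m x ++ sub 2 m x′ ++ sub 2 m a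
          spread 0 _ stop = here refl
          spread (suc k) (s≤s le) (step e _ w) with onlyThree (deg≤3 m) (∼-sym xm) mx′ ma x≢x′ (a≢x ∘ ≡.sym) (a≢x′ ∘ ≡.sym) e
          ... | here refl = there (∈-++⁺ˡ (∈sub⁺ le w))
          ... | there (here refl) = there (∈-++⁺ʳ (sub 2 m x) (∈-++⁺ˡ (∈sub⁺ le w)))
          ... | there (there (here refl)) = there (∈-++⁺ʳ (sub 2 m x) (∈-++⁺ʳ (sub 2 m x′) (∈sub⁺ le w)))
          inside : ∀ {z} → z ∈ cyc C ++ sub 2 m m → z ∈ m ∷ sub 2 m x ++ sub 2 m x′ ++ sub 2 m a
          inside z∈ with ∈-++⁻ (cyc C) z∈
          ... | inj₂ q = let k , le , w = ∈sub⁻ 2 q in spread k (≤-trans le (n≤1+n 2)) w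
          ... | inj₁ q with fz@(_ , m≁z , _) , _ ← verts∈ (walk C) q
            with s , zs , s≢m , c , mc , cs ← shallow fz (verts-active (walk C) q) =
            spread 3 ≤-refl (step mc (∼⇒≢ (∼-sym mc)) (step cs s≢m (step (∼-sym zs) (λ { refl → m≁z mc }) stop)))
        contra : OddCycle (λ z → Far m z × ¬ ⊥) → ⊥
        contra C with farOff m C (ball≤10 m) mact ball3
        ... | inj₂ le = even10 (len C) le (cycle≤10 C) (isOdd C)
          where
          even10 : ∀ k → 20 ≤ k + 10 → k + 10 ≤ 20 → odd k ≡ true → ⊥
          even10 k le le′ o with refl ← ℕₚ.≤-antisym (ℕₚ.+-cancelʳ-≤ 10 k 10 le′) (ℕₚ.+-cancelʳ-≤ 10 10 k le) = contradiction o λ ()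
        ... | inj₁ (z₀ , fz₀ , act₀ , z₀∉) = tooManyFar m C proj₁ b mact ball
            (longWalk (fz₀ , z₀∉) (let w , e , _ , zw = go-on z₀ (fz₀ , z₀∉) act₀ in w , e , zw) λ prev zz _ e → go-on prev zz (_ , e))
          where
          go-on : ∀ {z} prev → Far m z × z ∉ cyc C → Active z → ∃ λ w → z ∼ w × w ≢ prev × Far m w × w ∉ cyc C
          go-on prev (fz , z∉) act with w , zw , w≢ , fw ← nextFar m prev fz (far-deg fz act) =
            w , zw , w≢ , fw , λ w∈ → z∉ (noExit m C proj₁ w∈ (deg≤3 w) (shallow fw (_ , ∼-sym zw)) (∼-sym zw) fz)

      -- At most 22 - 20 = 2 vertices are at distance at least 4 from `m`, so the cycle, which
      -- avoids `o`, contains at most one such vertex `w₀`. The edge from `w₀` to its third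
      -- neighbour `r` is then the only one joining the cycle to the other far vertices, and a long
      -- walk from `r` away from `w₀` never returns.
      oneDeep : ∀ {o} → Far m o → Active o → ¬ SecondNbr m o → ⊥
      oneDeep {o} fo ao deep-o = bipartite⊎oddCycle (nonbip {J = _≡ o} (_≟ o) (λ { refl refl → refl }) (λ { refl → deep-o })) contra
        where
        two-deep : ∀ {y z} → Far m y → Far m z → Active y → Active z → ¬ SecondNbr m y → ¬ SecondNbr m z → o ≢ y → o ≢ z → y ≡ z
        two-deep {y} {z} fy fz ay az dy dz o≢y o≢z with y ≟ z
        ... | yes e = e
        ... | no y≢z = ⊥-elim (≤-absurd (≤-trans (s≤s (s≤s (s≤s ball3))) (b (o ∷ y ∷ z ∷ sub 3 m m)
            (unique-∷ (λ { (here e) → o≢y e ; (there (here e)) → o≢z e ; (there (there q)) → deep-o (far∈sub3 m fo q) })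
            (unique-∷ (λ { (here e) → y≢z e ; (there q) → dy (far∈sub3 m fy q) })
            (unique-∷ (λ q → dz (far∈sub3 m fz q)) (sub-unique nc 3 ≤-refl))))
            λ { (here refl) → ao ; (there (here refl)) → ay ; (there (there (here refl))) → az ; (there (there (there q))) → sub-active 3 mact q })))
        contra : OddCycle (λ z → Far m z × z ≢ o) → ⊥
        contra C with Any.any? (¬? ∘ secondNbr? m) (cyc C)
        ... | no none = tooManyFar m C proj₁ b mact ball
            (longWalk (fo , o∉) (let w , e , _ , zw = go-on o (fo , o∉) ao in w , e , zw) λ prev zz _ e → go-on prev zz (_ , e))
          where
          o∉ : o ∉ cyc C
          o∉ o∈ = proj₂ (verts∈ (walk C) o∈) refl
          shallow : ∀ {w} → w ∈ cyc C → SecondNbr m w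
          shallow {w} w∈ with secondNbr? m w
          ... | yes q = q
          ... | no q = contradiction (lose w∈ q) none
          go-on : ∀ {z} prev → Far m z × z ∉ cyc C → Active z → ∃ λ w → z ∼ w × w ≢ prev × Far m w × w ∉ cyc C
          go-on prev (fz , z∉) act with w , zw , w≢ , fw ← nextFar m prev fz (far-deg fz act) =
            w , zw , w≢ , fw , λ w∈ → z∉ (noExit m C proj₁ w∈ (deg≤3 w) (shallow w∈) (∼-sym zw) fz)
        ... | yes some with w₀ , w₀∈ , deep₀ ← find some = fromExit (nbrsOnCycle C w₀∈)
          where
          fw₀ : Far m w₀
          fw₀ = proj₁ (verts∈ (walk C) w₀∈)
          aw₀ : Active w₀
          aw₀ = verts-active (walk C) w₀∈
          Z : Fin n → Set
          Z z = Far m z × z ∉ cyc C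
          fromExit : CycleNbrs C w₀ → ⊥
          fromExit (cycleNbrs {s} {t} s∈ t∈ s≢t ws wt only) with r , w₀r , r≢s , r≢t ← avoid2 (far-deg fw₀ aw₀) s t =
            tooManyFar m C proj₁ b mact ball (longWalk zr first′ λ prev zz z≢r e → go-on prev zz (_ , e) λ w∈ zw → ⊥-elim (z≢r (proj₁ (exit zz w∈ zw))))
            where
            zr : Z r
            zr with farNbr m fw₀ w₀r
            ... | inj₁ sr = contradiction (r , w₀r , sr) deep₀
            ... | inj₂ fr = fr , λ r∈ → case only r∈ w₀r of λ { (inj₁ e) → r≢s e ; (inj₂ e) → r≢t e }
            exit : ∀ {z w} → Z z → w ∈ cyc C → z ∼ w → z ≡ r × w ≡ w₀
            exit {z} {w} (fz , z∉) w∈ zw with secondNbr? m w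
            ... | yes q = contradiction (noExit m C proj₁ w∈ (deg≤3 w) q (∼-sym zw) fz) z∉
            ... | no q with refl ← two-deep fw₀ (proj₁ (verts∈ (walk C) w∈)) aw₀ (verts-active (walk C) w∈) deep₀ q
                    (λ { refl → proj₂ (verts∈ (walk C) w₀∈) refl }) (λ { refl → proj₂ (verts∈ (walk C) w∈) refl })
              with onlyThree (deg≤3 w) ws wt w₀r s≢t (r≢s ∘ ≡.sym) (r≢t ∘ ≡.sym) (∼-sym zw)
            ...   | here refl = contradiction s∈ z∉
            ...   | there (here refl) = contradiction t∈ z∉
            ...   | there (there (here refl)) = refl , refl
            go-on : ∀ {z} prev → Z z → Active z → (∀ {w} → w ∈ cyc C → z ∼ w → w ≡ prev) → ∃ λ w → z ∼ w × w ≢ prev × Z w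
            go-on prev (fz , z∉) act h with w , zw , w≢ , fw ← nextFar m prev fz (far-deg fz act) =
              w , zw , w≢ , fw , λ w∈ → w≢ (h w∈ zw)
            first′ : ∃ λ w → r ∼ w × Z w
            first′ = let w , e , _ , zw = go-on w₀ zr (_ , ∼-sym w₀r) (λ w∈ e → proj₂ (exit zr w∈ e)) in w , e , zw

      impossible : ⊥
      impossible with any? (λ o → RootLemma.far? G nc6 m [] o ×-dec (any? (o ∼?_) ×-dec ¬? (secondNbr? m o)))
      ... | yes (o , fo , ao , deep) = oneDeep fo ao deep
      ... | no none = noDeep λ {z} fz az → case secondNbr? m z of λ where
          (yes q) → q
          (no q) → contradiction (z , fz , az , q) none

    middleRoot : deg p ≤ 2 → deg p′ ≤ 2 → Path p p′ 4 → ⊥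
    middleRoot p≤2 p′≤2 (cons _ px (cons _ xm (cons _ mx′ (cons _ x′p′ (nil _))))) = Middle.impossible p≤2 p′≤2 px xm mx′ x′p′

-- Adding an edge between vertices at distance at least 5

⊑-path : ∀ {n} {G H : Graph n} {u v k} → G ⊑ H → OddCycles.Walk G (λ _ → ⊤) u v k → OddCycles.Walk H (λ _ → ⊤) u v k
⊑-path G⊑H (OddCycles.nil _) = OddCycles.nil tt
⊑-path {G = G} {H} G⊑H (OddCycles.cons _ e w) = OddCycles.cons tt (G⊑H e) (⊑-path {G = G} {H} G⊑H w)

module Link7 {n : ℕ} (y y′ : Fin n) (F : Graph n) where

  private
    G : Graph n
    G = unlink y y′ F
    module F = Neighbourhoods F
    module G = Neighbourhoods G

  open OddCycles G using (Walk; nil; cons; append; reverse)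

  Linked : Fin n → Fin n → Set
  Linked a b = (a ≡ y × b ≡ y′) ⊎ (a ≡ y′ × b ≡ y)

  linked? : ∀ {a b} → Adj F a b → Adj G a b ⊎ Linked a b
  linked? {a} {b} e with (a ≟ y) ×-dec (b ≟ y′) | (a ≟ y′) ×-dec (b ≟ y)
  ... | yes p | _ = inj₂ (inj₁ p)
  ... | no _ | yes q = inj₂ (inj₂ q)
  ... | no p | no q = inj₁ (e , p , q)

  record Cut (p a x : Fin n) (k : ℕ) : Set where
    constructor cutting
    field
      {i j}  : ℕ
      {s t}  : Fin n
      link-st : Linked s t
      before : G.NB p a s i
      after  : F.NB s t x j
      nb     : i ≡ 0 → t ≢ p
      length≡ : i + suc j ≡ k

  cut : ∀ {p a x k} → F.NB p a x k → G.NB p a x k ⊎ Cut p a x k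
  cut F.stop = inj₁ G.stop
  cut (F.step e ne w) with linked? e
  ... | inj₂ l = inj₂ (cutting l G.stop w (λ _ → ne) refl)
  ... | inj₁ e′ with cut w
  ...   | inj₁ w′ = inj₁ (G.step e′ ne w′)
  ...   | inj₂ (cutting l v w′ _ eq) = inj₂ (cutting l (G.step e′ ne v) w′ (λ ()) (cong suc eq))

  toPath : ∀ {p a x k} → G.NB p a x k → Walk (λ _ → ⊤) a x k
  toPath G.stop = nil tt
  toPath (G.step e _ w) = cons tt e (toPath w)

  -- Cut a short closed walk at its uses of the new edge. A single use, or two successive uses in
  -- the same direction, leaves a path of length at most 4 between the ends; opposite directions
  -- leave a closed walk at one end or an immediate backtrack.
  noClosed-linked : y ≢ y′ → G.NoClosed 6 → (∀ {j} → j ≤ 4 → ¬ Walk (λ _ → ⊤) y y′ j) → F.NoClosed 6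
  noClosed-linked y≢y′ nc far {a} {k} k<5 w with cut w
  ... | inj₁ w′ = nc k<5 w′
  ... | inj₂ (cutting {i} {j} {s} {t} l v w₁ _ eq) = second-part (cut w₁)
    where
    far′ : ∀ {s t j} → Linked s t → j ≤ 4 → ¬ Walk (λ _ → ⊤) t s j
    far′ (inj₁ (refl , refl)) le p = far le (reverse p)
    far′ (inj₂ (refl , refl)) le p = far le p
    i+j≤4 : j + i ≤ 4
    i+j≤4 = s≤s⁻¹ (≤-trans (s≤s (≤-reflexive (+-comm j i))) (≤-trans (≤-reflexive (trans (≡.sym (+-suc i j)) eq)) (s≤s⁻¹ k<5)))
    second-part : G.NB s t a j ⊎ Cut s t a j → ⊥
    second-part (inj₁ w₂) = far′ l i+j≤4 (append (toPath w₂) (toPath v))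
    second-part (inj₂ (cutting {i′} {j′} {s′} l′ v′ _ nb eq′)) = meets l l′ v′ nb
      where
      i′≤4 : i′ ≤ 4
      i′≤4 = ≤-trans (≤-trans (m≤m+n i′ (suc j′)) (≤-trans (≤-reflexive eq′) (m≤m+n j i))) i+j≤4
      returns : ∀ {s t t′ i′} → t′ ≡ s → i′ ≤ 4 → G.NB s t t i′ → (i′ ≡ 0 → t′ ≢ s) → ⊥
      returns eq _ G.stop nb = nb refl eq
      returns eq le w@(G.step _ _ _) nb = G.noReturn nc (s≤s (≤-trans le (n≤1+n 4))) w
      meets : ∀ {s t s′ t′} → Linked s t → Linked s′ t′ → G.NB s t s′ i′ → (i′ ≡ 0 → t′ ≢ s) → ⊥
      meets l@(inj₁ (refl , refl)) (inj₁ (refl , refl)) v′ _ = far′ l i′≤4 (toPath v′)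
      meets l@(inj₂ (refl , refl)) (inj₂ (refl , refl)) v′ _ = far′ l i′≤4 (toPath v′)
      meets (inj₁ (refl , refl)) (inj₂ (refl , refl)) v′ nb = returns refl i′≤4 v′ nb
      meets (inj₂ (refl , refl)) (inj₁ (refl , refl)) v′ nb = returns refl i′≤4 v′ nb

module _ {n : ℕ} (y y′ : Fin n) where

  open Neighbourhoods

  Good7 : Graph n → Set
  Good7 F = NoClosed (unlink y y′ F) 7 × (∀ {j} → j ≤ 3 → ¬ OddCycles.Walk (unlink y y′ F) (λ _ → ⊤) y y′ j) × Bound F 22

  -- As 22 is below 25, the case of girth 6 colours `F` once `F` itself has girth 6. This can fail
  -- only when a path of length 4 joins `y` and `y′`, and such a path is refuted by `middleRoot`
  -- after both ends are shown to have degree at most 2.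
  separation7-core : ∀ F → Good7 F → MinDeg3 F → ¬ ¬ Col F
  separation7-core F (nc , apart , b) md nocol = go (adj? F y y′)
    where
    G : Graph n
    G = unlink y y′ F
    open SubSizes G
    module S = Separation7 G nc
    b25 : Bound F 25
    b25 xs u h = ≤-trans (b xs u h) (m≤n+m 22 3)
    go : Dec (Adj F y y′) → ⊥
    go (no y≁y′) = girth6-colourable F (⊑-noClosed {G = F} {H = G} (nonadjacent-⊑-unlink {F = F} y≁y′) S.nc6) b25 nocol
    go (yes yy′) = girth6-colourable F (Link7.noClosed-linked y y′ F (λ e → Graph.irrefl F e yy′) S.nc6 far4) b25 nocol
      where
      bG : Bound G 22
      bG = ⊑-bound {G = G} {H = F} proj₁ b
      2≤y : 2 ≤ deg G y
      2≤y = s≤s⁻¹ (≤-trans (md (_ , yy′)) (deg-unlink-end {F = F}))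
      2≤y′ : 2 ≤ deg G y′
      2≤y′ = s≤s⁻¹ (≤-trans (md (_ , Graph.sym F yy′)) (deg-unlink-end {F = F}))
      apart′ : S.Apart y′ y
      apart′ le w = apart le (OddCycles.reverse G w)
      deg3 : ∀ {x} → Active G x → x ≢ y → x ≢ y′ → 3 ≤ deg G x
      deg3 (w , e) p q = ≤-trans (md (w , proj₁ e)) (deg-unlink {F = F} p q)
      module Here = S.Specials y y′ apart bG 2≤y 2≤y′ deg3 (λ c p ne → nocol (c , unlink-proper {F = F} p ne))
      module There = S.Specials y′ y apart′ bG 2≤y′ 2≤y (λ a p q → deg3 a q p) (λ c p ne → nocol (c , unlink-proper {F = F} p (ne ∘ ≡.sym)))
      far4 : ∀ {j} → j ≤ 4 → ¬ OddCycles.Walk G (λ _ → ⊤) y y′ j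
      far4 {j} le w with ℕₚ.m≤n⇒m<n∨m≡n le
      ... | inj₁ lt = apart (s≤s⁻¹ lt) w
      ... | inj₂ refl = Here.middleRoot Here.deg-p≤2 There.deg-p≤2 w

  separation7 : ∀ F → Good7 F → ¬ ¬ Col F
  separation7 F good = reduceToCore Good7
    (λ {G} {v} (nc , ap , b) → let le = unlink-mono {y = y} {y′} {F = G ∖ (v ∷ [])} {H = G} proj₁ in
       ⊑-noClosed {G = unlink y y′ (G ∖ (v ∷ []))} {H = unlink y y′ G} le nc ,
       (λ j≤ w → ap j≤ (⊑-path {G = unlink y y′ (G ∖ (v ∷ []))} {H = unlink y y′ G} le w)) ,
       ⊑-bound {G = G ∖ (v ∷ [])} {H = G} proj₁ b)
    separation7-core 22 F (proj₂ (proj₂ good)) good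

-- The case of girth 7

module _ {n : ℕ} (G : Graph n) where

  open Neighbourhoods G
  open OddCycles G
  open SubSizes G
  open LowCycles G

  -- Girth 7 lets the tree at one end go a level deeper, and 22 + 10 exceeds 29.
  noHighEdge7 : NoClosed 7 → MinDeg3 G → Bound 29 → ∀ {u v} → u ∼ v → ¬ Low u → ¬ Low v → ⊥
  noHighEdge7 nc md b {u} {v} uv hu hv = ≤-absurd (≤-trans (+-mono-≤ size3 size2) (≤-trans (≤-reflexive (≡.sym (length-++ (sub 3 v u))))
      (b (sub 3 v u ++ sub 2 u v) (edge-subs-unique nc 3 2 uv ≤-refl (s≤s (s≤s (s≤s (s≤s (s≤s z≤n))))) ≤-refl)
        λ x∈ → [ sub-active 3 (_ , uv) , sub-active 2 (active-∼ uv) ]′ (∈-++⁻ (sub 3 v u) x∈))))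
    where
    kids≥3 : ∀ p {a} → ¬ Low a → 3 ≤ length (kids p a)
    kids≥3 p high = s≤s⁻¹ (≤-trans (≰⇒> high) (deg≤1+kids p _))
    sub1≥3 : ∀ {p a q} → q ∈ kids p a → 3 ≤ length (sub 1 a q)
    sub1≥3 q∈ = ≤-trans (md (active-∼ (proj₁ (∈kids⁻ q∈)))) (deg≤sub1 _ _)
    size2 : 10 ≤ length (sub 2 u v)
    size2 = sub-suc≥ 1 u v (kids≥3 u hv) sub1≥3
    size3 : 22 ≤ length (sub 3 v u)
    size3 = sub-suc≥ 2 {7} {3} v u (kids≥3 v hu) λ a∈ →
      sub-suc≥ 1 {3} {2} u _ (3≤deg⇒2≤kids u (md (active-∼ (proj₁ (∈kids⁻ a∈))))) sub1≥3

  girth7-core : NoClosed 7 → Bound 29 → MinDeg3 G → ¬ ¬ Col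
  girth7-core nc b md nocol = lowOddCycle (noHighEdge7 nc md b) nocol λ C → remove C (detach md C)
    where
    nc6 : NoClosed 6
    nc6 = noClosed-mono (n≤1+n 6) nc
    open ShortCycles nc6
    remove : (C : OddCycle Low) → Detached C → ⊥
    remove C D = separation7 y y′ F
      ( ⊑-noClosed {G = unlink y y′ F} {H = G} (λ e → proj₁ (unlinked-⊑ nc6 D e)) nc
      , (λ le w → apart le (⊑-path {G = unlink y y′ F} {H = G ∖ cyc C} (unlinked-⊑ nc6 D) w))
      , linked-bound nc6 D b) (λ c → nocol (linked-col nc6 D c))
      where
      open Detached D
      F : Graph n
      F = linked nc6 D
      off : ∀ {x z} → x ∈ cyc C → z ∉ cyc C → x ≢ z
      off x∈ z∉ refl = z∉ x∈
      adjacent : ¬ y ∼ y′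
      adjacent e = no4 c∼y e (∼-sym c′∼y′) (∼-sym c∼c′) (off c∈ y′∉) (off c′∈ y∉ ∘ ≡.sym)
      -- The path through `c` and `c′` has length 3, so a path of length at most 3 closes a walk of
      -- length at most 6.
      apart : ∀ {j} → j ≤ 3 → ¬ OddCycles.Walk (G ∖ cyc C) (λ _ → ⊤) y y′ j
      apart _ (OddCycles.nil _) = no3 c∼c′ c′∼y′ (∼-sym c∼y)
      apart _ (OddCycles.cons _ (e , _) (OddCycles.nil _)) = adjacent e
      apart _ (OddCycles.cons _ (e , _) (OddCycles.cons _ (e′ , _) (OddCycles.nil _))) =
        no5 c∼y e e′ (∼-sym c′∼y′) (∼-sym c∼c′)
      apart _ (OddCycles.cons _ (e , _ , a∉) (OddCycles.cons _ (e′ , _ , b∉) (OddCycles.cons _ (e″ , _) (OddCycles.nil _)))) =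
        nc {k = 5} ≤-refl (step c∼y (∼⇒≢ (∼-sym c∼y)) (step e (off c∈ a∉ ∘ ≡.sym) (step e′ (λ { refl → adjacent e″ })
          (step e″ (λ { refl → adjacent e }) (step (∼-sym c′∼y′) (off c′∈ b∉) (step (∼-sym c∼c′) (off c∈ y′∉) stop))))))
      apart (s≤s (s≤s (s≤s ()))) (OddCycles.cons _ _ (OddCycles.cons _ _ (OddCycles.cons _ _ (OddCycles.cons _ _ _))))

girth7-colourable : ∀ {n} (G : Graph n) → Neighbourhoods.NoClosed G 7 → Neighbourhoods.Bound G 29 → ¬ ¬ Neighbourhoods.Col G
girth7-colourable G nc b = reduceToCore (λ G → Neighbourhoods.NoClosed G 7 × Neighbourhoods.Bound G 29)
  (λ {G} {v} (nc , b) → ⊑-noClosed {G = G ∖ (v ∷ [])} {H = G} proj₁ nc , ⊑-bound {G = G ∖ (v ∷ [])} {H = G} proj₁ b)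
  (λ G (nc , b) → girth7-core G nc b) 29 G b (nc , b)

-- From girth to closed walks, and the two bounds

lookup-injective : ∀ {A : Set} {xs : List A} → Unique xs → ∀ {i j} → lookup xs i ≡ lookup xs j → i ≡ j
lookup-injective {xs = _ ∷ _}  _        {zero}  {zero}  _  = refl
lookup-injective {xs = _ ∷ xs} (ne ∷ _) {zero}  {suc j} eq = contradiction eq (All.lookup ne (∈-lookup j))
lookup-injective {xs = _ ∷ xs} (ne ∷ _) {suc i} {zero}  eq = contradiction (≡.sym eq) (All.lookup ne (∈-lookup i))
lookup-injective {xs = _ ∷ _}  (_ ∷ u)  {suc i} {suc j} eq = cong suc (lookup-injective u eq)

-- The lengths in question are at most 6, where a closed walk that backtracks at most at its base is
-- a cycle, or a coincidence of its vertices cuts off a triangle or a 4-cycle.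
girth⇒noClosed : ∀ {n} (G : Graph n) {g} → g ≤ 7 → GirthAtLeast G g → Neighbourhoods.NoClosed G g
girth⇒noClosed {n} G {g} g≤7 girth = noClosed
  where
  open Neighbourhoods G
  cycle3 : ∀ {a b c} → 3 < g → a ∼ b → b ∼ c → c ∼ a → ⊥
  cycle3 {a} {b} {c} lt ab bc ca = girth 2 (lookup (a ∷ b ∷ c ∷ [])) ≤-refl lt
    ( lookup-injective ((∼⇒≢ ab ∷ ∼⇒≢ (∼-sym ca) ∷ []) ∷ (∼⇒≢ bc ∷ []) ∷ [] ∷ [])
    , (λ { 0F → ab ; 1F → bc }) , ca)
  cycle4 : ∀ {a b c d} → 4 < g → a ∼ b → b ∼ c → c ∼ d → d ∼ a → a ≢ c → b ≢ d → ⊥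
  cycle4 {a} {b} {c} {d} lt ab bc cd da a≢c b≢d = girth 3 (lookup (a ∷ b ∷ c ∷ d ∷ [])) (s≤s (s≤s (s≤s z≤n))) lt
    ( lookup-injective ((∼⇒≢ ab ∷ a≢c ∷ ∼⇒≢ (∼-sym da) ∷ []) ∷ (∼⇒≢ bc ∷ b≢d ∷ []) ∷ (∼⇒≢ cd ∷ []) ∷ [] ∷ [])
    , (λ { 0F → ab ; 1F → bc ; 2F → cd }) , da)
  noClosed : NoClosed g
  noClosed {k = 0} lt (step e _ stop) = ∼⇒≢ e refl
  noClosed {k = 1} lt (step _ _ (step _ ne stop)) = ne refl
  noClosed {k = 2} lt (step ab _ (step bc _ (step ca _ stop))) = cycle3 lt ab bc ca
  noClosed {k = 3} lt (step ab _ (step bc ac (step cd bd (step da _ stop)))) = cycle4 lt ab bc cd da (ac ∘ ≡.sym) (bd ∘ ≡.sym)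
  noClosed {k = 4} lt (step {a = a} {b} ab _ (step {b = c} bc ac (step {b = d} cd bd (step {b = e} de ce (step ea ad stop))))) =
    girth 4 (lookup (a ∷ b ∷ c ∷ d ∷ e ∷ [])) (s≤s (s≤s (s≤s z≤n))) lt
      ( lookup-injective ((∼⇒≢ ab ∷ ac ∘ ≡.sym ∷ ad ∷ ∼⇒≢ (∼-sym ea) ∷ []) ∷
          (∼⇒≢ bc ∷ bd ∘ ≡.sym ∷ (λ { refl → cycle3 3<g bc cd de }) ∷ []) ∷ (∼⇒≢ cd ∷ ce ∘ ≡.sym ∷ []) ∷ (∼⇒≢ de ∷ []) ∷ [] ∷ [])
      , (λ { 0F → ab ; 1F → bc ; 2F → cd ; 3F → de }) , ea)
    where
    3<g : 3 < g
    3<g = ≤-trans (m≤n+m 4 2) lt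
  noClosed {k = 5} lt (step {a = a} {b} ab _ (step {b = c} bc ac (step {b = d} cd bd (step {b = e} de ce (step {b = f} ef df (step fa ea stop)))))) =
    girth 5 (lookup (a ∷ b ∷ c ∷ d ∷ e ∷ f ∷ [])) (s≤s (s≤s (s≤s z≤n))) lt
      ( lookup-injective ((∼⇒≢ ab ∷ ac ∘ ≡.sym ∷ (λ { refl → cycle3 3<g ab bc cd }) ∷ ea ∷ ∼⇒≢ (∼-sym fa) ∷ []) ∷
          (∼⇒≢ bc ∷ bd ∘ ≡.sym ∷ (λ { refl → cycle3 3<g bc cd de }) ∷ (λ { refl → cycle4 4<g bc cd de ef (bd ∘ ≡.sym) (ce ∘ ≡.sym) }) ∷ []) ∷
          (∼⇒≢ cd ∷ ce ∘ ≡.sym ∷ (λ { refl → cycle3 3<g cd de ef }) ∷ []) ∷ (∼⇒≢ de ∷ df ∘ ≡.sym ∷ []) ∷ (∼⇒≢ ef ∷ []) ∷ [] ∷ [])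
      , (λ { 0F → ab ; 1F → bc ; 2F → cd ; 3F → de ; 4F → ef }) , fa)
    where
    3<g : 3 < g
    3<g = ≤-trans (m≤n+m 4 3) lt
    4<g : 4 < g
    4<g = ≤-trans (m≤n+m 5 2) lt
  noClosed {k = suc (suc (suc (suc (suc (suc _)))))} lt _ = ≤-absurd {8} {7} (≤-trans (m≤m+n 8 _) (≤-trans lt g≤7))

bound-order : ∀ {n k} (G : Graph n) → n ≤ k → Neighbourhoods.Bound G k
bound-order {n} G le xs u _ = ≤-trans (unique⊆⇒length≤ u (λ _ → ∈-allFin _)) (≤-trans (≤-reflexive (length-tabulate {n = n} id)) le)

theorem4 : (∀ (n : ℕ) (G : Graph n) → HasChromaticNumber G 4 → GirthAtLeast G 6 → 26 ≤ n)
    × (∀ (n : ℕ) (G : Graph n) → HasChromaticNumber G 4 → GirthAtLeast G 7 → 30 ≤ n)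
theorem4 =
    (λ n G (_ , ¬col) girth → ≰⇒> λ n≤ → girth6-colourable G (girth⇒noClosed G (n≤1+n 6) girth) (bound-order G n≤) ¬col)
  , (λ n G (_ , ¬col) girth → ≰⇒> λ n≤ → girth7-colourable G (girth⇒noClosed G ≤-refl girth) (bound-order G n≤) ¬col)
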